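{- If $G$ is a contractible graph, then $\phi(G)=\mathrm{SDet}(A)=1$. If $G$ is a $d$-sphere with $d\ge0$, then $\phi(G)=\mathrm{SDet}(C)=1$. Here $A$ is the Dirac operator of $G$ with the first row and column deleted, and $C$ is the Dirac operator of $G$ with the first and last rows and the first and last columns deleted.
   Context: Let $G=(V,E)$ be a finite simple graph. A $k$-simplex of $G$ is (the vertex set of) a complete subgraph $K_{k+1}$; $f_k$ is the number of $k$-simplices. Order the vertices; for a $(k+1)$-simplex $x=\{v_0<\dots<v_{k+1}\}$ and $y=x\setminus\{v_i\}$ put $\mathrm{sign}(y,x)=(-1)^i$. The exterior derivative $d_k$ is the $f_{k+1}\times f_k$ matrix given by $d_kf(x)=\sum_{y\subset x,\ \dim y=k}\mathrm{sign}(y,x)f(y)$. These assemble to an $n\times n$ matrix $d$ on functions on all $n=\sum_kf_k$ simplices, and $D=d+d^*$ is the Dirac operator. The simplices indexing rows and columns are ordered by increasing dimension, so the first index is a vertex and the last index is a simplex of maximal dimension. The pseudo determinant $\mathrm{Det}(M)$ of a square matrix $M$ is the product of its non-zero eigenvalues, counted with multiplicity (equal to $1$ if there are none, in particular for an empty matrix). For a matrix of the form $T=e+e^*$ obtained from $D$ by deleting rows and the corresponding columns, let $e_k$ be the matrix obtained from $d_k$ by deleting the columns and rows indexed by deleted simplices; then $\mathrm{SDet}(T)=\prod_k\mathrm{Det}(e_k^*e_k)^{(-1)^k}$. Define $\phi(G)=\mathrm{SDet}(A)$ for contractible $G$ and $\phi(G)=\mathrm{SDet}(C)$ for spheres $G$.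 The unit sphere $S(v)$ of a vertex $v$ is the subgraph induced by the neighbors of $v$; $G-v$ is the subgraph induced by $V\setminus\{v\}$. Contractible graphs are defined inductively: the one-point graph $K_1$ is contractible, and $G$ is contractible if there is a vertex $v$ such that both $S(v)$ and $G-v$ are contractible. Spheres are defined inductively: the empty graph is the $(-1)$-sphere, and for $k\ge0$ a $k$-sphere is a graph all of whose unit spheres are $(k-1)$-spheres and such that $G-v$ is contractible for some vertex $v$. -}

module Defs where

open import Level using (0ℓ; _⊔_)
open import Algebra.Bundles using (CommutativeRing; Semiring)
open import Algebra.Apartness.Bundles using (HeytingField; module HeytingCommutativeRing)
import Algebra.Apartness.Properties.HeytingCommutativeRing as HeytingProperties
import Algebra.Definitions.RawSemiring as RawSemiring
open import Data.Bool.Properties using () renaming (_≟_ to _≟ᵇ_)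
open import Data.Fin.Base using (Fin; zero; suc; toℕ; inject₁; punchIn; _≤_)
open import Data.Fin.Properties using (any?; _<?_; _≟_)
open import Data.Fin.Subset using (Subset; _∈_; _∩_; ⁅_⁆; ⊤; ∣_∣; Nonempty; Empty)
  renaming (_-_ to _∖_)
open import Data.Fin.Subset.Properties using (_∈?_; ∣p∣≤n; x∈p⇒∣p-x∣<∣p∣)
open import Data.List.Base using (List; filter; allFin; length; lookup)
open import Data.Nat.Base as ℕ using (ℕ; zero; suc; pred)
import Data.Nat.Properties as ℕₚ
open import Data.Product.Base using (∃; _×_; _,_; proj₁; proj₂)
open import Data.Sum.Base using (_⊎_; inj₁; inj₂)
open import Data.Vec.Base using (tabulate)
open import Data.Vec.Properties using (≡-dec)
open import Function.Base using (_∘_)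
open import Function.Definitions using (Injective)
open import Relation.Binary.Core using (Rel)
open import Relation.Binary.Definitions using (Decidable; DecidableEquality; Symmetric; Irreflexive)
open import Relation.Binary.PropositionalEquality.Core using (_≡_; _≢_)
open import Relation.Nullary.Decidable using (Dec; yes; no; does; _×-dec_)

private
  variable
    n : ℕ

-- The vertices are ordered by the order of Fin n.
record Graph (n : ℕ) : Set₁ where
  infix 4 _~_ _~?_
  field
    _~_      : Rel (Fin n) 0ℓ
    _~?_     : Decidable _~_
    ~-sym    : Symmetric _~_
    ~-irrefl : Irreflexive _≡_ _~_

  neighbours : Fin n → Subset n
  neighbours v = tabulate λ u → does (v ~? u)

module _ (G : Graph n) where
  open Graph G

  -- Induced subgraphs are represented by their vertex sets: in the
  -- subgraph induced by W, the unit sphere of v is induced by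
  -- W ∩ neighbours v, and the complement of v by W ∖ v.

  data Contractible[_] : Subset n → Set where
    one-point : ∀ {W} v → W ≡ ⁅ v ⁆ → Contractible[ W ]
    extend    : ∀ {W} v → v ∈ W →
                Contractible[ W ∩ neighbours v ] → Contractible[ W ∖ v ] →
                Contractible[ W ]

  -- The number is one more than the dimension: Sphere[ suc d , W ] says
  -- that W induces a d-sphere, and Sphere[ 0 , W ] a (-1)-sphere.
  Sphere[_,_] : ℕ → Subset n → Set
  Sphere[ zero  , W ] = Empty W
  Sphere[ suc d , W ] =
    (∀ v → v ∈ W → Sphere[ d , W ∩ neighbours v ]) ×
    (∃ λ v → v ∈ W × Contractible[ W ∖ v ])

  Contractible : Set
  Contractible = Contractible[ ⊤ ]

  -- As above, the dimension is shifted by one.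
  Sphere : ℕ → Set
  Sphere d+1 = Sphere[ d+1 , ⊤ ]

module _ (G : Graph n) where
  open Graph G

  IsSimplex : Subset n → Set
  IsSimplex x = Nonempty x × (∀ {u v} → u ∈ x → v ∈ x → u ≢ v → u ~ v)

dim : Subset n → ℕ
dim x = pred ∣ x ∣

dim<n : (x : Subset n) → Nonempty x → dim x ℕ.< n
dim<n x (v , v∈x) = ℕₚ.<-≤-trans (lemma (ℕₚ.≤-<-trans ℕ.z≤n (x∈p⇒∣p-x∣<∣p∣ v∈x))) (∣p∣≤n x)
  where
  lemma : ∀ {k} → 0 ℕ.< k → pred k ℕ.< k
  lemma (ℕ.s≤s _) = ℕₚ.≤-refl

_≟ˢ_ : DecidableEquality (Subset n)
_≟ˢ_ = ≡-dec _≟ᵇ_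

facet? : (y x : Subset n) → Dec (∃ λ v → v ∈ x × y ≡ x ∖ v)
facet? y x = any? λ v → (v ∈? x) ×-dec (y ≟ˢ (x ∖ v))

-- The index i of v = vᵢ in x = {v₀ < v₁ < …}.
position : Fin n → Subset n → ℕ
position v x = ∣ x ∩ tabulate (λ u → does (u <? v)) ∣

record SimplexOrder (G : Graph n) (N : ℕ) : Set where
  field
    simplex   : Fin N → Subset n
    isSimplex : ∀ i → IsSimplex G (simplex i)
    injective : Injective _≡_ _≡_ simplex
    complete  : ∀ {x} → IsSimplex G x → ∃ λ i → simplex i ≡ x
    monotone  : ∀ {i j} → i ≤ j → dim (simplex i) ℕ.≤ dim (simplex j)

notFirst : ∀ {N} → Fin (pred N) → Fin N
notFirst {suc N} = suc

notLast : ∀ {N} → Fin (pred N) → Fin N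
notLast {suc N} = inject₁

-- The scalars form an arbitrary Heyting field of characteristic zero, such as
-- ℝ or ℂ, since the library has no real numbers.
module _ {c ℓ₁ ℓ₂} (K : HeytingField c ℓ₁ ℓ₂) where
  open HeytingField K
  open HeytingCommutativeRing heytingCommutativeRing using (commutativeRing)
  open CommutativeRing commutativeRing using (semiring)
  open RawSemiring (Semiring.rawSemiring semiring) using () renaming (_×_ to _⋆_)

  CharZero : Set ℓ₂
  CharZero = ∀ m → (suc m ⋆ 1#) # 0#

module LinearAlgebra {c ℓ₁ ℓ₂} (K : HeytingField c ℓ₁ ℓ₂) where
  open HeytingField K hiding (zero)
  open HeytingCommutativeRing heytingCommutativeRing using (commutativeRing)
  open CommutativeRing commutativeRing using (semiring)
  open RawSemiring (Semiring.rawSemiring semiring)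
    using (_^_) renaming (sum to ∑; product to ∏)
  open HeytingProperties heytingCommutativeRing using (1#0; x#0y#0→xy#0)

  Matrix : ℕ → ℕ → Set c
  Matrix p q = Fin p → Fin q → Carrier

  -- The entries that occur are integers, so the adjoint is the transpose.
  _† : ∀ {p q} → Matrix p q → Matrix q p
  (M †) i j = M j i

  _·_ : ∀ {p q r} → Matrix p q → Matrix q r → Matrix p r
  (M · N) i k = ∑ λ j → M i j * N j k

  det : ∀ {m} → Matrix m m → Carrier
  det {zero}  M = 1#
  det {suc m} M = ∑ λ j →
    (- 1#) ^ toℕ j * (M zero j * det λ i k → M (suc i) (punchIn j k))

  scalar : ∀ {m} → Carrier → Matrix m m
  scalar t i j with i ≟ j
  ... | yes _ = t
  ... | no  _ = 0#

  -- The eigenvalues of M with multiplicity.  K is infinite, so requiring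
  -- the characteristic polynomial to split as a function of t is the same
  -- as requiring it as a polynomial.  As equality in K need not be
  -- decidable, each eigenvalue is given as zero or as apart from zero.
  record Spectrum {m} (M : Matrix m m) : Set (c ⊔ ℓ₁ ⊔ ℓ₂) where
    field
      eigenvalue : Fin m → Carrier
      charPoly   : ∀ t → det (λ i j → scalar t i j - M i j) ≈ ∏ λ i → t - eigenvalue i
      zero?      : ∀ i → eigenvalue i ≈ 0# ⊎ eigenvalue i # 0#

    nonzeroFactor : Fin m → Carrier
    nonzeroFactor i with zero? i
    ... | inj₁ _ = 1#
    ... | inj₂ _ = eigenvalue i

    nonzeroFactor#0 : ∀ i → nonzeroFactor i # 0#
    nonzeroFactor#0 i with zero? i
    ... | inj₁ _   = 1#0
    ... | inj₂ λ#0 = λ#0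

  ∏#0 : ∀ {m} (f : Fin m → Carrier) → (∀ i → f i # 0#) → ∏ f # 0#
  ∏#0 {zero}  f f#0 = 1#0
  ∏#0 {suc m} f f#0 = x#0y#0→xy#0 (f#0 zero) (∏#0 (f ∘ suc) (f#0 ∘ suc))

  Det : ∀ {m} (M : Matrix m m) → Spectrum M → Carrier
  Det M s = ∏ (Spectrum.nonzeroFactor s)

  Det#0 : ∀ {m} (M : Matrix m m) (s : Spectrum M) → Det M s # 0#
  Det#0 M s = ∏#0 _ (Spectrum.nonzeroFactor#0 s)

  inverse : ∀ x → x # 0# → Carrier
  inverse x x#0 = proj₁ (#⇒invertible x#0)

  -- x raised to the power (-1)ᵏ.
  alternate : ℕ → ∀ x → x # 0# → Carrier
  alternate zero          x x#0 = x
  alternate (suc zero)    x x#0 = inverse x x#0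
  alternate (suc (suc k)) x x#0 = alternate k x x#0

  -- A square matrix whose indices have degrees below n; for the Dirac
  -- operator the degree of a simplex is its dimension.
  record GradedMatrix (n : ℕ) : Set c where
    field
      size     : ℕ
      degree   : Fin size → ℕ
      degree<n : ∀ i → degree i ℕ.< n
      entry    : Matrix size size

    ofDegree : ℕ → List (Fin size)
    ofDegree k = filter (λ i → degree i ℕₚ.≟ k) (allFin size)

    -- The block of e in T = e + e †: columns of degree k, rows of degree k + 1.
    e : ∀ k → Matrix (length (ofDegree (suc k))) (length (ofDegree k))
    e k i j = entry (lookup (ofDegree (suc k)) i) (lookup (ofDegree k) j)

    e†e : ∀ k → Matrix (length (ofDegree k)) (length (ofDegree k))
    e†e k = (e k †) · e k

  submatrix : (T : GradedMatrix n) {m : ℕ} → (Fin m → Fin (GradedMatrix.size T)) → GradedMatrix n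
  submatrix T {m} ι = record
    { size     = m
    ; degree   = degree ∘ ι
    ; degree<n = degree<n ∘ ι
    ; entry    = λ i j → entry (ι i) (ι j)
    } where open GradedMatrix T

  Spectra : GradedMatrix n → Set (c ⊔ ℓ₁ ⊔ ℓ₂)
  Spectra {n} T = (k : Fin n) → Spectrum (GradedMatrix.e†e T (toℕ k))

  SDet : (T : GradedMatrix n) → Spectra T → Carrier
  SDet T s = ∏ λ k → alternate (toℕ k) (Det _ (s k)) (Det#0 _ (s k))

  incidence : (y x : Subset n) → Carrier
  incidence y x with facet? y x
  ... | yes (v , _) = (- 1#) ^ position v x
  ... | no  _       = 0#

  module _ {G : Graph n} {N : ℕ} (σ : SimplexOrder G N) where
    open SimplexOrder σ

    exteriorDerivative : Matrix N N
    exteriorDerivative i j = incidence (simplex j) (simplex i)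

    Dirac : GradedMatrix n
    Dirac = record
      { size     = N
      ; degree   = dim ∘ simplex
      ; degree<n = λ i → dim<n (simplex i) (proj₁ (isSimplex i))
      ; entry    = λ i j → exteriorDerivative i j + (exteriorDerivative †) i j
      }

    DiracA : GradedMatrix n
    DiracA = submatrix Dirac notFirst

    DiracC : GradedMatrix n
    DiracC = submatrix Dirac (notFirst ∘ notLast)

    ContractibleOrSphere : Set
    ContractibleOrSphere = Contractible G ⊎ ∃ (Sphere G)

    reduced : ContractibleOrSphere → GradedMatrix n
    reduced (inj₁ _) = DiracA
    reduced (inj₂ _) = DiracC

    φ : (γ : ContractibleOrSphere) → Spectra (reduced γ) → Carrier
    φ γ = SDet (reduced γ)

{-# OPTIONS --safe #-}
-- Let e be the coboundary of the complex of the simplices that are kept, that is,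
-- relative to the first vertex.  The augmented chain complex of a contractible graph
-- is acyclic over ℤ, and a sphere has a fundamental cycle with coefficient ±1 at every
-- facet, so that it becomes acyclic when one facet is removed.  Hence e has an integral
-- contraction h with h e + e h = 1 and h h = 0.
--
-- Put Q = e h, P = h e and B = e† e + Q.  The factorisation
--   t + e† e = (e† e + t P + Q) (P + t Q)
-- shows that Det (e† e) = det B in each degree.  Between the even and the odd part of
-- the complex let D = e + e† and W = e + h.  Then D† W is block triangular with
-- the blocks B of even degree on the diagonal, and D W⁻¹ likewise with those of odd degree.
-- As W and W⁻¹ are integral, det W = det W⁻¹ = ±1, so both products of det B are equal.

module Submission where

open import Defs
open import Algebra.Apartness.Bundles using (HeytingField; module HeytingCommutativeRing)
import Algebra.Definitions.RawSemiring as RawSemiring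
open import Level using (_⊔_)
open import Algebra.Bundles using (CommutativeRing; Semiring)
open import Data.Nat.Base as ℕ using (ℕ; zero; suc)
open import Data.Fin.Base as Fin using (Fin; zero; suc)
open import Data.Product.Base using (∃; _×_; _,_; proj₁; proj₂)
open import Data.Sum.Base using (_⊎_; inj₁; inj₂)
open import Function.Base using (_∘_)
open import Relation.Binary.PropositionalEquality as ≡ using (_≡_; _≢_; cong; cong₂; subst)
open import Relation.Nullary using (¬_; Dec; yes; no)
open import Relation.Nullary.Negation using (contradiction)

-- The scalars form a field `K` without an order, so the decisive facts are proved over ℤ and
-- carried over by characteristic zero. Positivity of sums of squares makes every B nonsingular.
-- Units matter as well: over a field det W det W⁻¹ = 1 would not make the two determinants equal,
-- whereas over ℤ it does. Hence h must have integer entries, and acyclicity over ℤ is required. A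
-- fundamental cycle with coefficient c at the removed facet would leave torsion ℤ/c, so
-- coefficients ±1 are essential. Multiplicities are the other obstacle. A spectrum only says how
-- the characteristic polynomial splits as a function, and det (P + t Q) must be shown to be exactly
-- the power of t contributed by the zero eigenvalues. Neither ranks nor diagonalisation are
-- available for this; it follows from multiplicativity of P + t Q in t and from the fact that a
-- polynomial function vanishing at 1, 2, ... vanishes at 0.

-- The canonical homomorphism from the integers to a commutative ring.

module IntegerMultiples {c ℓ} (R : CommutativeRing c ℓ) where
  open CommutativeRing R
  open import Algebra.Properties.Ring ring
  open import Algebra.Properties.AbelianGroup +-abelianGroup using (⁻¹-∙-comm)
  open import Algebra.Properties.Semiring.Mult semiring
    using (×-homo-+; ×1-homo-*) renaming (_×_ to _⋆_)
  open import Relation.Binary.Reasoning.Setoid setoid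
  open import Data.Integer.Base as ℤ using (ℤ; +_; -[1+_]; _⊖_)
  import Data.Integer.Properties as ℤₚ

  fromℤ : ℤ → Carrier
  fromℤ (+ n)      = n ⋆ 1#
  fromℤ (-[1+ n ]) = - (suc n ⋆ 1#)

  fromℤ-neg : ∀ i → fromℤ (ℤ.- i) ≈ - fromℤ i
  fromℤ-neg (+ zero)   = sym -0#≈0#
  fromℤ-neg (+ suc n)  = refl
  fromℤ-neg (-[1+ n ]) = sym (-‿involutive _)

  fromℤ-⊖ : ∀ m n → fromℤ (m ⊖ n) ≈ m ⋆ 1# - n ⋆ 1#
  fromℤ-⊖ zero    zero    = sym (-‿inverseʳ _)
  fromℤ-⊖ zero    (suc n) = sym (+-identityˡ _)
  fromℤ-⊖ (suc m) zero    = sym (trans (+-congˡ -0#≈0#) (+-identityʳ _))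
  fromℤ-⊖ (suc m) (suc n) = begin
    fromℤ (suc m ⊖ suc n)  ≡⟨ cong fromℤ (ℤₚ.[1+m]⊖[1+n]≡m⊖n m n) ⟩
    fromℤ (m ⊖ n)  ≈⟨ fromℤ-⊖ m n ⟩
    m ⋆ 1# - n ⋆ 1#  ≈⟨ +-congʳ (+-identityˡ _) ⟨
    (0# + m ⋆ 1#) - n ⋆ 1#  ≈⟨ +-congʳ (+-congʳ (-‿inverseʳ 1#)) ⟨
    ((1# - 1#) + m ⋆ 1#) - n ⋆ 1#  ≈⟨ +-congʳ (+-assoc _ _ _) ⟩
    (1# + (- 1# + m ⋆ 1#)) - n ⋆ 1#  ≈⟨ +-congʳ (+-congˡ (+-comm _ _)) ⟩
    (1# + (m ⋆ 1# - 1#)) - n ⋆ 1#  ≈⟨ +-congʳ (+-assoc _ _ _) ⟨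
    ((1# + m ⋆ 1#) - 1#) - n ⋆ 1#  ≈⟨ +-assoc _ _ _ ⟩
    (1# + m ⋆ 1#) + (- 1# - n ⋆ 1#)  ≈⟨ +-congˡ (⁻¹-∙-comm _ _) ⟩
    (1# + m ⋆ 1#) - (1# + n ⋆ 1#)  ∎

  fromℤ-+ : ∀ i j → fromℤ (i ℤ.+ j) ≈ fromℤ i + fromℤ j
  fromℤ-+ (+ m)      (+ n)      = ×-homo-+ 1# m n
  fromℤ-+ (+ m)      (-[1+ n ]) = fromℤ-⊖ m (suc n)
  fromℤ-+ (-[1+ m ]) (+ n)      = trans (fromℤ-⊖ n (suc m)) (+-comm _ _)
  fromℤ-+ (-[1+ m ]) (-[1+ n ]) = begin
    - (suc (suc (m ℕ.+ n)) ⋆ 1#)  ≡⟨ cong (λ k → - (suc k ⋆ 1#)) (≡.sym (ℕₚ.+-suc m n)) ⟩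
    - ((suc m ℕ.+ suc n) ⋆ 1#)  ≈⟨ -‿cong (×-homo-+ 1# (suc m) (suc n)) ⟩
    - (suc m ⋆ 1# + suc n ⋆ 1#)  ≈⟨ ⁻¹-∙-comm _ _ ⟨
    - (suc m ⋆ 1#) - suc n ⋆ 1#  ∎
    where import Data.Nat.Properties as ℕₚ

  private
    fromℤ-pos* : ∀ m j → fromℤ (+ m ℤ.* j) ≈ m ⋆ 1# * fromℤ j
    fromℤ-pos* m (+ n) = begin
      fromℤ (+ m ℤ.* + n)  ≡⟨ cong fromℤ (≡.sym (ℤₚ.pos-* m n)) ⟩
      (m ℕ.* n) ⋆ 1#  ≈⟨ ×1-homo-* m n ⟩
      m ⋆ 1# * (n ⋆ 1#)  ∎
    fromℤ-pos* m j@(-[1+ n ]) = begin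
      fromℤ (+ m ℤ.* j)  ≡⟨ cong fromℤ (≡.sym (ℤₚ.neg-distribʳ-* (+ m) (+ suc n))) ⟩
      fromℤ (ℤ.- (+ m ℤ.* + suc n))  ≈⟨ fromℤ-neg (+ m ℤ.* + suc n) ⟩
      - fromℤ (+ m ℤ.* + suc n)  ≈⟨ -‿cong (fromℤ-pos* m (+ suc n)) ⟩
      - (m ⋆ 1# * (suc n ⋆ 1#))  ≈⟨ -‿distribʳ-* _ _ ⟩
      m ⋆ 1# * fromℤ j  ∎

  fromℤ-* : ∀ i j → fromℤ (i ℤ.* j) ≈ fromℤ i * fromℤ j
  fromℤ-* (+ m)        j = fromℤ-pos* m j
  fromℤ-* i@(-[1+ m ]) j = begin
    fromℤ (i ℤ.* j)  ≡⟨ cong fromℤ (≡.sym (ℤₚ.neg-distribˡ-* (+ suc m) j)) ⟩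
    fromℤ (ℤ.- (+ suc m ℤ.* j))  ≈⟨ fromℤ-neg (+ suc m ℤ.* j) ⟩
    - fromℤ (+ suc m ℤ.* j)  ≈⟨ -‿cong (fromℤ-pos* (suc m) j) ⟩
    - (fromℤ (+ suc m) * fromℤ j)  ≈⟨ -‿distribˡ-* _ _ ⟩
    fromℤ i * fromℤ j  ∎

  -- Integer coefficients have decidable equality, so that the solver can
  -- cancel terms although equality in R need not be decidable.
  module Solver where
    open import Algebra.Solver.Ring.AlmostCommutativeRing
      using (fromCommutativeRing; _-Raw-AlmostCommutative⟶_)
    open import Data.Maybe.Base using (Maybe; just; nothing)

    morphism : CommutativeRing.rawRing ℤₚ.+-*-commutativeRing
               -Raw-AlmostCommutative⟶ fromCommutativeRing R
    morphism = record
      { ⟦_⟧    = fromℤ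
      ; +-homo = fromℤ-+
      ; *-homo = fromℤ-*
      ; -‿homo = fromℤ-neg
      ; 0-homo = refl
      ; 1-homo = +-identityʳ 1#
      }

    coeff≟ : ∀ i j → Maybe (fromℤ i ≈ fromℤ j)
    coeff≟ i j with i ℤₚ.≟ j
    ... | yes i≡j = just (reflexive (cong fromℤ i≡j))
    ... | no  _   = nothing

    open import Algebra.Solver.Ring _ (fromCommutativeRing R) morphism coeff≟ public
      using (solve; _:=_; _:+_; _:*_; _:-_; :-_; con)

-- Matrices, and determinants by expansion along the first row.

module Matrices {c ℓ} (R : CommutativeRing c ℓ) where
  open CommutativeRing R hiding (zero)
  open RawSemiring (Semiring.rawSemiring semiring) using (_^_)
  open import Algebra.Properties.Ring ring
  import Algebra.Properties.Semiring.Sum semiring as Sum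
  open IntegerMultiples R
  open Solver
  open import Data.Fin.Base using (toℕ; punchIn; _↑ˡ_; _↑ʳ_)
  open import Relation.Binary.Reasoning.Setoid setoid

  private
    variable
      m n p q r : ℕ

  -- Opaque, since otherwise the summand cannot be inferred from the sum.
  opaque
    ∑ : (Fin m → Carrier) → Carrier
    ∑ = Sum.sum

    ∑≡sum : (f : Fin m → Carrier) → ∑ f ≡ Sum.sum f
    ∑≡sum f = ≡.refl

    ∑-[] : (f : Fin 0 → Carrier) → ∑ f ≡ 0#
    ∑-[] f = ≡.refl

    ∑-∷ : (f : Fin (suc m) → Carrier) → ∑ f ≡ f zero + ∑ (f ∘ suc)
    ∑-∷ f = ≡.refl

    ∑-cong : {f g : Fin m → Carrier} → (∀ i → f i ≈ g i) → ∑ f ≈ ∑ g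
    ∑-cong = Sum.sum-cong-≋

    ∑-+ : (f g : Fin m → Carrier) → ∑ (λ i → f i + g i) ≈ ∑ f + ∑ g
    ∑-+ = Sum.∑-distrib-+

    ∑-comm : (f : Fin m → Fin n → Carrier) → ∑ (λ i → ∑ λ j → f i j) ≈ ∑ (λ j → ∑ λ i → f i j)
    ∑-comm = Sum.∑-comm

    *-∑ : ∀ x (f : Fin m → Carrier) → x * ∑ f ≈ ∑ λ i → x * f i
    *-∑ = Sum.*-distribˡ-sum

    ∑-* : ∀ x (f : Fin m → Carrier) → ∑ f * x ≈ ∑ λ i → f i * x
    ∑-* = Sum.*-distribʳ-sum

    ∑-zero : (f : Fin m → Carrier) → (∀ i → f i ≈ 0#) → ∑ f ≈ 0#
    ∑-zero {m} f f≈0 = trans (Sum.sum-cong-≋ f≈0) (Sum.sum-replicate-zero m)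

    ∑-neg : (f : Fin m → Carrier) → ∑ (λ i → - f i) ≈ - ∑ f
    ∑-neg {zero}  f = sym -0#≈0#
    ∑-neg {suc m} f = trans (+-congˡ (∑-neg (f ∘ suc)))
      (solve 2 (λ a b → :- a :+ :- b := :- (a :+ b)) refl _ _)

    ∑-split : ∀ m {n} (f : Fin (m ℕ.+ n) → Carrier) →
              ∑ f ≈ ∑ (λ i → f (i ↑ˡ n)) + ∑ (λ j → f (m ↑ʳ j))
    ∑-split zero    f = sym (+-identityˡ _)
    ∑-split (suc m) f = trans (+-congˡ (∑-split m (f ∘ suc))) (sym (+-assoc _ _ _))

  Matrix : ℕ → ℕ → Set c
  Matrix p q = Fin p → Fin q → Carrier

  infix 4 _≋_
  _≋_ : Matrix p q → Matrix p q → Set ℓ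
  M ≋ N = ∀ i j → M i j ≈ N i j

  infixl 8 _†
  _† : Matrix p q → Matrix q p
  (M †) i j = M j i

  infixl 7 _·_
  _·_ : Matrix p q → Matrix q r → Matrix p r
  (M · N) i k = ∑ λ j → M i j * N j k

  infixl 6 _⊞_
  _⊞_ : Matrix p q → Matrix p q → Matrix p q
  (M ⊞ N) i j = M i j + N i j

  𝟘 : Matrix p q
  𝟘 _ _ = 0#

  -- With recursion on both indices instead of a decision `i ≟ j`, deleting the first row and column
  -- leaves an identity matrix definitionally.
  𝟙 : Matrix m m
  𝟙 zero    zero    = 1#
  𝟙 zero    (suc _) = 0#
  𝟙 (suc _) zero    = 0#
  𝟙 (suc i) (suc j) = 𝟙 i j

  -- Opaque for the same reason as ∑.
  opaque
    det : Matrix m m → Carrier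
    det {zero}  M = 1#
    det {suc m} M = ∑ λ j → (- 1#) ^ toℕ j * (M zero j * det λ i k → M (suc i) (punchIn j k))

    det-[] : (M : Matrix 0 0) → det M ≡ 1#
    det-[] M = ≡.refl

    det-∷ : (M : Matrix (suc m) (suc m)) →
      det M ≡ ∑ λ j → (- 1#) ^ toℕ j * (M zero j * det λ i k → M (suc i) (punchIn j k))
    det-∷ M = ≡.refl

  ∑-𝟙ˡ : (i : Fin m) (f : Fin m → Carrier) → ∑ (λ j → 𝟙 i j * f j) ≈ f i
  ∑-𝟙ˡ zero f = trans (reflexive (∑-∷ _)) (trans
    (+-cong (*-identityˡ _) (∑-zero _ λ _ → zeroˡ _)) (+-identityʳ _))
  ∑-𝟙ˡ (suc i) f = trans (reflexive (∑-∷ _))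
    (trans (+-cong (zeroˡ _) (∑-𝟙ˡ i (f ∘ suc))) (+-identityˡ _))

  𝟙-sym : (i j : Fin m) → 𝟙 i j ≡ 𝟙 j i
  𝟙-sym zero    zero    = ≡.refl
  𝟙-sym zero    (suc j) = ≡.refl
  𝟙-sym (suc i) zero    = ≡.refl
  𝟙-sym (suc i) (suc j) = 𝟙-sym i j

  ∑-𝟙ʳ : (i : Fin m) (f : Fin m → Carrier) → ∑ (λ j → f j * 𝟙 j i) ≈ f i
  ∑-𝟙ʳ i f = trans
    (∑-cong λ j → trans (*-comm _ _) (*-congʳ (reflexive (𝟙-sym j i)))) (∑-𝟙ˡ i f)

  𝟙-diag : (i : Fin m) → 𝟙 i i ≡ 1#
  𝟙-diag zero    = ≡.refl
  𝟙-diag (suc i) = 𝟙-diag i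

  𝟙-offdiag : {i j : Fin m} → i ≢ j → 𝟙 i j ≡ 0#
  𝟙-offdiag {i = zero}  {zero}  i≢j = contradiction ≡.refl i≢j
  𝟙-offdiag {i = zero}  {suc j} i≢j = ≡.refl
  𝟙-offdiag {i = suc i} {zero}  i≢j = ≡.refl
  𝟙-offdiag {i = suc i} {suc j} i≢j = 𝟙-offdiag (i≢j ∘ cong suc)

  ·-cong : {M M′ : Matrix p q} {N N′ : Matrix q r} → M ≋ M′ → N ≋ N′ → M · N ≋ M′ · N′
  ·-cong M≋ N≋ i k = ∑-cong λ j → *-cong (M≋ i j) (N≋ j k)

  ·-assoc : (L : Matrix p q) (M : Matrix q r) (N : Matrix r n) → (L · M) · N ≋ L · (M · N)
  ·-assoc L M N i l = begin
    ∑ (λ k → ∑ (λ j → L i j * M j k) * N k l)  ≈⟨ ∑-cong (λ k → ∑-* (N k l) _) ⟩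
    ∑ (λ k → ∑ (λ j → L i j * M j k * N k l))  ≈⟨ ∑-cong (λ k → ∑-cong λ j → *-assoc _ _ _) ⟩
    ∑ (λ k → ∑ (λ j → L i j * (M j k * N k l)))  ≈⟨ ∑-comm _ ⟩
    ∑ (λ j → ∑ (λ k → L i j * (M j k * N k l)))  ≈⟨ ∑-cong (λ j → *-∑ (L i j) _) ⟨
    ∑ (λ j → L i j * ∑ (λ k → M j k * N k l))  ∎

  ·-identityˡ : (M : Matrix p q) → 𝟙 · M ≋ M
  ·-identityˡ M i j = ∑-𝟙ˡ i λ k → M k j

  ·-identityʳ : (M : Matrix p q) → M · 𝟙 ≋ M
  ·-identityʳ M i j = ∑-𝟙ʳ j (M i)

  ·-distribˡ : (L : Matrix p q) (M N : Matrix q r) → L · (M ⊞ N) ≋ (L · M) ⊞ (L · N)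
  ·-distribˡ L M N i k = trans (∑-cong λ j → distribˡ _ _ _) (∑-+ (λ j → L i j * M j k) _)

  ·-distribʳ : (L M : Matrix p q) (N : Matrix q r) → (L ⊞ M) · N ≋ (L · N) ⊞ (M · N)
  ·-distribʳ L M N i k = trans (∑-cong λ j → distribʳ _ _ _) (∑-+ (λ j → L i j * N j k) _)

  ·-zeroˡ : (N : Matrix q r) → 𝟘 {p} · N ≋ 𝟘
  ·-zeroˡ N i k = ∑-zero _ λ j → zeroˡ _

  ·-zeroʳ : (M : Matrix p q) → M · 𝟘 {_} {r} ≋ 𝟘
  ·-zeroʳ M i k = ∑-zero _ λ j → zeroʳ _

  det-cong : {M N : Matrix m m} → M ≋ N → det M ≈ det N
  det-cong {zero}  {M} {N} M≋N = reflexive (≡.trans (det-[] M) (≡.sym (det-[] N)))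
  det-cong {suc m} {M} {N} M≋N = begin
    det M  ≡⟨ det-∷ M ⟩
    _  ≈⟨ ∑-cong (λ j → *-congˡ (*-cong (M≋N zero j)
                (det-cong λ i k → M≋N (suc i) (punchIn j k)))) ⟩
    _  ≡⟨ det-∷ N ⟨
    det N  ∎

  det-𝟙 : det {m} 𝟙 ≈ 1#
  det-𝟙 {zero}  = reflexive (det-[] _)
  det-𝟙 {suc m} = begin
    det {suc m} 𝟙  ≡⟨ det-∷ _ ⟩
    _  ≡⟨ ∑-∷ _ ⟩
    1# * (1# * det {m} 𝟙) + ∑ _  ≈⟨ +-cong (trans (*-identityˡ _) (*-identityˡ _))
                                      (∑-zero _ λ j → trans (*-congˡ (zeroˡ _)) (zeroʳ _)) ⟩
    det {m} 𝟙 + 0#  ≈⟨ +-identityʳ _ ⟩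
    det {m} 𝟙  ≈⟨ det-𝟙 {m} ⟩
    1#  ∎

  det-scale : ∀ a (M : Matrix m m) → det (λ i j → a * M i j) ≈ a ^ m * det M
  det-scale {zero}  a M = trans (reflexive (≡.trans (det-[] _) (≡.sym (det-[] M)))) (sym (*-identityˡ _))
  det-scale {suc m} a M = begin
    det (λ i j → a * M i j) ≡⟨ det-∷ _ ⟩
    ∑ (λ j → (- 1#) ^ toℕ j * (a * M zero j * det (λ i k → a * M (suc i) (punchIn j k))))
      ≈⟨ ∑-cong (λ j → trans
           (*-congˡ (*-congˡ (det-scale a λ i k → M (suc i) (punchIn j k))))
           (solve 5 (λ s a x p d → s :* (a :* x :* (p :* d)) := a :* p :* (s :* (x :* d)))
              refl ((- 1#) ^ toℕ j) a (M zero j) (a ^ m) (det λ i k → M (suc i) (punchIn j k)))) ⟩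
    ∑ (λ j → a ^ suc m * ((- 1#) ^ toℕ j * (M zero j * det (λ i k → M (suc i) (punchIn j k)))))
      ≈⟨ *-∑ (a ^ suc m) _ ⟨
    _ ≡⟨ cong (a ^ suc m *_) (det-∷ M) ⟨
    a ^ suc m * det M ∎

  private
    punchIn-↑ˡ : ∀ {m} n (j : Fin (suc m)) k → punchIn (j ↑ˡ n) (k ↑ˡ n) ≡ punchIn j k ↑ˡ n
    punchIn-↑ˡ n zero    k       = ≡.refl
    punchIn-↑ˡ n (suc j) zero    = ≡.refl
    punchIn-↑ˡ n (suc j) (suc k) = cong suc (punchIn-↑ˡ n j k)

    punchIn-↑ʳ : ∀ {m n} (j : Fin (suc m)) (k : Fin n) →
                 punchIn (j ↑ˡ n) (m ↑ʳ k) ≡ suc m ↑ʳ k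
    punchIn-↑ʳ         zero    k = ≡.refl
    punchIn-↑ʳ {suc m} (suc j) k = cong suc (punchIn-↑ʳ j k)

    toℕ-↑ˡ : ∀ {m} n (i : Fin m) → toℕ (i ↑ˡ n) ≡ toℕ i
    toℕ-↑ˡ n zero    = ≡.refl
    toℕ-↑ˡ n (suc i) = cong suc (toℕ-↑ˡ n i)

  -- Expansion along the first row meets only the first block of columns, and each remaining minor
  -- is again block triangular with the same lower right block. The upper triangular case would need
  -- a column expansion and follows later by transposition.
  det-lowerTriangular : ∀ m {n} (M : Matrix (m ℕ.+ n) (m ℕ.+ n)) →
    (∀ i j → M (i ↑ˡ n) (m ↑ʳ j) ≈ 0#) →
    det M ≈ det (λ i j → M (i ↑ˡ n) (j ↑ˡ n)) * det (λ i j → M (m ↑ʳ i) (m ↑ʳ j))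
  det-lowerTriangular zero        M M≈0 =
    sym (trans (*-congʳ (reflexive (det-[] _))) (*-identityˡ _))
  det-lowerTriangular (suc m) {n} M M≈0 = begin
    det M  ≡⟨ det-∷ M ⟩
    _  ≈⟨ ∑-split (suc m) (λ j → (- 1#) ^ toℕ j * (M zero j * det (minor j))) ⟩
    ∑ (λ j → (- 1#) ^ toℕ (j ↑ˡ n) * (M zero (j ↑ˡ n) * det (minor (j ↑ˡ n))))
      + ∑ (λ j → (- 1#) ^ toℕ (suc m ↑ʳ j) * (M zero (suc m ↑ʳ j) * det (minor (suc m ↑ʳ j))))
      ≈⟨ +-cong (∑-cong left) (∑-zero _ λ j → trans
           (*-congˡ {x = (- 1#) ^ toℕ (suc m ↑ʳ j)} (trans (*-congʳ (M≈0 zero j)) (zeroˡ _))) (zeroʳ _)) ⟩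
    ∑ (λ j → (- 1#) ^ toℕ j * (A zero j * det (λ i k → A (suc i) (punchIn j k))) * det B) + 0#
      ≈⟨ +-identityʳ _ ⟩
    ∑ (λ j → (- 1#) ^ toℕ j * (A zero j * det (λ i k → A (suc i) (punchIn j k))) * det B)
      ≈⟨ ∑-* (det B) _ ⟨
    _ ≡⟨ cong (_* det B) (det-∷ A) ⟨
    det A * det B ∎
    where
    minor : Fin (suc m ℕ.+ n) → Matrix (m ℕ.+ n) (m ℕ.+ n)
    minor j i k = M (suc i) (punchIn j k)
    A = λ i j → M (i ↑ˡ n) (j ↑ˡ n)
    B = λ i j → M (suc m ↑ʳ i) (suc m ↑ʳ j)
    left : ∀ j → (- 1#) ^ toℕ (j ↑ˡ n) * (M zero (j ↑ˡ n) * det (minor (j ↑ˡ n)))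
             ≈ (- 1#) ^ toℕ j * (A zero j * det (λ i k → A (suc i) (punchIn j k))) * det B
    left j = begin
      (- 1#) ^ toℕ (j ↑ˡ n) * (M zero (j ↑ˡ n) * det (minor (j ↑ˡ n)))
        ≈⟨ *-cong (reflexive (cong ((- 1#) ^_) (toℕ-↑ˡ n j))) (*-congˡ
             (det-lowerTriangular m (minor (j ↑ˡ n)) λ i k →
               trans (reflexive (cong (M _) (punchIn-↑ʳ j k))) (M≈0 (suc i) k))) ⟩
      (- 1#) ^ toℕ j * (A zero j * (det (λ i k → minor (j ↑ˡ n) (i ↑ˡ n) (k ↑ˡ n))
                                  * det (λ i k → minor (j ↑ˡ n) (m ↑ʳ i) (m ↑ʳ k))))
        ≈⟨ *-congˡ (*-congˡ (*-cong
             (det-cong λ i k → reflexive (cong (M _) (punchIn-↑ˡ n j k)))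
             (det-cong λ i k → reflexive (cong (M _) (punchIn-↑ʳ j k))))) ⟩
      (- 1#) ^ toℕ j * (A zero j * (det (λ i k → A (suc i) (punchIn j k)) * det B))
        ≈⟨ solve 4 (λ s a d b → s :* (a :* (d :* b)) := s :* (a :* d) :* b)
             refl ((- 1#) ^ toℕ j) (A zero j) (det (λ i k → A (suc i) (punchIn j k))) (det B) ⟩
      (- 1#) ^ toℕ j * (A zero j * det (λ i k → A (suc i) (punchIn j k))) * det B ∎

-- The exterior algebra: multiplicativity and transposition of determinants.

module Exterior {c ℓ} (R : CommutativeRing c ℓ) where
  open CommutativeRing R hiding (zero)
  open Matrices R
  open RawSemiring (Semiring.rawSemiring semiring) using (_^_)
  open import Algebra.Properties.Ring ring
  open IntegerMultiples R
  open Solver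
  open import Data.Fin.Base using (toℕ; punchIn)
  open import Data.Fin.Subset using (Subset; ⊤; ∣_∣; inside; outside)
  open import Data.Fin.Subset.Properties using (∣p∣≤n)
  open import Data.Vec.Base using ([]; _∷_)
  open import Data.Integer.Base using (+_)
  import Data.Nat.Properties as ℕₚ
  open import Relation.Binary.Reasoning.Setoid setoid

  private
    variable
      k m n p q : ℕ

  -- The exterior algebra on m generators: y stands for the product of the
  -- generators in y in increasing order.
  Λ : ℕ → Set c
  Λ m = Subset m → Carrier

  infix 4 _≐_
  _≐_ : Λ m → Λ m → Set ℓ
  ω ≐ η = ∀ y → ω y ≈ η y

  -- Exterior multiplication by the vector `w` from the left. The minus sign arises when the tail of
  -- `w` moves past generator zero, which stands first in `inside ∷ y`.
  wedge : (Fin m → Carrier) → Λ m → Λ m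
  wedge w ω []            = 0#
  wedge w ω (outside ∷ y) = wedge (w ∘ suc) (ω ∘ (outside ∷_)) y
  wedge w ω (inside  ∷ y) = w zero * ω (outside ∷ y) - wedge (w ∘ suc) (ω ∘ (inside ∷_)) y

  one : Λ m
  one []            = 1#
  one (outside ∷ y) = one y
  one (inside  ∷ y) = 0#

  top : Λ m
  top []            = 1#
  top (outside ∷ y) = 0#
  top (inside  ∷ y) = top y

  wedges : Matrix k m → Λ m
  wedges {zero}  M = one
  wedges {suc k} M = wedge (M zero) (wedges (M ∘ suc))

  wedge-cong : ∀ {w w′ : Fin m → Carrier} {ω ω′} → (∀ i → w i ≈ w′ i) → ω ≐ ω′ →
               wedge w ω ≐ wedge w′ ω′
  wedge-cong w≈ ω≈ []            = refl
  wedge-cong w≈ ω≈ (outside ∷ y) = wedge-cong (w≈ ∘ suc) (ω≈ ∘ (outside ∷_)) y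
  wedge-cong w≈ ω≈ (inside  ∷ y) = +-cong (*-cong (w≈ zero) (ω≈ (outside ∷ y)))
    (-‿cong (wedge-cong (w≈ ∘ suc) (ω≈ ∘ (inside ∷_)) y))

  wedge-congʳ : ∀ (w : Fin m → Carrier) {ω ω′} → ω ≐ ω′ → wedge w ω ≐ wedge w ω′
  wedge-congʳ w = wedge-cong λ _ → refl

  wedge-linear : ∀ (w : Fin m → Carrier) a ω η →
                 wedge w (λ y → a * ω y + η y) ≐ λ y → a * wedge w ω y + wedge w η y
  wedge-linear w a ω η []            = solve 1 (λ a → con (+ 0) := a :* con (+ 0) :+ con (+ 0)) refl a
  wedge-linear w a ω η (outside ∷ y) = wedge-linear (w ∘ suc) a _ _ y
  wedge-linear w a ω η (inside  ∷ y) = trans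
    (+-congˡ (-‿cong (wedge-linear (w ∘ suc) a _ _ y)))
    (solve 6 (λ w a c e x z → w :* (a :* c :+ e) :- (a :* x :+ z)
                           := a :* (w :* c :- x) :+ (w :* e :- z)) refl _ a _ _ _ _)

  wedge-zero : ∀ (w : Fin m → Carrier) → wedge w (λ _ → 0#) ≐ λ _ → 0#
  wedge-zero w []            = refl
  wedge-zero w (outside ∷ y) = wedge-zero (w ∘ suc) y
  wedge-zero w (inside  ∷ y) = trans (+-cong (zeroʳ _) (trans (-‿cong (wedge-zero (w ∘ suc) y)) -0#≈0#)) (+-identityʳ _)

  wedge-neg : ∀ (w : Fin m → Carrier) ω → wedge w (λ y → - ω y) ≐ λ y → - wedge w ω y
  wedge-neg w ω []            = sym -0#≈0#
  wedge-neg w ω (outside ∷ y) = wedge-neg (w ∘ suc) _ y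
  wedge-neg w ω (inside  ∷ y) = trans
    (+-congˡ (-‿cong (wedge-neg (w ∘ suc) _ y)))
    (solve 3 (λ w c x → w :* (:- c) :- :- x := :- (w :* c :- x)) refl _ _ _)

  wedge-∑ : ∀ (w : Fin m → Carrier) (a : Fin n → Carrier) (ω : Fin n → Λ m) →
            wedge w (λ y → ∑ λ i → a i * ω i y) ≐ λ y → ∑ λ i → a i * wedge w (ω i) y
  wedge-∑ {n = zero}  w a ω y = begin
    wedge w (λ y → ∑ λ i → a i * ω i y) y  ≈⟨ wedge-congʳ w (λ _ → reflexive (∑-[] _)) y ⟩
    wedge w (λ _ → 0#) y  ≈⟨ wedge-zero w y ⟩
    0#  ≡⟨ ∑-[] _ ⟨
    _  ∎
  wedge-∑ {n = suc n} w a ω y = begin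
    wedge w (λ y → ∑ λ i → a i * ω i y) y
      ≈⟨ wedge-congʳ w (λ _ → reflexive (∑-∷ _)) y ⟩
    wedge w (λ y → a zero * ω zero y + ∑ (λ i → a (suc i) * ω (suc i) y)) y
      ≈⟨ wedge-linear w (a zero) _ _ y ⟩
    a zero * wedge w (ω zero) y + wedge w (λ y → ∑ λ i → a (suc i) * ω (suc i) y) y
      ≈⟨ +-congˡ (wedge-∑ w (a ∘ suc) (ω ∘ suc) y) ⟩
    a zero * wedge w (ω zero) y + ∑ (λ i → a (suc i) * wedge w (ω (suc i)) y)
      ≡⟨ ∑-∷ _ ⟨
    _ ∎

  wedge-linearˡ : ∀ a (w u : Fin m → Carrier) ω →
                  wedge (λ i → a * w i + u i) ω ≐ λ y → a * wedge w ω y + wedge u ω y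
  wedge-linearˡ a w u ω []            = solve 1 (λ a → con (+ 0) := a :* con (+ 0) :+ con (+ 0)) refl a
  wedge-linearˡ a w u ω (outside ∷ y) = wedge-linearˡ a (w ∘ suc) (u ∘ suc) _ y
  wedge-linearˡ a w u ω (inside  ∷ y) = trans
    (+-congˡ (-‿cong (wedge-linearˡ a (w ∘ suc) (u ∘ suc) _ y)))
    (solve 6 (λ w u a c x z → (a :* w :+ u) :* c :- (a :* x :+ z)
                           := a :* (w :* c :- x) :+ (u :* c :- z)) refl _ _ a _ _ _)

  wedge-zeroˡ : ∀ (ω : Λ m) → wedge (λ _ → 0#) ω ≐ λ _ → 0#
  wedge-zeroˡ ω []            = refl
  wedge-zeroˡ ω (outside ∷ y) = wedge-zeroˡ _ y
  wedge-zeroˡ ω (inside  ∷ y) = trans (+-cong (zeroˡ _) (trans (-‿cong (wedge-zeroˡ _ y)) -0#≈0#)) (+-identityʳ _)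

  wedge-anticomm : ∀ (w u : Fin m → Carrier) ω → wedge w (wedge u ω) ≐ λ y → - wedge u (wedge w ω) y
  wedge-anticomm w u ω []            = sym -0#≈0#
  wedge-anticomm w u ω (outside ∷ y) = wedge-anticomm (w ∘ suc) (u ∘ suc) _ y
  wedge-anticomm w u ω (inside  ∷ y) = begin
    w zero * wedge u′ ω₀ y - wedge w′ (λ y → u zero * ω₀ y - wedge u′ ω₁ y) y
      ≈⟨ +-congˡ (-‿cong (wedge-linear w′ (u zero) ω₀ _ y)) ⟩
    w zero * wedge u′ ω₀ y - (u zero * wedge w′ ω₀ y + wedge w′ (λ y → - wedge u′ ω₁ y) y)
      ≈⟨ +-congˡ (-‿cong (+-congˡ (wedge-neg w′ (wedge u′ ω₁) y))) ⟩
    w zero * wedge u′ ω₀ y - (u zero * wedge w′ ω₀ y - wedge w′ (wedge u′ ω₁) y)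
      ≈⟨ +-congˡ (-‿cong (+-congˡ (-‿cong (wedge-anticomm w′ u′ ω₁ y)))) ⟩
    w zero * wedge u′ ω₀ y - (u zero * wedge w′ ω₀ y - - wedge u′ (wedge w′ ω₁) y)
      ≈⟨ solve 3 (λ a b c → a :- (b :- :- c) := :- (b :- (a :- c))) refl _ _ _ ⟩
    - (u zero * wedge w′ ω₀ y - (w zero * wedge u′ ω₀ y - wedge u′ (wedge w′ ω₁) y))
      ≈⟨ -‿cong (+-congˡ (-‿cong (+-congˡ (wedge-neg u′ (wedge w′ ω₁) y)))) ⟨
    - (u zero * wedge w′ ω₀ y - (w zero * wedge u′ ω₀ y + wedge u′ (λ y → - wedge w′ ω₁ y) y))
      ≈⟨ -‿cong (+-congˡ (-‿cong (wedge-linear u′ (w zero) ω₀ _ y))) ⟨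
    - (u zero * wedge w′ ω₀ y - wedge u′ (λ y → w zero * ω₀ y - wedge w′ ω₁ y) y) ∎
    where
    w′ = w ∘ suc
    u′ = u ∘ suc
    ω₀ = ω ∘ (outside ∷_)
    ω₁ = ω ∘ (inside ∷_)

  -- This is stronger than `wedge-anticomm` with both vectors equal, which only shows that twice the
  -- form vanishes.
  wedge-square : ∀ (w : Fin m → Carrier) ω → wedge w (wedge w ω) ≐ λ _ → 0#
  wedge-square w ω []            = refl
  wedge-square w ω (outside ∷ y) = wedge-square (w ∘ suc) _ y
  wedge-square w ω (inside  ∷ y) = begin
    w zero * wedge w′ ω₀ y - wedge w′ (λ y → w zero * ω₀ y - wedge w′ ω₁ y) y
      ≈⟨ +-congˡ (-‿cong (trans (wedge-linear w′ (w zero) ω₀ _ y)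
           (+-congˡ (trans (wedge-neg w′ _ y) (trans (-‿cong (wedge-square w′ ω₁ y)) -0#≈0#))))) ⟩
    w zero * wedge w′ ω₀ y - (w zero * wedge w′ ω₀ y + 0#)
      ≈⟨ solve 1 (λ a → a :- (a :+ con (+ 0)) := con (+ 0)) refl _ ⟩
    0# ∎
    where
    w′ = w ∘ suc
    ω₀ = ω ∘ (outside ∷_)
    ω₁ = ω ∘ (inside ∷_)

  -- The algebra homomorphism sending the i-th generator to the i-th row of B.
  substitute : Matrix p q → Λ p → Λ q
  substitute {zero}  B ω y = ω [] * one y
  substitute {suc p} B ω y = wedge (B zero) (substitute (B ∘ suc) (ω ∘ (inside ∷_))) y
                           + substitute (B ∘ suc) (ω ∘ (outside ∷_)) y

  substitute-cong : ∀ (B : Matrix p q) {ω η} → ω ≐ η → substitute B ω ≐ substitute B η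
  substitute-cong {zero}  B ω≐η y = *-congʳ (ω≐η [])
  substitute-cong {suc p} B ω≐η y = +-cong
    (wedge-congʳ _ (substitute-cong (B ∘ suc) (ω≐η ∘ (inside ∷_))) y)
    (substitute-cong (B ∘ suc) (ω≐η ∘ (outside ∷_)) y)

  substitute-linear : ∀ (B : Matrix p q) a ω η →
    substitute B (λ y → a * ω y + η y) ≐ λ y → a * substitute B ω y + substitute B η y
  substitute-linear {zero}  B a ω η y =
    solve 4 (λ a x z o → (a :* x :+ z) :* o := a :* (x :* o) :+ z :* o) refl _ _ _ _
  substitute-linear {suc p} B a ω η y = trans
    (+-cong (trans (wedge-congʳ _ (substitute-linear (B ∘ suc) a _ _) y) (wedge-linear _ a _ _ y))
            (substitute-linear (B ∘ suc) a _ _ y))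
    (solve 5 (λ a x z u v → (a :* x :+ z) :+ (a :* u :+ v) := a :* (x :+ u) :+ (z :+ v)) refl a _ _ _ _)

  substitute-zero : ∀ (B : Matrix p q) {ω} → ω ≐ (λ _ → 0#) → substitute B ω ≐ λ _ → 0#
  substitute-zero {zero}  B ω≈0 y = trans (*-congʳ (ω≈0 [])) (zeroˡ _)
  substitute-zero {suc p} B ω≈0 y = trans
    (+-cong (trans (wedge-congʳ _ (substitute-zero (B ∘ suc) (ω≈0 ∘ (inside ∷_))) y) (wedge-zero _ y))
            (substitute-zero (B ∘ suc) (ω≈0 ∘ (outside ∷_)) y))
    (+-identityʳ _)

  substitute-neg : ∀ (B : Matrix p q) ω → substitute B (λ y → - ω y) ≐ λ y → - substitute B ω y
  substitute-neg B ω y = begin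
    substitute B (λ y → - ω y) y
      ≈⟨ substitute-cong B (λ y → trans (+-identityʳ _) (-1*x≈-x _)) y ⟨
    substitute B (λ y → - 1# * ω y + 0#) y
      ≈⟨ substitute-linear B (- 1#) ω _ y ⟩
    - 1# * substitute B ω y + substitute B (λ _ → 0#) y
      ≈⟨ +-cong (-1*x≈-x _) (substitute-zero B (λ _ → refl) y) ⟩
    - substitute B ω y + 0#
      ≈⟨ +-identityʳ _ ⟩
    - substitute B ω y ∎

  -- Write ω as generator zero times ω₁ plus ω₀. Under substitution generator zero becomes the row
  -- `b`; the image `v` of the tail of `w` passes `b` at the cost of a sign, and b ∧ b = 0 removes
  -- the term in which generator zero would occur twice.
  substitute-wedge : ∀ (B : Matrix p q) w ω →
    substitute B (wedge w ω) ≐ wedge (λ j → ∑ λ i → w i * B i j) (substitute B ω)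
  substitute-wedge {zero} B w ω y = begin
    0# * one y  ≈⟨ zeroˡ _ ⟩
    0#  ≈⟨ wedge-zeroˡ (substitute B ω) y ⟨
    wedge (λ _ → 0#) (substitute B ω) y ≈⟨ wedge-cong (λ j → reflexive (≡.sym (∑-[] _))) (λ _ → refl) y ⟩
    _ ∎
  substitute-wedge {suc p} B w ω y = begin
    wedge b (substitute B′ (λ y → w zero * ω₀ y - wedge w′ ω₁ y)) y + substitute B′ (wedge w′ ω₀) y
      ≈⟨ +-cong (wedge-congʳ b (λ y → trans (substitute-linear B′ (w zero) ω₀ _ y)
           (+-congˡ (trans (substitute-neg B′ _ y) (-‿cong (substitute-wedge B′ w′ ω₁ y))))) y)
         (substitute-wedge B′ w′ ω₀ y) ⟩
    wedge b (λ y → w zero * S₀ y - wedge v S₁ y) y + wedge v S₀ y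
      ≈⟨ +-congʳ (trans (wedge-linear b (w zero) S₀ _ y) (+-congˡ
           (trans (wedge-neg b _ y) (-‿cong (wedge-anticomm b v S₁ y))))) ⟩
    (w zero * wedge b S₀ y - - wedge v (wedge b S₁) y) + wedge v S₀ y
      ≈⟨ solve 4 (λ w a c d → (w :* a :- :- c) :+ d := w :* (con (+ 0) :+ a) :+ (c :+ d)) refl _ _ _ _ ⟩
    w zero * (0# + wedge b S₀ y) + (wedge v (wedge b S₁) y + wedge v S₀ y)
      -- The zero is replaced by `wedge b (wedge b S₁)`, so that both `b` and `v` multiply the same
      -- form `wedge b S₁` plus `S₀`, which is `substitute B ω`.
      ≈⟨ +-cong (*-congˡ (+-congʳ (wedge-square b S₁ y))) refl ⟨
    w zero * (wedge b (wedge b S₁) y + wedge b S₀ y) + (wedge v (wedge b S₁) y + wedge v S₀ y)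
      ≈⟨ +-cong (*-congˡ (wedge-add b (wedge b S₁) S₀ y)) (wedge-add v (wedge b S₁) S₀ y) ⟨
    w zero * wedge b (λ y → wedge b S₁ y + S₀ y) y + wedge v (λ y → wedge b S₁ y + S₀ y) y
      ≈⟨ wedge-linearˡ (w zero) b v _ y ⟨
    wedge (λ j → w zero * b j + v j) (λ y → wedge b S₁ y + S₀ y) y
      ≈⟨ wedge-cong (λ j → reflexive (≡.sym (∑-∷ _))) (λ _ → refl) y ⟩
    wedge (λ j → ∑ λ i → w i * B i j) (λ y → wedge b S₁ y + S₀ y) y ∎
    where
    b = B zero
    B′ = B ∘ suc
    w′ = w ∘ suc
    ω₀ = ω ∘ (outside ∷_)
    ω₁ = ω ∘ (inside ∷_)
    v = λ j → ∑ λ i → w′ i * B′ i j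
    S₀ = substitute B′ ω₀
    S₁ = substitute B′ ω₁
    wedge-add : ∀ (w : Fin m → Carrier) ω η → wedge w (λ y → ω y + η y) ≐ λ y → wedge w ω y + wedge w η y
    wedge-add w ω η y = trans
      (wedge-congʳ w (λ y → +-congʳ (sym (*-identityˡ _))) y)
      (trans (wedge-linear w 1# ω η y) (+-congʳ (*-identityˡ _)))

  substitute-one : ∀ (B : Matrix p q) → substitute B one ≐ one
  substitute-one {zero}  B y = *-identityˡ _
  substitute-one {suc p} B y = trans
    (+-cong (trans (wedge-congʳ _ (substitute-zero (B ∘ suc) (λ _ → refl)) y) (wedge-zero _ y))
            (substitute-one (B ∘ suc) y))
    (+-identityˡ _)

  substitute-wedges : ∀ (A : Matrix k p) (B : Matrix p q) → substitute B (wedges A) ≐ wedges (A · B)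
  substitute-wedges {zero}  A B y = substitute-one B y
  substitute-wedges {suc k} A B y = trans (substitute-wedge B (A zero) _ y)
    (wedge-congʳ _ (substitute-wedges (A ∘ suc) B) y)

  substitute-top : ∀ (B : Matrix p q) → substitute B top ≐ wedges B
  substitute-top {zero}  B y = *-identityˡ _
  substitute-top {suc p} B y = trans
    (+-cong (wedge-congʳ _ (substitute-top (B ∘ suc)) y) (substitute-zero (B ∘ suc) (λ _ → refl) y))
    (+-identityʳ _)

  -- `t` counts the generators already stripped from the front by the recursion on `y`, so that the
  -- hypothesis keeps speaking about the degree of the whole form.
  wedge-degree : ∀ t {w : Fin m → Carrier} {ω} →
    (∀ y → t ℕ.+ ∣ y ∣ ≢ k → ω y ≈ 0#) → ∀ y → t ℕ.+ ∣ y ∣ ≢ suc k → wedge w ω y ≈ 0#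
  wedge-degree t ω≈0 []            t≢ = refl
  wedge-degree t ω≈0 (outside ∷ y) t≢ = wedge-degree t (ω≈0 ∘ (outside ∷_)) y t≢
  wedge-degree t {w} {ω} ω≈0 (inside  ∷ y) t≢ = begin
    w zero * ω (outside ∷ y) - wedge (w ∘ suc) (ω ∘ (inside ∷_)) y
      ≈⟨ +-cong (*-congˡ (ω≈0 (outside ∷ y) λ eq → t≢ (≡.trans (ℕₚ.+-suc t _) (cong suc eq))))
           (-‿cong (wedge-degree (suc t) (λ y neq → ω≈0 (inside ∷ y) (neq ∘ ≡.trans (≡.sym (ℕₚ.+-suc t _)))) y
             (t≢ ∘ ≡.trans (ℕₚ.+-suc t _)))) ⟩
    w zero * 0# - 0#  ≈⟨ +-cong (zeroʳ _) -0#≈0# ⟩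
    0# + 0#  ≈⟨ +-identityʳ _ ⟩
    0# ∎

  one-degree : ∀ (y : Subset m) → ∣ y ∣ ≢ 0 → one y ≈ 0#
  one-degree []            y≢ = contradiction ≡.refl y≢
  one-degree (outside ∷ y) y≢ = one-degree y y≢
  one-degree (inside  ∷ y) y≢ = refl

  wedges-degree : ∀ (M : Matrix k m) y → ∣ y ∣ ≢ k → wedges M y ≈ 0#
  wedges-degree {zero}  M = one-degree
  wedges-degree {suc k} M = wedge-degree 0 (wedges-degree (M ∘ suc))

  topDegree : ∀ (ω : Λ m) → (∀ y → ∣ y ∣ ≢ m → ω y ≈ 0#) → ω ≐ λ y → ω ⊤ * top y
  topDegree {zero}  ω ω≈0 []            = sym (*-identityʳ _)
  topDegree {suc m} ω ω≈0 (outside ∷ y) = trans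
    (ω≈0 (outside ∷ y) λ eq → ℕₚ.<⇒≢ (ℕ.s≤s (∣p∣≤n y)) eq) (sym (zeroʳ _))
  topDegree {suc m} ω ω≈0 (inside  ∷ y) =
    topDegree (ω ∘ (inside ∷_)) (λ y neq → ω≈0 (inside ∷ y) (neq ∘ ℕₚ.suc-injective)) y

  det∧ : Matrix m m → Carrier
  det∧ M = wedges M ⊤

  -- Substituting the rows of `B` for the generators turns the product of the rows of `A` into that
  -- of the rows of `A · B`. As the top degree has rank one, the former product is `det∧ A` times
  -- the volume form, which is sent to the product of the rows of `B`.
  det∧-· : (A B : Matrix m m) → det∧ (A · B) ≈ det∧ A * det∧ B
  det∧-· A B = begin
    wedges (A · B) ⊤  ≈⟨ substitute-wedges A B ⊤ ⟨
    substitute B (wedges A) ⊤  ≈⟨ substitute-cong B (topDegree _ (wedges-degree A)) ⊤ ⟩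
    substitute B (λ y → det∧ A * top y) ⊤  ≈⟨ substitute-cong B (λ y → sym (+-identityʳ _)) ⊤ ⟩
    substitute B (λ y → det∧ A * top y + 0#) ⊤  ≈⟨ substitute-linear B (det∧ A) top _ ⊤ ⟩
    det∧ A * substitute B top ⊤ + substitute B (λ _ → 0#) ⊤
      ≈⟨ +-cong (*-congˡ (substitute-top B ⊤)) (substitute-zero B (λ _ → refl) ⊤) ⟩
    det∧ A * det∧ B + 0#  ≈⟨ +-identityʳ _ ⟩
    det∧ A * det∧ B  ∎

  -- The image of a subset under `punchIn j`: restricting a form along `skip j` amounts to deleting
  -- column `j`.
  skip : Fin (suc m) → Subset m → Subset (suc m)
  skip zero            y       = outside ∷ y
  skip {suc m} (suc j) (s ∷ y) = s ∷ skip j y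

  wedge-⊤ : ∀ (w : Fin (suc m) → Carrier) ω →
            wedge w ω ⊤ ≈ ∑ λ j → (- 1#) ^ toℕ j * (w j * ω (skip j ⊤))
  wedge-⊤ {zero}  w ω = trans
    (solve 2 (λ w c → w :* c :- con (+ 0) := w :* c :+ con (+ 0)) refl (w zero) (ω (outside ∷ [])))
    (trans (+-cong (sym (*-identityˡ _)) (reflexive (≡.sym (∑-[] _)))) (reflexive (≡.sym (∑-∷ _))))
  wedge-⊤ {suc m} w ω = begin
    w zero * ω (outside ∷ ⊤) - wedge (w ∘ suc) (ω ∘ (inside ∷_)) ⊤
      ≈⟨ +-cong (sym (*-identityˡ _)) (-‿cong (wedge-⊤ (w ∘ suc) (ω ∘ (inside ∷_)))) ⟩
    1# * (w zero * ω (outside ∷ ⊤)) - ∑ (λ j → (- 1#) ^ toℕ j * (w (suc j) * ω (inside ∷ skip j ⊤)))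
      ≈⟨ +-congˡ (trans (sym (∑-neg _)) (∑-cong λ j →
           trans (-‿cong refl) (trans (sym (-1*x≈-x _)) (sym (*-assoc _ _ _))))) ⟩
    1# * (w zero * ω (outside ∷ ⊤)) + ∑ (λ j → - 1# * (- 1#) ^ toℕ j * (w (suc j) * ω (inside ∷ skip j ⊤)))
      ≡⟨ ∑-∷ _ ⟨
    _ ∎

  wedge-skip : ∀ (w : Fin (suc m) → Carrier) ω j →
               wedge w ω ∘ skip j ≐ wedge (w ∘ punchIn j) (ω ∘ skip j)
  wedge-skip w ω zero    y             = refl
  wedge-skip w ω (suc j) (outside ∷ y) = wedge-skip (w ∘ suc) _ j y
  wedge-skip w ω (suc j) (inside  ∷ y) = +-congˡ (-‿cong (wedge-skip (w ∘ suc) _ j y))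

  one-skip : ∀ j (y : Subset m) → one (skip j y) ≈ one y
  one-skip zero    y             = refl
  one-skip (suc j) (outside ∷ y) = one-skip j y
  one-skip (suc j) (inside  ∷ y) = refl

  wedges-skip : ∀ (M : Matrix k (suc m)) j → wedges M ∘ skip j ≐ wedges (λ i l → M i (punchIn j l))
  wedges-skip {zero}  M j y = one-skip j y
  wedges-skip {suc k} M j y = trans (wedge-skip (M zero) _ j y) (wedge-congʳ _ (wedges-skip (M ∘ suc) j) y)

  -- Reading off the top coefficient of the outermost factor, the first row, is the expansion along
  -- that row.
  det∧≈det : (M : Matrix m m) → det∧ M ≈ det M
  det∧≈det {zero}  M = reflexive (≡.sym (det-[] M))
  det∧≈det {suc m} M = begin
    wedge (M zero) (wedges (M ∘ suc)) ⊤  ≈⟨ wedge-⊤ (M zero) (wedges (M ∘ suc)) ⟩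
    _  ≈⟨ ∑-cong (λ j → *-congˡ (*-congˡ (trans
                                              (wedges-skip (M ∘ suc) j ⊤)
                                              (det∧≈det (λ i k → M (suc i) (punchIn j k)))))) ⟩
    _  ≡⟨ det-∷ M ⟨
    det M  ∎

  wedges-outside : ∀ (M : Matrix k (suc m)) y → wedges M (outside ∷ y) ≈ wedges (λ i j → M i (suc j)) y
  wedges-outside M = wedges-skip M zero

  -- Expansion along the first column: generator zero comes from exactly one row `i`, and moving it
  -- to the front past the earlier rows gives the sign. Compared with the row expansion in
  -- `det∧≈det`, this yields invariance under transposition.
  wedges-inside : ∀ (M : Matrix (suc k) (suc m)) y →
    wedges M (inside ∷ y) ≈
    ∑ λ i → (- 1#) ^ toℕ i * M i zero * wedges (λ r s → M (punchIn i r) (suc s)) y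
  wedges-inside {zero} M y = begin
    M zero zero * one y - wedge (M zero ∘ suc) (λ _ → 0#) y
      ≈⟨ +-cong (*-congʳ (sym (*-identityˡ _))) (trans (-‿cong (wedge-zero _ y)) -0#≈0#) ⟩
    1# * M zero zero * one y + 0#  ≡⟨ cong (λ z → 1# * M zero zero * one y + z) (∑-[] _) ⟨
    _  ≡⟨ ∑-∷ _ ⟨
    _  ∎
  wedges-inside {suc k} M y = begin
    M zero zero * wedges M′ (outside ∷ y) - wedge w (wedges M′ ∘ (inside ∷_)) y
      ≈⟨ +-cong (*-cong (sym (*-identityˡ _)) (wedges-outside M′ y)) (-‿cong (trans
           (wedge-congʳ w (wedges-inside M′) y) (wedge-∑ w _ _ y))) ⟩
    _ ≈⟨ +-congˡ (trans (sym (∑-neg _)) (∑-cong λ i → trans (sym (-1*x≈-x _))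
           (solve 4 (λ u s m x → u :* (s :* m :* x) := u :* s :* m :* x) refl (- 1#) _ _ _))) ⟩
    _ ≡⟨ ∑-∷ (λ i → (- 1#) ^ toℕ i * M i zero * wedges (λ r s → M (punchIn i r) (suc s)) y) ⟨
    _ ∎
    where
    M′ = M ∘ suc
    w = M zero ∘ suc

  det∧≈det-† : (M : Matrix m m) → det∧ M ≈ det (M †)
  det∧≈det-† {zero}  M = reflexive (≡.sym (det-[] _))
  det∧≈det-† {suc m} M = begin
    det∧ M  ≈⟨ wedges-inside M ⊤ ⟩
    _  ≈⟨ ∑-cong (λ i → trans (*-assoc _ _ _)
                  (*-congˡ (*-congˡ (det∧≈det-† λ r s → M (punchIn i r) (suc s))))) ⟩
    _  ≡⟨ det-∷ (M †) ⟨
    det (M †) ∎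

module DeterminantProperties {c ℓ} (R : CommutativeRing c ℓ) where
  open CommutativeRing R hiding (zero)
  open Matrices R
  open Exterior R
  open import Data.Fin.Base using (_↑ˡ_; _↑ʳ_)
  open import Relation.Binary.Reasoning.Setoid setoid

  private
    variable
      m : ℕ

  det-† : (M : Matrix m m) → det (M †) ≈ det M
  det-† M = trans (sym (det∧≈det-† M)) (det∧≈det M)

  det-· : (M N : Matrix m m) → det (M · N) ≈ det M * det N
  det-· M N = begin
    det (M · N)  ≈⟨ det∧≈det (M · N) ⟨
    det∧ (M · N)  ≈⟨ det∧-· M N ⟩
    det∧ M * det∧ N  ≈⟨ *-cong (det∧≈det M) (det∧≈det N) ⟩
    det M * det N  ∎

  det-upperTriangular : ∀ m {n} (M : Matrix (m ℕ.+ n) (m ℕ.+ n)) →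
    (∀ i j → M (m ↑ʳ i) (j ↑ˡ n) ≈ 0#) →
    det M ≈ det (λ i j → M (i ↑ˡ n) (j ↑ˡ n)) * det (λ i j → M (m ↑ʳ i) (m ↑ʳ j))
  det-upperTriangular m M M≈0 = begin
    det M  ≈⟨ det-† M ⟨
    det (M †)  ≈⟨ det-lowerTriangular m (M †) (λ i j → M≈0 j i) ⟩
    _  ≈⟨ *-cong (det-† _) (det-† _) ⟩
    _  ∎

-- Polynomial functions, described by iterated differences.

module PolynomialFunctions {c ℓ} (R : CommutativeRing c ℓ) where
  open CommutativeRing R hiding (zero)
  open Matrices R
  open RawSemiring (Semiring.rawSemiring semiring)
    using (_^_; product) renaming (_×_ to _⋆_)
  open import Algebra.Properties.Ring ring
  open IntegerMultiples R
  open Solver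
  open import Data.Fin.Base using (toℕ; punchIn)
  open import Data.Integer.Base using (+_)
  import Data.Nat.Properties as ℕₚ
  open import Relation.Binary.Reasoning.Setoid setoid

  private
    variable
      m n : ℕ
      f g : Carrier → Carrier

  opaque
    ∏ : (Fin m → Carrier) → Carrier
    ∏ = product

    ∏≡product : (f : Fin m → Carrier) → ∏ f ≡ product f
    ∏≡product f = ≡.refl

    ∏-[] : (f : Fin 0 → Carrier) → ∏ f ≡ 1#
    ∏-[] f = ≡.refl

    ∏-∷ : (f : Fin (suc m) → Carrier) → ∏ f ≡ f zero * ∏ (f ∘ suc)
    ∏-∷ f = ≡.refl

    ∏-cong : {f g : Fin m → Carrier} → (∀ i → f i ≈ g i) → ∏ f ≈ ∏ g
    ∏-cong {zero}  f≈g = refl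
    ∏-cong {suc m} f≈g = *-cong (f≈g zero) (∏-cong (f≈g ∘ suc))

    ∏-* : (f g : Fin m → Carrier) → ∏ (λ i → f i * g i) ≈ ∏ f * ∏ g
    ∏-* {zero}  f g = sym (*-identityˡ _)
    ∏-* {suc m} f g = trans (*-congˡ (∏-* (f ∘ suc) (g ∘ suc)))
      (solve 4 (λ a b c d → a :* b :* (c :* d) := a :* c :* (b :* d)) refl _ _ _ _)

    ∏-scale : ∀ a (f : Fin m → Carrier) → ∏ (λ i → a * f i) ≈ a ^ m * ∏ f
    ∏-scale {zero}  a f = sym (*-identityˡ _)
    ∏-scale {suc m} a f = trans (*-congˡ (∏-scale a (f ∘ suc)))
      (solve 4 (λ a b c d → a :* b :* (c :* d) := a :* c :* (b :* d)) refl _ _ _ _)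

  -- f is a polynomial function of degree below n; differences avoid coefficients.
  Degree< : ℕ → (Carrier → Carrier) → Set (c ⊔ ℓ)
  Degree< zero    f = ∀ (t : Carrier) → f t ≈ 0#
  Degree< (suc n) f = Degree< n λ t → f (t + 1#) - f t

  degree-cong : ∀ n → (∀ t → f t ≈ g t) → Degree< n f → Degree< n g
  degree-cong zero    f≈g d = λ t → trans (sym (f≈g t)) (d t)
  degree-cong (suc n) f≈g d = degree-cong n (λ t → +-cong (f≈g _) (-‿cong (f≈g t))) d

  degree-zero : ∀ n → (∀ t → f t ≈ 0#) → Degree< n f
  degree-zero zero    f≈0 = f≈0
  degree-zero (suc n) f≈0 = degree-zero n λ t →
    trans (+-cong (f≈0 _) (trans (-‿cong (f≈0 t)) -0#≈0#)) (+-identityʳ _)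

  degree-weaken : ∀ n f → Degree< n f → Degree< (suc n) f
  degree-weaken zero    f d = degree-zero 1 d
  degree-weaken (suc n) f d = degree-weaken n _ d

  degree-≤ : m ℕ.≤′ n → ∀ f → Degree< m f → Degree< n f
  degree-≤ ℕ.≤′-refl       f d = d
  degree-≤ {n = suc n} (ℕ.≤′-step m≤n) f d = degree-weaken n f (degree-≤ m≤n f d)

  degree-shift : ∀ n → Degree< n f → Degree< n (λ t → f (t + 1#))
  degree-shift zero    d = λ t → d (t + 1#)
  degree-shift (suc n) d = degree-shift n d

  degree-+ : ∀ n → Degree< n f → Degree< n g → Degree< n (λ t → f t + g t)
  degree-+ zero    d e = λ t → trans (+-cong (d t) (e t)) (+-identityʳ _)
  degree-+ (suc n) d e = degree-cong n
    (λ t → solve 4 (λ a b c d → (a :- b) :+ (c :- d) := (a :+ c) :- (b :+ d)) refl _ _ _ _)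
    (degree-+ n d e)

  -- The Leibniz rule for differences, with `f` shifted in one of the two terms. The bound is not
  -- sharp; some finite bound suffices.
  degree-* : ∀ m n → Degree< m f → Degree< n g → Degree< (m ℕ.+ n) (λ t → f t * g t)
  degree-* zero    n d e = degree-zero n λ t → trans (*-congʳ (d t)) (zeroˡ _)
  degree-* (suc m) zero d e = degree-zero (suc m ℕ.+ zero) λ t → trans (*-congˡ (e t)) (zeroʳ _)
  degree-* {f} {g} (suc m) (suc n) d e = degree-cong (m ℕ.+ suc n)
    (λ t → solve 4 (λ f⁺ f g⁺ g → f⁺ :* (g⁺ :- g) :+ (f⁺ :- f) :* g := f⁺ :* g⁺ :- f :* g)
       refl (f (t + 1#)) (f t) (g (t + 1#)) (g t))
    (degree-+ (m ℕ.+ suc n)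
      (subst (λ k → Degree< k (λ t → f (t + 1#) * (g (t + 1#) - g t))) (≡.sym (ℕₚ.+-suc m n))
        (degree-* (suc m) n (degree-shift {f} (suc m) d) e))
      (degree-* m (suc n) d e))

  -- A function on a setoid need not respect `≈`, and `poly-vanish` moves between arguments such as
  -- `0# + 1#` and `1 ⋆ 1#`; hence the field `congruent`.
  record Polynomial (f : Carrier → Carrier) : Set (c ⊔ ℓ) where
    constructor polynomial
    field
      congruent : ∀ {s t} → s ≈ t → f s ≈ f t
      bound     : ℕ
      degree    : Degree< bound f


  poly-cong : (∀ t → f t ≈ g t) → Polynomial f → Polynomial g
  poly-cong f≈g (polynomial f-cong n d) = polynomial
    (λ {s} {t} s≈t → trans (sym (f≈g s)) (trans (f-cong s≈t) (f≈g t))) n (degree-cong n f≈g d)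

  poly-const : ∀ a → Polynomial (λ _ → a)
  poly-const a = polynomial (λ _ → refl) 1 λ _ → -‿inverseʳ a

  poly-id : Polynomial (λ t → t)
  poly-id = polynomial (λ s≈t → s≈t) 2 λ t →
    solve 2 (λ t u → (t :+ u :+ u :- (t :+ u)) :- (t :+ u :- t) := con (+ 0)) refl t 1#

  poly-+ : Polynomial f → Polynomial g → Polynomial (λ t → f t + g t)
  poly-+ (polynomial f-cong m d) (polynomial g-cong n e) = polynomial
    (λ s≈t → +-cong (f-cong s≈t) (g-cong s≈t)) (m ℕ.+ n)
    (degree-+ (m ℕ.+ n) (degree-≤ (ℕₚ.≤⇒≤′ (ℕₚ.m≤m+n m n)) _ d) (degree-≤ (ℕₚ.≤⇒≤′ (ℕₚ.m≤n+m n m)) _ e))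

  poly-* : Polynomial f → Polynomial g → Polynomial (λ t → f t * g t)
  poly-* (polynomial f-cong m d) (polynomial g-cong n e) = polynomial
    (λ s≈t → *-cong (f-cong s≈t) (g-cong s≈t)) (m ℕ.+ n) (degree-* m n d e)

  poly-neg : Polynomial f → Polynomial (λ t → - f t)
  poly-neg pf = poly-cong (λ t → -1*x≈-x _) (poly-* (poly-const (- 1#)) pf)

  poly-∑ : {f : Fin m → Carrier → Carrier} → (∀ i → Polynomial (f i)) → Polynomial (λ t → ∑ λ i → f i t)
  poly-∑ {zero}  pf = poly-cong (λ t → reflexive (≡.sym (∑-[] _))) (poly-const 0#)
  poly-∑ {suc m} pf = poly-cong (λ t → reflexive (≡.sym (∑-∷ _))) (poly-+ (pf zero) (poly-∑ (pf ∘ suc)))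

  poly-∏ : {f : Fin m → Carrier → Carrier} → (∀ i → Polynomial (f i)) →
           Polynomial (λ t → ∏ λ i → f i t)
  poly-∏ {zero}  pf = poly-cong (λ t → reflexive (≡.sym (∏-[] _))) (poly-const 1#)
  poly-∏ {suc m} pf = poly-cong (λ t → reflexive (≡.sym (∏-∷ _))) (poly-* (pf zero) (poly-∏ (pf ∘ suc)))

  poly-det : {M : Carrier → Matrix m m} → (∀ i j → Polynomial (λ t → M t i j)) →
             Polynomial (λ t → det (M t))
  poly-det {zero}  pM = poly-cong (λ t → reflexive (≡.sym (det-[] _))) (poly-const 1#)
  poly-det {suc m} pM = poly-cong (λ t → reflexive (≡.sym (det-∷ _)))
    (poly-∑ λ j → poly-* (poly-const ((- 1#) ^ toℕ j))
      (poly-* (pM zero j) (poly-det λ i k → pM (suc i) (punchIn j k))))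

  -- The difference Δf also vanishes at 1, 2, ..., hence at 0 by induction on the bound, and f 0 = f
  -- 1 - Δf 0. No division and no count of roots is involved.
  poly-vanish : Polynomial f → (∀ k → f (suc k ⋆ 1#) ≈ 0#) → f 0# ≈ 0#
  poly-vanish {f} (polynomial f-cong n d) = go n f f-cong d
    where
    go : ∀ n f → (∀ {s t} → s ≈ t → f s ≈ f t) → Degree< n f →
         (∀ k → f (suc k ⋆ 1#) ≈ 0#) → f 0# ≈ 0#
    go zero    f f-cong d f≈0 = d 0#
    go (suc n) f f-cong d f≈0 = begin
      f 0#  ≈⟨ solve 2 (λ a b → b := a :- (a :- b)) refl (f (0# + 1#)) (f 0#) ⟩
      f (0# + 1#) - (f (0# + 1#) - f 0#)
        ≈⟨ +-cong (trans (f-cong (+-comm _ _)) (f≈0 0)) (-‿cong (go n _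
             (λ s≈t → +-cong (f-cong (+-congʳ s≈t)) (-‿cong (f-cong s≈t))) d
             λ k → trans (+-cong (trans (f-cong (+-comm _ _)) (f≈0 (suc k))) (-‿cong (f≈0 k)))
                         (-‿inverseʳ _))) ⟩
      0# - 0#  ≈⟨ -‿inverseʳ _ ⟩
      0#  ∎

-- The pseudo determinant as an ordinary determinant.

module PseudoDeterminant {c ℓ₁ ℓ₂} (K : HeytingField c ℓ₁ ℓ₂) (charZero : CharZero K) where
  open HeytingField K using (_#_; #⇒invertible; heytingCommutativeRing)
  open HeytingCommutativeRing heytingCommutativeRing using (commutativeRing)
  open CommutativeRing commutativeRing hiding (zero)
  open Matrices commutativeRing
  open DeterminantProperties commutativeRing
  open PolynomialFunctions commutativeRing
  open IntegerMultiples commutativeRing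
  open Solver
  open RawSemiring (Semiring.rawSemiring semiring)
    using (_^_) renaming (_×_ to _⋆_)
  open import Algebra.Apartness.Properties.HeytingCommutativeRing heytingCommutativeRing
    using (#-congʳ; x-0≈x; 1#0; x#0y#0→xy#0)
  open import Algebra.Properties.Ring ring
  open import Data.Integer.Base using (+_)
  open import Data.Fin.Base using (toℕ; punchIn)
  open import Data.Fin.Properties using (_≟_)
  open import Relation.Binary.Reasoning.Setoid setoid
  private module LA = LinearAlgebra K

  private
    variable
      m : ℕ

  LA-det≈det : (M : Matrix m m) → LA.det M ≈ det M
  LA-det≈det {zero}  M = reflexive (≡.sym (det-[] M))
  LA-det≈det {suc m} M = begin
    LA.det M  ≡⟨ ∑≡sum _ ⟨
    _  ≈⟨ ∑-cong (λ j → *-congˡ {x = (- 1#) ^ toℕ j} (*-congˡ (LA-det≈det λ i k → M (suc i) (punchIn j k)))) ⟩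
    _  ≡⟨ det-∷ M ⟨
    det M  ∎

  scalar≈ : ∀ t (i j : Fin m) → LA.scalar t i j ≈ t * 𝟙 i j
  scalar≈ t i j with i ≟ j
  ... | yes ≡.refl = sym (trans (*-congˡ (reflexive (𝟙-diag i))) (*-identityʳ t))
  ... | no  i≢j    = sym (trans (*-congˡ (reflexive (𝟙-offdiag i≢j))) (zeroʳ t))

  #0-cancelˡ : ∀ {x y z} → x # 0# → x * y ≈ x * z → y ≈ z
  #0-cancelˡ {x} {y} {z} x#0 xy≈xz with #⇒invertible x#0
  ... | x⁻¹ , x⁻¹x≈1 , _ = begin
    y  ≈⟨ *-identityˡ y ⟨
    1# * y  ≈⟨ *-congʳ x⁻¹*x≈1 ⟨
    x⁻¹ * x * y  ≈⟨ *-assoc _ _ _ ⟩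
    x⁻¹ * (x * y)  ≈⟨ *-congˡ xy≈xz ⟩
    x⁻¹ * (x * z)  ≈⟨ *-assoc _ _ _ ⟨
    x⁻¹ * x * z  ≈⟨ *-congʳ x⁻¹*x≈1 ⟩
    1# * z  ≈⟨ *-identityˡ z ⟩
    z  ∎
    where
    -- Apartness from `0#` yields an inverse of the difference `x - 0#`.
    x⁻¹*x≈1 : x⁻¹ * x ≈ 1#
    x⁻¹*x≈1 = trans (*-congˡ (sym (x-0≈x x))) x⁻¹x≈1

  module _ (M Q : Matrix m m) (s : LA.Spectrum M)
           (MQ≈0 : M · Q ≋ 𝟘) (QQ≈Q : Q · Q ≋ Q) (nonsingular : det (M ⊞ Q) # 0#) where
    open LA.Spectrum s

    private
      -- The two factors of t + M; the second one is 1 on the kernel of Q and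
      -- t on its image, so that det (right t) is a power of t.
      left right : Carrier → Matrix m m
      left  t i j = M i j + (t * 𝟙 i j + (1# - t) * Q i j)
      right t i j = 𝟙 i j + (t - 1#) * Q i j

      F f : Carrier → Carrier
      F t = det (left t)
      f t = det (right t)

      ·-right : ∀ (X : Matrix m m) t i j → (X · right t) i j ≈ X i j + (t - 1#) * (X · Q) i j
      ·-right X t i j = begin
        ∑ (λ k → X i k * (𝟙 k j + (t - 1#) * Q k j))
          ≈⟨ ∑-cong (λ k → solve 4 (λ x d a q → x :* (d :+ a :* q) := x :* d :+ a :* (x :* q)) refl _ _ _ _) ⟩
        ∑ (λ k → X i k * 𝟙 k j + (t - 1#) * (X i k * Q k j))
          ≈⟨ ∑-+ _ _ ⟩
        ∑ (λ k → X i k * 𝟙 k j) + ∑ (λ k → (t - 1#) * (X i k * Q k j))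
          ≈⟨ +-cong (∑-𝟙ʳ j (X i)) (sym (*-∑ (t - 1#) _)) ⟩
        X i j + (t - 1#) * (X · Q) i j ∎

      left·Q : ∀ t → left t · Q ≋ Q
      left·Q t i j = begin
        ∑ (λ k → (M i k + (t * 𝟙 i k + (1# - t) * Q i k)) * Q k j)
          ≈⟨ ∑-cong (λ k → solve 6 (λ m t d a q r → (m :+ (t :* d :+ a :* q)) :* r
               := m :* r :+ (t :* (d :* r) :+ a :* (q :* r))) refl _ _ _ _ _ _) ⟩
        ∑ (λ k → M i k * Q k j + (t * (𝟙 i k * Q k j) + (1# - t) * (Q i k * Q k j)))
          ≈⟨ trans (∑-+ _ _) (+-congˡ (∑-+ _ _)) ⟩
        ∑ (λ k → M i k * Q k j) + (∑ (λ k → t * (𝟙 i k * Q k j)) + ∑ (λ k → (1# - t) * (Q i k * Q k j)))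
          ≈⟨ +-cong (MQ≈0 i j) (+-cong
               (trans (sym (*-∑ t _)) (*-congˡ (∑-𝟙ˡ i λ k → Q k j)))
               (trans (sym (*-∑ (1# - t) _)) (*-congˡ (QQ≈Q i j)))) ⟩
        0# + (t * Q i j + (1# - t) * Q i j)
          ≈⟨ solve 3 (λ t u q → con (+ 0) :+ (t :* q :+ (u :- t) :* q) := u :* q) refl t 1# _ ⟩
        1# * Q i j ≈⟨ *-identityˡ _ ⟩
        Q i j ∎

      right·Q : ∀ t i j → (right t · Q) i j ≈ t * Q i j
      right·Q t i j = begin
        ∑ (λ k → (𝟙 i k + (t - 1#) * Q i k) * Q k j)
          ≈⟨ ∑-cong (λ k → solve 4 (λ d a q r → (d :+ a :* q) :* r
               := d :* r :+ a :* (q :* r)) refl _ _ _ _) ⟩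
        ∑ (λ k → 𝟙 i k * Q k j + (t - 1#) * (Q i k * Q k j))
          ≈⟨ ∑-+ _ _ ⟩
        ∑ (λ k → 𝟙 i k * Q k j) + ∑ (λ k → (t - 1#) * (Q i k * Q k j))
          ≈⟨ +-cong (∑-𝟙ˡ i λ k → Q k j) (trans (sym (*-∑ (t - 1#) _)) (*-congˡ (QQ≈Q i j))) ⟩
        Q i j + (t - 1#) * Q i j ≈⟨ +-congʳ (*-identityˡ _) ⟨
        1# * Q i j + (t - 1#) * Q i j
          ≈⟨ solve 3 (λ t u q → u :* q :+ (t :- u) :* q := t :* q) refl t 1# _ ⟩
        t * Q i j ∎

      f-* : ∀ t u → f (t * u) ≈ f t * f u
      f-* t u = trans (det-cong λ i j → sym (begin
        (right t · right u) i j  ≈⟨ ·-right (right t) u i j ⟩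
        right t i j + (u - 1#) * (right t · Q) i j  ≈⟨ +-congˡ (*-congˡ (right·Q t i j)) ⟩
        right t i j + (u - 1#) * (t * Q i j)
          ≈⟨ solve 5 (λ d t u e q → d :+ (t :- e) :* q :+ (u :- e) :* (t :* q)
               := d :+ (t :* u :- e :+ (t :- e :* t)) :* q) refl (𝟙 i j) t u 1# (Q i j) ⟩
        𝟙 i j + (t * u - 1# + (t - 1# * t)) * Q i j
          ≈⟨ +-congˡ (*-congʳ (trans (+-congˡ (trans (+-congˡ (-‿cong (*-identityˡ t))) (-‿inverseʳ t))) (+-identityʳ _))) ⟩
        right (t * u) i j ∎)) (det-· (right t) (right u))

      -- This is `charPoly` at `- t` with a factor (-1)^m cancelled on both sides, so that the
      -- factorisation of t + M carries no signs.
      charPoly⁺ : ∀ t → det (λ i j → M i j + t * 𝟙 i j) ≈ ∏ λ i → t + eigenvalue i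
      charPoly⁺ t = -1^-cancel m (begin
        (- 1#) ^ m * det (λ i j → M i j + t * 𝟙 i j)  ≈⟨ det-scale (- 1#) (λ i j → M i j + t * 𝟙 i j) ⟨
        det (λ i j → - 1# * (M i j + t * 𝟙 i j))  ≈⟨ det-cong (λ i j → trans (-1*x≈-x _) (trans
            (solve 3 (λ x t d → :- (x :+ t :* d) := (:- t) :* d :- x) refl _ _ _)
            (+-congʳ (sym (scalar≈ (- t) i j))))) ⟩
        det (λ i j → LA.scalar (- t) i j - M i j)  ≈⟨ LA-det≈det (λ i j → LA.scalar (- t) i j - M i j) ⟨
        LA.det (λ i j → LA.scalar (- t) i j - M i j)  ≈⟨ charPoly (- t) ⟩
        _  ≡⟨ ∏≡product _ ⟨
        ∏ (λ i → - t - eigenvalue i)  ≈⟨ ∏-cong (λ i → trans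
            (solve 2 (λ t x → :- t :- x := :- (t :+ x)) refl _ _) (sym (-1*x≈-x _))) ⟩
        ∏ (λ i → - 1# * (t + eigenvalue i))  ≈⟨ ∏-scale (- 1#) (λ i → t + eigenvalue i) ⟩
        (- 1#) ^ m * ∏ (λ i → t + eigenvalue i) ∎)
        where
        -1^-cancel : ∀ k {x y} → (- 1#) ^ k * x ≈ (- 1#) ^ k * y → x ≈ y
        -1^-cancel zero    eq = trans (sym (*-identityˡ _)) (trans eq (*-identityˡ _))
        -1^-cancel (suc k) eq = -1^-cancel k (-‿injective
          (trans (sym (-1*x≈-x _)) (trans (sym (*-assoc _ _ _)) (trans eq (trans (*-assoc _ _ _) (-1*x≈-x _))))))

      zeroPart nonzeroPart : ∀ {x} → x ≈ 0# ⊎ x # 0# → Carrier → Carrier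
      zeroPart    (inj₁ _) t = t
      zeroPart    (inj₂ _) t = 1#
      nonzeroPart (inj₁ _) t = 1#
      nonzeroPart {x} (inj₂ _) t = t + x

      -- `τ t` is the power of t contributed by the zero eigenvalues and `N t` collects the other
      -- factors. Both follow the decisions recorded in `zero?`, so that `N 0#` is the pseudo
      -- determinant.
      τ N : Carrier → Carrier
      τ t = ∏ λ i → zeroPart (zero? i) t
      N t = ∏ λ i → nonzeroPart (zero? i) t

      τ*N : ∀ t → ∏ (λ i → t + eigenvalue i) ≈ τ t * N t
      τ*N t = trans (∏-cong λ i → split (zero? i)) (∏-* (λ i → zeroPart (zero? i) t) _)
        where
        split : ∀ {x} (d : x ≈ 0# ⊎ x # 0#) → t + x ≈ zeroPart d t * nonzeroPart d t
        split (inj₁ x≈0) = trans (+-congˡ x≈0) (trans (+-identityʳ t) (sym (*-identityʳ t)))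
        split (inj₂ _)   = sym (*-identityˡ _)

      τ-* : ∀ t u → τ (t * u) ≈ τ t * τ u
      τ-* t u = trans (∏-cong λ i → split (zero? i)) (∏-* (λ i → zeroPart (zero? i) t) _)
        where
        split : ∀ {x} (d : x ≈ 0# ⊎ x # 0#) → zeroPart d (t * u) ≈ zeroPart d t * zeroPart d u
        split (inj₁ _) = refl
        split (inj₂ _) = sym (*-identityˡ _)

      τ#0 : ∀ {t} → t # 0# → τ t # 0#
      τ#0 t#0 = #-congʳ (reflexive (≡.sym (∏≡product _))) (LA.∏#0 _ λ i → part (zero? i))
        where
        part : ∀ {x} (d : x ≈ 0# ⊎ x # 0#) → zeroPart d _ # 0#
        part (inj₁ _) = t#0
        part (inj₂ _) = 1#0

      N0≈Det : N 0# ≈ LA.Det M s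
      N0≈Det = trans (∏-cong part) (reflexive (∏≡product _))
        where
        part : ∀ i → nonzeroPart (zero? i) 0# ≈ nonzeroFactor i
        part i with zero? i
        ... | inj₁ _ = refl
        ... | inj₂ _ = +-identityˡ _

      F*f : ∀ t → F t * f t ≈ τ t * N t
      F*f t = begin
        F t * f t  ≈⟨ det-· (left t) (right t) ⟨
        det (left t · right t)  ≈⟨ det-cong (λ i j → trans (·-right (left t) t i j) (trans
            (+-congˡ (*-congˡ (left·Q t i j)))
            (solve 5 (λ x t d u q → x :+ (t :* d :+ (u :- t) :* q) :+ (t :- u) :* q := x :+ t :* d)
               refl (M i j) t (𝟙 i j) 1# (Q i j)))) ⟩
        det (λ i j → M i j + t * 𝟙 i j)  ≈⟨ charPoly⁺ t ⟩
        ∏ (λ i → t + eigenvalue i)  ≈⟨ τ*N t ⟩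
        τ t * N t  ∎

      poly-F : ∀ {g} → Polynomial g → Polynomial (λ t → F (g t))
      poly-F pg = poly-det λ i j → poly-+ (poly-const _)
        (poly-+ (poly-* pg (poly-const _)) (poly-* (poly-+ (poly-const 1#) (poly-neg pg)) (poly-const _)))

      poly-N : ∀ {g} → Polynomial g → Polynomial (λ t → N (g t))
      poly-N {g} pg = poly-∏ λ i → part (zero? i)
        where
        part : ∀ {x} (d : x ≈ 0# ⊎ x # 0#) → Polynomial (λ t → nonzeroPart d (g t))
        part (inj₁ _) = poly-const 1#
        part (inj₂ _) = poly-+ pg (poly-const _)

      F0≈ : F 0# ≈ det (M ⊞ Q)
      F0≈ = det-cong λ i j → +-congˡ (trans
        (+-cong (zeroˡ _) (*-congʳ (trans (+-congˡ -0#≈0#) (+-identityʳ _))))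
        (trans (+-identityˡ _) (*-identityˡ _)))

      -- Scaling the argument of F f = τ N by u and cancelling τ u gives a
      -- polynomial identity in u, whose value at 0 determines f.
      f≈τ : ∀ t → f t ≈ τ t
      f≈τ t = #0-cancelˡ F0N0#0 (trans
        (solve 3 (λ a b c → a :* b :* c := a :* c :* b) refl (F 0#) (N 0#) (f t))
        (trans at0 (solve 3 (λ a b c → a :* b :* c := c :* b :* a) refl (τ t) (N 0#) (F 0#))))
        where
        F0N0#0 : F 0# * N 0# # 0#
        F0N0#0 = x#0y#0→xy#0 (#-congʳ (sym F0≈) nonsingular) (#-congʳ (sym N0≈Det) (LA.Det#0 M s))
        G : Carrier → Carrier
        G u = F (t * u) * f t * N u - τ t * N (t * u) * F u
        poly-tu : Polynomial (λ u → t * u)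
        poly-tu = poly-* (poly-const t) poly-id
        poly-G : Polynomial G
        poly-G = poly-+ (poly-* (poly-* (poly-F poly-tu) (poly-const (f t))) (poly-N poly-id))
          (poly-neg (poly-* (poly-* (poly-const (τ t)) (poly-N poly-tu)) (poly-F poly-id)))
        G-vanish : ∀ k → G (suc k ⋆ 1#) ≈ 0#
        G-vanish k = trans (+-congʳ (#0-cancelˡ (τ#0 (charZero k)) (begin
          τ u * (F (t * u) * f t * N u)
            ≈⟨ solve 4 (λ a b c d → a :* (b :* c :* d) := b :* c :* (a :* d)) refl _ _ _ _ ⟩
          F (t * u) * f t * (τ u * N u)  ≈⟨ *-congˡ (F*f u) ⟨
          F (t * u) * f t * (F u * f u)
            ≈⟨ solve 4 (λ a b c d → a :* b :* (c :* d) := a :* (b :* d) :* c) refl _ _ _ _ ⟩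
          F (t * u) * (f t * f u) * F u  ≈⟨ *-congʳ (*-congˡ (f-* t u)) ⟨
          F (t * u) * f (t * u) * F u  ≈⟨ *-congʳ (F*f (t * u)) ⟩
          τ (t * u) * N (t * u) * F u  ≈⟨ *-congʳ (*-congʳ (τ-* t u)) ⟩
          τ t * τ u * N (t * u) * F u
            ≈⟨ solve 4 (λ a b c d → a :* b :* c :* d := b :* (a :* c :* d)) refl _ _ _ _ ⟩
          τ u * (τ t * N (t * u) * F u)  ∎))) (-‿inverseʳ _)
          where u = suc k ⋆ 1#
        at0 : F 0# * f t * N 0# ≈ τ t * N 0# * F 0#
        at0 = begin
          F 0# * f t * N 0#  ≈⟨ *-congʳ (*-congʳ (Polynomial.congruent (poly-F poly-id) (zeroʳ t))) ⟨
          F (t * 0#) * f t * N 0#  ≈⟨ x-y≈0⇒x≈y (poly-vanish poly-G G-vanish) ⟩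
          τ t * N (t * 0#) * F 0#  ≈⟨ *-congʳ (*-congˡ (Polynomial.congruent (poly-N poly-id) (zeroʳ t))) ⟩
          τ t * N 0# * F 0#  ∎
          where
          x-y≈0⇒x≈y : ∀ {x y} → x - y ≈ 0# → x ≈ y
          x-y≈0⇒x≈y = x∙y⁻¹≈ε⇒x≈y _ _

    -- Once f = τ, cancelling τ in F f = τ N gives F = N at all positive integers. Then F - N
    -- vanishes at 0 too, where the two sides are the two determinants in question.
    Det≈det-⊞ : LA.Det M s ≈ det (M ⊞ Q)
    Det≈det-⊞ = begin
      LA.Det M s  ≈⟨ N0≈Det ⟨
      N 0#  ≈⟨ x∙y⁻¹≈ε⇒x≈y _ _ (poly-vanish
                        (poly-+ (poly-F poly-id) (poly-neg (poly-N poly-id)))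
                        (λ k → trans (+-congʳ (#0-cancelˡ (τ#0 (charZero k))
                          (trans (*-congʳ (sym (f≈τ _))) (trans (*-comm _ _) (F*f _))))) (-‿inverseʳ _))) ⟨
      F 0#  ≈⟨ F0≈ ⟩
      det (M ⊞ Q)  ∎

-- Block matrices.

module BlockMatrices {c ℓ} (R : CommutativeRing c ℓ) where
  open CommutativeRing R hiding (zero)
  open Matrices R
  open import Data.Fin.Base using (_↑ˡ_; _↑ʳ_; splitAt)
  open import Data.Fin.Properties using (splitAt⁻¹-↑ˡ; splitAt⁻¹-↑ʳ)
  open import Data.Vec.Functional using (_++_)
  open import Data.Vec.Functional.Properties using (lookup-++ˡ; lookup-++ʳ)

  private
    variable
      m n p q r s : ℕ

  infixr 5 _∣_ _⫽_
  _∣_ : Matrix p m → Matrix p n → Matrix p (m ℕ.+ n)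
  (A ∣ B) i = A i ++ B i

  _⫽_ : Matrix m p → Matrix n p → Matrix (m ℕ.+ n) p
  A ⫽ B = A ++ B

  ∣-ˡ : (A : Matrix p m) (B : Matrix p n) → ∀ i j → (A ∣ B) i (j ↑ˡ n) ≡ A i j
  ∣-ˡ A B i j = lookup-++ˡ (A i) (B i) j

  ∣-ʳ : (A : Matrix p m) (B : Matrix p n) → ∀ i j → (A ∣ B) i (m ↑ʳ j) ≡ B i j
  ∣-ʳ A B i j = lookup-++ʳ (A i) (B i) j

  ⫽-ˡ : (A : Matrix m p) (B : Matrix n p) → ∀ i j → (A ⫽ B) (i ↑ˡ n) j ≡ A i j
  ⫽-ˡ A B i j = cong (λ r → r j) (lookup-++ˡ A B i)

  ⫽-ʳ : (A : Matrix m p) (B : Matrix n p) → ∀ i j → (A ⫽ B) (m ↑ʳ i) j ≡ B i j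
  ⫽-ʳ A B i j = cong (λ r → r j) (lookup-++ʳ A B i)

  ↑-elim : ∀ {a} m {n} (P : Fin (m ℕ.+ n) → Set a) →
           (∀ i → P (i ↑ˡ n)) → (∀ j → P (m ↑ʳ j)) → ∀ k → P k
  ↑-elim m P l r k with splitAt m k in eq
  ... | inj₁ i = subst P (splitAt⁻¹-↑ˡ eq) (l i)
  ... | inj₂ j = subst P (splitAt⁻¹-↑ʳ eq) (r j)

  block-≋ : {M N : Matrix (m ℕ.+ n) (p ℕ.+ q)} →
    (∀ i j → M (i ↑ˡ n) (j ↑ˡ q) ≈ N (i ↑ˡ n) (j ↑ˡ q)) →
    (∀ i j → M (i ↑ˡ n) (p ↑ʳ j) ≈ N (i ↑ˡ n) (p ↑ʳ j)) →
    (∀ i j → M (m ↑ʳ i) (j ↑ˡ q) ≈ N (m ↑ʳ i) (j ↑ˡ q)) →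
    (∀ i j → M (m ↑ʳ i) (p ↑ʳ j) ≈ N (m ↑ʳ i) (p ↑ʳ j)) → M ≋ N
  block-≋ {m} {n} {p} {q} {M} {N} a b c d =
    ↑-elim m (λ i → ∀ j → M i j ≈ N i j)
      (λ i → ↑-elim p (λ j → M (i ↑ˡ n) j ≈ N (i ↑ˡ n) j) (a i) (b i))
      (λ i → ↑-elim p (λ j → M (m ↑ʳ i) j ≈ N (m ↑ʳ i) j) (c i) (d i))

  ∣·⫽ : (A : Matrix p m) (B : Matrix p n) (C : Matrix m q) (D : Matrix n q) →
        (A ∣ B) · (C ⫽ D) ≋ (A · C) ⊞ (B · D)
  ∣·⫽ {m = m} A B C D i k = trans (∑-split m _) (+-cong
    (∑-cong λ j → reflexive (cong₂ _*_ (∣-ˡ A B i j) (⫽-ˡ C D j k)))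
    (∑-cong λ j → reflexive (cong₂ _*_ (∣-ʳ A B i j) (⫽-ʳ C D j k))))

  𝟙-↑ˡ : ∀ {m} n (i j : Fin m) → 𝟙 (i ↑ˡ n) (j ↑ˡ n) ≡ 𝟙 i j
  𝟙-↑ˡ n zero    zero    = ≡.refl
  𝟙-↑ˡ n zero    (suc j) = ≡.refl
  𝟙-↑ˡ n (suc i) zero    = ≡.refl
  𝟙-↑ˡ n (suc i) (suc j) = 𝟙-↑ˡ n i j

  𝟙-↑ʳ : ∀ m {n} (i j : Fin n) → 𝟙 (m ↑ʳ i) (m ↑ʳ j) ≡ 𝟙 i j
  𝟙-↑ʳ zero    i j = ≡.refl
  𝟙-↑ʳ (suc m) i j = 𝟙-↑ʳ m i j

  𝟙-↑ˡ-↑ʳ : ∀ {m n} (i : Fin m) (j : Fin n) → 𝟙 (i ↑ˡ n) (m ↑ʳ j) ≡ 0#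
  𝟙-↑ˡ-↑ʳ zero    j = ≡.refl
  𝟙-↑ˡ-↑ʳ (suc i) j = 𝟙-↑ˡ-↑ʳ i j

  𝟙-↑ʳ-↑ˡ : ∀ {m n} (i : Fin n) (j : Fin m) → 𝟙 (m ↑ʳ i) (j ↑ˡ n) ≡ 0#
  𝟙-↑ʳ-↑ˡ i zero    = ≡.refl
  𝟙-↑ʳ-↑ˡ i (suc j) = 𝟙-↑ʳ-↑ˡ i j

-- Complexes with a contraction.

module _ {c ℓ} (R : CommutativeRing c ℓ) where
  open Matrices R

  -- The projection e h onto the image of the coboundary arriving in degree `k`; nothing arrives in
  -- degree zero. It precedes the record because the field `he` mentions it.
  imageProjection : (rank : ℕ → ℕ) → (∀ k → Matrix (rank (suc k)) (rank k)) →
    (∀ k → Matrix (rank k) (rank (suc k))) → ∀ k → Matrix (rank k) (rank k)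
  imageProjection rank e h zero    = 𝟘
  imageProjection rank e h (suc k) = e k · h k

record ContractedComplex {c ℓ} (R : CommutativeRing c ℓ) : Set (c ⊔ ℓ) where
  open Matrices R
  field
    rank : ℕ → ℕ
    e    : ∀ k → Matrix (rank (suc k)) (rank k)
    h    : ∀ k → Matrix (rank k) (rank (suc k))
    ee   : ∀ k → e (suc k) · e k ≋ 𝟘
    hh   : ∀ k → h k · h (suc k) ≋ 𝟘
    he   : ∀ k → (h k · e k) ⊞ imageProjection R rank e h k ≋ 𝟙

  Q : ∀ k → Matrix (rank k) (rank k)
  Q = imageProjection R rank e h

  -- On the image of Q k this is the identity, and on a complement it induces e†e.
  B : ∀ k → Matrix (rank k) (rank k)
  B k = ((e k) † · e k) ⊞ Q k

-- The even and the odd part of a contracted complex.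

-- The indices are a number m of degrees and an offset o, and run through the degrees
-- o, o + 2, … (Even) or o + 1, o + 3, … (Odd) below o + m.  On the sums of the
-- corresponding modules D is e + e†, and W and V are the two halves of e + h.
module EvenOdd {c ℓ} (R : CommutativeRing c ℓ) (C : ContractedComplex R) where
  open CommutativeRing R hiding (zero)
  open Matrices R
  open BlockMatrices R
  open DeterminantProperties R
  open ContractedComplex C
  open import Data.Fin.Base using (_↑ˡ_; _↑ʳ_)
  open import Relation.Binary.Reasoning.Setoid setoid
  import Data.Nat.Properties as ℕₚ

  mutual
    Even Odd : ℕ → ℕ → ℕ
    Even zero    o = 0
    Even (suc m) o = rank o ℕ.+ Odd m (suc o)
    Odd zero    o = 0
    Odd (suc m) o = Even m (suc o)

  col : ∀ m o → Matrix (Even m (suc o)) (rank o)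
  col zero    o = λ ()
  col (suc m) o = e o ⫽ 𝟘

  row : ∀ m o → Matrix (rank o) (Even m (suc o))
  row zero    o = λ _ ()
  row (suc m) o = h o ∣ 𝟘

  -- Splitting off degree `o` interchanges even and odd. Since e + e† is symmetric, its other half
  -- is a transpose; e + h is not symmetric, so that its halves `W` and `V` are defined together.
  D : ∀ m o → Matrix (Odd m o) (Even m o)
  D zero    o = λ ()
  D (suc m) o = col m o ∣ D m (suc o) †

  mutual
    W : ∀ m o → Matrix (Odd m o) (Even m o)
    W zero    o = λ ()
    W (suc m) o = col m o ∣ V m (suc o)

    V : ∀ m o → Matrix (Even m o) (Odd m o)
    V zero    o = λ ()
    V (suc m) o = row m o ⫽ W m (suc o)

  -- The defect caused by cutting off the degrees below `o`: in degree `o` only h e = 1 - Q is left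
  -- of h e + e h = 1.
  corner : ∀ m o → Matrix (Even m o) (Even m o)
  corner zero    o = λ ()
  corner (suc m) o = (Q o ∣ 𝟘) ⫽ 𝟘

  private
    Fin-empty : ∀ {a} {n} {A : Set a} → n ≡ 0 → Fin n → A
    Fin-empty ≡.refl ()

    ∑-empty : ∀ {n} (f : Fin n → Carrier) → n ≡ 0 → ∑ f ≈ 0#
    ∑-empty f n≡0 = ∑-zero f λ i → Fin-empty n≡0 i

  -- The last block is cut off, which is harmless because the next module is zero.

  row·col : ∀ m o → rank (m ℕ.+ suc o) ≡ 0 → row m o · col m o ≋ h o · e o
  row·col zero    o r≡0 i j = trans (reflexive (∑-[] _)) (sym (∑-empty _ r≡0))
  row·col (suc m) o r≡0 i j = trans (∣·⫽ (h o) 𝟘 (e o) 𝟘 i j)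
    (trans (+-congˡ (·-zeroˡ 𝟘 i j)) (+-identityʳ _))

  col†·col : ∀ m o → rank (m ℕ.+ suc o) ≡ 0 → col m o † · col m o ≋ e o † · e o
  col†·col zero    o r≡0 i j = trans (reflexive (∑-[] _)) (sym (∑-empty _ r≡0))
  col†·col (suc m) o r≡0 i j = trans (∑-split (rank (suc o)) _) (trans
    (+-cong (∑-cong λ k → reflexive (cong₂ _*_ (⫽-ˡ (e o) 𝟘 k i) (⫽-ˡ (e o) 𝟘 k j)))
            (∑-zero _ λ k → trans (*-congʳ (reflexive (⫽-ʳ (e o) 𝟘 k i))) (zeroˡ _)))
    (+-identityʳ _))

  col·row : ∀ m o → col m o · row m o ≋ corner m (suc o)
  col·row zero    o ()
  col·row (suc m) o = block-≋
    (λ i j → trans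
      (∑-cong λ k → reflexive (cong₂ _*_ (⫽-ˡ (e o) 𝟘 i k) (∣-ˡ (h o) 𝟘 k j)))
      (reflexive (≡.sym (≡.trans (⫽-ˡ (Q (suc o) ∣ 𝟘) 𝟘 i (j ↑ˡ _)) (∣-ˡ (Q (suc o)) 𝟘 i j)))))
    (λ i j → trans
      (∑-zero _ λ k → trans (*-congˡ (reflexive (∣-ʳ (h o) 𝟘 k j))) (zeroʳ _))
      (reflexive (≡.sym (≡.trans (⫽-ˡ (Q (suc o) ∣ 𝟘) 𝟘 i (_ ↑ʳ j)) (∣-ʳ (Q (suc o)) 𝟘 i j)))))
    (λ i j → lower i (j ↑ˡ _))
    (λ i j → lower i (rank (suc o) ↑ʳ j))
    where
    lower : ∀ i j → (col (suc m) o · row (suc m) o) (rank (suc o) ↑ʳ i) j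
                  ≈ corner (suc m) (suc o) (rank (suc o) ↑ʳ i) j
    lower i j = trans
      (∑-zero _ λ k → trans (*-congʳ (reflexive (⫽-ʳ (e o) 𝟘 i k))) (zeroˡ _))
      (reflexive (≡.sym (⫽-ʳ (Q (suc o) ∣ 𝟘) 𝟘 i j)))

  col·e : ∀ m o → col m (suc o) · e o ≋ 𝟘
  col·e zero    o ()
  col·e (suc m) o = ↑-elim (rank (suc (suc o))) _
    (λ i j → trans (∑-cong λ k → *-congʳ (reflexive (⫽-ˡ (e (suc o)) 𝟘 i k))) (ee o i j))
    (λ i j → ∑-zero _ λ k → trans (*-congʳ (reflexive (⫽-ʳ (e (suc o)) 𝟘 i k))) (zeroˡ _))

  h·row : ∀ m o → h o · row m (suc o) ≋ 𝟘
  h·row zero    o i ()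
  h·row (suc m) o i = ↑-elim (rank (suc (suc o))) _
    (λ j → trans (∑-cong λ k → *-congˡ (reflexive (∣-ˡ (h (suc o)) 𝟘 k j))) (hh o i j))
    (λ j → ∑-zero _ λ k → trans (*-congˡ (reflexive (∣-ʳ (h (suc o)) 𝟘 k j))) (zeroʳ _))

  [col∣]·col : ∀ m o (A : Matrix (Odd (suc m) (suc o)) (Odd m (suc (suc o)))) →
               (col m (suc o) ∣ A) · col (suc m) o ≋ 𝟘
  [col∣]·col m o A i j = trans (∣·⫽ (col m (suc o)) A (e o) 𝟘 i j)
    (trans (+-cong (col·e m o i j) (·-zeroʳ A i j)) (+-identityʳ _))

  D·col : ∀ m o → D m (suc o) · col m o ≋ 𝟘
  D·col zero    o ()
  D·col (suc m) o = [col∣]·col m o _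

  W·col : ∀ m o → W m (suc o) · col m o ≋ 𝟘
  W·col zero    o ()
  W·col (suc m) o = [col∣]·col m o _

  row·V : ∀ m o → row m o · V m (suc o) ≋ 𝟘
  row·V zero    o i ()
  row·V (suc m) o i j = trans (∣·⫽ (h o) 𝟘 (row m (suc o)) (W m (suc (suc o))) i j)
    (trans (+-cong (h·row m o i j) (·-zeroˡ (W m (suc (suc o))) i j)) (+-identityʳ _))

  private
    shift : ∀ m o → rank (suc m ℕ.+ o) ≡ 0 → rank (m ℕ.+ suc o) ≡ 0
    shift m o = ≡.trans (cong rank (ℕₚ.+-suc m o))

  mutual
    -- (e + h)² = h e + e h because e e and h h vanish. `W·V` needs no correction: it starts in
    -- degree o + 1, where `col · row` supplies the missing summand e h.
    V·W⊞corner : ∀ m o → rank (m ℕ.+ o) ≡ 0 → (V m o · W m o) ⊞ corner m o ≋ 𝟙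
    V·W⊞corner zero    o _   ()
    V·W⊞corner (suc m) o r≡0 = block-≋
      (λ i j → trans (+-cong
        (trans (∑-cong λ k → reflexive (cong₂ _*_ (⫽-ˡ (row m o) W′ i k) (∣-ˡ (col m o) V′ k j)))
               (row·col m o (shift m o r≡0) i j))
        (reflexive (≡.trans (⫽-ˡ (Q o ∣ 𝟘) 𝟘 i (j ↑ˡ _)) (∣-ˡ (Q o) 𝟘 i j))))
        (trans (he o i j) (reflexive (≡.sym (𝟙-↑ˡ _ i j)))))
      (λ i j → trans (+-cong
        (trans (∑-cong λ k → reflexive (cong₂ _*_ (⫽-ˡ (row m o) W′ i k) (∣-ʳ (col m o) V′ k j)))
               (row·V m o i j))
        (reflexive (≡.trans (⫽-ˡ (Q o ∣ 𝟘) 𝟘 i (_ ↑ʳ j)) (∣-ʳ (Q o) 𝟘 i j))))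
        (trans (+-identityʳ _) (reflexive (≡.sym (𝟙-↑ˡ-↑ʳ i j)))))
      (λ i j → trans (+-cong
        (trans (∑-cong λ k → reflexive (cong₂ _*_ (⫽-ʳ (row m o) W′ i k) (∣-ˡ (col m o) V′ k j)))
               (W·col m o i j))
        (reflexive (⫽-ʳ (Q o ∣ 𝟘) 𝟘 i (j ↑ˡ _))))
        (trans (+-identityʳ _) (reflexive (≡.sym (𝟙-↑ʳ-↑ˡ i j)))))
      (λ i j → trans (+-cong
        (trans (∑-cong λ k → reflexive (cong₂ _*_ (⫽-ʳ (row m o) W′ i k) (∣-ʳ (col m o) V′ k j)))
               (W·V m (suc o) (shift m o r≡0) i j))
        (reflexive (⫽-ʳ (Q o ∣ 𝟘) 𝟘 i (rank o ↑ʳ j))))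
        (trans (+-identityʳ _) (reflexive (≡.sym (𝟙-↑ʳ (rank o) i j)))))
      where
      W′ = W m (suc o)
      V′ = V m (suc o)

    W·V : ∀ m o → rank (m ℕ.+ o) ≡ 0 → W m o · V m o ≋ 𝟙
    W·V zero    o _   ()
    W·V (suc m) o r≡0 i j = begin
      (W (suc m) o · V (suc m) o) i j
        ≈⟨ ∣·⫽ (col m o) (V m (suc o)) (row m o) (W m (suc o)) i j ⟩
      (col m o · row m o) i j + (V m (suc o) · W m (suc o)) i j
        ≈⟨ +-comm _ _ ⟩
      (V m (suc o) · W m (suc o)) i j + (col m o · row m o) i j
        ≈⟨ +-congˡ (col·row m o i j) ⟩
      (V m (suc o) · W m (suc o)) i j + corner m (suc o) i j
        ≈⟨ V·W⊞corner m (suc o) (shift m o r≡0) i j ⟩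
      𝟙 i j ∎

  mutual
    evens odds : ℕ → ℕ → Carrier
    evens zero    o = 1#
    evens (suc m) o = det (B o) * odds m (suc o)
    odds zero    o = 1#
    odds (suc m) o = evens m (suc o)

  mutual
    -- The lower left block is `D·col`, which vanishes by e e = 0, and the first diagonal block is
    -- e†e + Q in degree `o`. The other diagonal block is D V for the higher degrees. There
    -- `det-D·V` leads back to this statement: the term e h of D V is precisely the corner of the
    -- complex that starts one degree higher.
    det-D†·W : ∀ m o → rank (m ℕ.+ o) ≡ 0 → det ((D m o † · W m o) ⊞ corner m o) ≈ evens m o
    det-D†·W zero    o _   = reflexive (det-[] _)
    det-D†·W (suc m) o r≡0 = trans
      (det-upperTriangular (rank o) _ λ i j → trans (+-cong
        (trans (∑-cong λ k → reflexive (cong₂ _*_ (∣-ʳ (col m o) D′ k i) (∣-ˡ (col m o) V′ k j)))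
               (D·col m o i j))
        (reflexive (⫽-ʳ (Q o ∣ 𝟘) 𝟘 i (j ↑ˡ _)))) (+-identityʳ _))
      (*-cong
        (det-cong λ i j → +-cong
          (trans (∑-cong λ k → reflexive (cong₂ _*_ (∣-ˡ (col m o) D′ k i) (∣-ˡ (col m o) V′ k j)))
                 (col†·col m o (shift m o r≡0) i j))
          (reflexive (≡.trans (⫽-ˡ (Q o ∣ 𝟘) 𝟘 i (j ↑ˡ _)) (∣-ˡ (Q o) 𝟘 i j))))
        (trans
          (det-cong λ i j → trans (+-cong
            (∑-cong λ k → reflexive (cong₂ _*_ (∣-ʳ (col m o) D′ k i) (∣-ʳ (col m o) V′ k j)))
            (reflexive (⫽-ʳ (Q o ∣ 𝟘) 𝟘 i (rank o ↑ʳ j)))) (+-identityʳ _))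
          (det-D·V m (suc o) (shift m o r≡0))))
      where
      D′ = D m (suc o) †
      V′ = V m (suc o)

    det-D·V : ∀ m o → rank (m ℕ.+ o) ≡ 0 → det (D m o · V m o) ≈ odds m o
    det-D·V zero    o _   = reflexive (det-[] _)
    det-D·V (suc m) o r≡0 = trans
      (det-cong λ i j → trans (∣·⫽ (col m o) (D m (suc o) †) (row m o) (W m (suc o)) i j)
        (trans (+-comm _ _) (+-congˡ (col·row m o i j))))
      (det-D†·W m (suc o) (shift m o r≡0))

  corner₀≋𝟘 : ∀ m → corner m 0 ≋ 𝟘
  corner₀≋𝟘 zero    ()
  corner₀≋𝟘 (suc m) = block-≋
    (λ i j → reflexive (≡.trans (⫽-ˡ (Q 0 ∣ 𝟘) 𝟘 i (j ↑ˡ _)) (∣-ˡ (Q 0) 𝟘 i j)))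
    (λ i j → reflexive (≡.trans (⫽-ˡ (Q 0 ∣ 𝟘) 𝟘 i (_ ↑ʳ j)) (∣-ʳ (Q 0) 𝟘 i j)))
    (λ i j → reflexive (⫽-ʳ (Q 0 ∣ 𝟘) 𝟘 i (j ↑ˡ _)))
    (λ i j → reflexive (⫽-ʳ (Q 0 ∣ 𝟘) 𝟘 i (_ ↑ʳ j)))

  module _ (m : ℕ) (r≡0 : rank m ≡ 0) where
    private
      r≡0′ : rank (m ℕ.+ 0) ≡ 0
      r≡0′ = ≡.trans (cong rank (ℕₚ.+-identityʳ m)) r≡0

    V·W≋𝟙 : V m 0 · W m 0 ≋ 𝟙
    V·W≋𝟙 i j = trans (sym (+-identityʳ _))
      (trans (+-congˡ (sym (corner₀≋𝟘 m i j))) (V·W⊞corner m 0 r≡0′ i j))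

    W·V≋𝟙 : W m 0 · V m 0 ≋ 𝟙
    W·V≋𝟙 = W·V m 0 r≡0′

    evens≈ : evens m 0 ≈ det (D m 0 † · W m 0)
    evens≈ = trans (sym (det-D†·W m 0 r≡0′))
      (det-cong λ i j → trans (+-congˡ (corner₀≋𝟘 m i j)) (+-identityʳ _))

    odds≈ : odds m 0 ≈ det (D m 0 · V m 0)
    odds≈ = sym (det-D·V m 0 r≡0′)

-- A contraction from exactness.

module Contraction {c ℓ} (R : CommutativeRing c ℓ) where
  open CommutativeRing R hiding (zero)
  open Matrices R
  open import Algebra.Properties.Ring ring
  open import Relation.Binary.Reasoning.Setoid setoid

  module _
    (rank : ℕ → ℕ) (e : ∀ k → Matrix (rank (suc k)) (rank k))
    (ee : ∀ k → e (suc k) · e k ≋ 𝟘)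
    (exact₀ : (x : Fin (rank 0) → Carrier) →
      ∃ λ (y : Fin (rank 1) → Carrier) → ∀ j → ∑ (λ i → y i * e 0 i j) ≈ x j)
    (exact : ∀ k (x : Fin (rank (suc k)) → Carrier) → (∀ j → ∑ (λ i → x i * e k i j) ≈ 0#) →
      ∃ λ (y : Fin (rank (suc (suc k))) → Carrier) → ∀ j → ∑ (λ i → y i * e (suc k) i j) ≈ x j)
    where

    private
      record Stage (k : ℕ) : Set (c ⊔ ℓ) where
        field
          Q  : Matrix (rank k) (rank k)
          eQ : e k · Q ≋ 𝟘
          h  : Matrix (rank k) (rank (suc k))
          he : (h · e k) ⊞ Q ≋ 𝟙

      -- Multiply h e + Q = 1 by e from the left and use e Q = 0.
      eheh : ∀ {k} (s : Stage k) → let open Stage s in (e k · h) · e k ≋ e k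
      eheh {k} s i j = begin
        ((e k · h) · e k) i j  ≈⟨ ·-assoc (e k) h (e k) i j ⟩
        (e k · (h · e k)) i j  ≈⟨ +-identityʳ _ ⟨
        (e k · (h · e k)) i j + 0#  ≈⟨ +-congˡ (eQ i j) ⟨
        (e k · (h · e k)) i j + (e k · Q) i j  ≈⟨ ·-distribˡ (e k) (h · e k) Q i j ⟨
        (e k · ((h · e k) ⊞ Q)) i j  ≈⟨ ·-cong {M = e k} (λ _ _ → refl) he i j ⟩
        (e k · 𝟙) i j  ≈⟨ ·-identityʳ (e k) i j ⟩
        e k i j  ∎
        where open Stage s

      complete : ∀ {k} (Q : Matrix (rank k) (rank k)) → e k · Q ≋ 𝟘 →
                 (∀ i → ∃ λ y → ∀ j → ∑ (λ l → y l * e k l j) ≈ 𝟙 i j - Q i j) → Stage k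
      complete Q eQ solve = record
        { Q  = Q
        ; eQ = eQ
        ; h  = λ i → proj₁ (solve i)
        ; he = λ i j → trans (+-congʳ (proj₂ (solve i) j))
            (trans (+-assoc _ _ _) (trans (+-congˡ (-‿inverseˡ _)) (+-identityʳ _)))
        }

      -- Row `i` of h is a preimage of row `i` of 1 - Q. For Q = e h from the previous stage that
      -- row is a cycle, since (1 - e h) e = e - e h e = 0. Exactness returns explicit preimages, so
      -- the rows form a matrix without any choice.
      stage : ∀ k → Stage k
      stage zero    = complete 𝟘 (·-zeroʳ (e 0)) λ i → exact₀ λ j → 𝟙 i j - 0#
      stage (suc k) = complete (e k · h)
        (λ i j → trans (sym (·-assoc (e (suc k)) (e k) h i j))
          (trans (·-cong {N = h} (ee k) (λ _ _ → refl) i j) (·-zeroˡ h i j)))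
        λ i → exact k (λ j → 𝟙 i j - (e k · h) i j) λ j → begin
          ∑ (λ l → (𝟙 i l - (e k · h) i l) * e k l j)
            ≈⟨ ∑-cong (λ l → [y-z]x≈yx-zx _ _ _) ⟩
          ∑ (λ l → 𝟙 i l * e k l j - (e k · h) i l * e k l j)
            ≈⟨ trans (∑-+ _ _) (+-congˡ (∑-neg _)) ⟩
          (𝟙 · e k) i j - ((e k · h) · e k) i j
            ≈⟨ +-cong (·-identityˡ (e k) i j) (-‿cong (eheh (stage k) i j)) ⟩
          e k i j - e k i j
            ≈⟨ -‿inverseʳ _ ⟩
          0# ∎
        where open Stage (stage k)

      h₀ : ∀ k → Matrix (rank k) (rank (suc k))
      h₀ k = Stage.h (stage k)

      ehe : ∀ k → (e k · h₀ k) · e k ≋ e k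
      ehe k = eheh (stage k)

      -- The contraction h₀ need not satisfy h₀ h₀ = 0.
      h : ∀ k → Matrix (rank k) (rank (suc k))
      h k = h₀ k · (e k · h₀ k)

      e·h : ∀ k → e k · h k ≋ e k · h₀ k
      e·h k i j = begin
        (e k · (h₀ k · (e k · h₀ k))) i j  ≈⟨ ·-assoc (e k) (h₀ k) (e k · h₀ k) i j ⟨
        ((e k · h₀ k) · (e k · h₀ k)) i j  ≈⟨ ·-assoc (e k · h₀ k) (e k) (h₀ k) i j ⟨
        (((e k · h₀ k) · e k) · h₀ k) i j  ≈⟨ ·-cong {N = h₀ k} (ehe k) (λ _ _ → refl) i j ⟩
        (e k · h₀ k) i j  ∎

      h·e : ∀ k → h k · e k ≋ h₀ k · e k
      h·e k i j = trans (·-assoc (h₀ k) (e k · h₀ k) (e k) i j)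
        (·-cong {M = h₀ k} (λ _ _ → refl) (ehe k) i j)

      projection≋ : ∀ k → imageProjection R rank e h k ≋ Stage.Q (stage k)
      projection≋ zero    i j = refl
      projection≋ (suc k) i j = e·h k i j

      -- `E` is idempotent and `H ⊞ E` is the identity, so E H = E - E E = 0.
      eh·he : ∀ k → (e k · h₀ k) · (h₀ (suc k) · e (suc k)) ≋ 𝟘
      eh·he k i j = begin
        (E · H) i j  ≈⟨ +-identityʳ _ ⟨
        (E · H) i j + 0#  ≈⟨ +-congˡ (-‿inverseʳ (E i j)) ⟨
        (E · H) i j + (E i j - E i j)  ≈⟨ +-assoc _ _ _ ⟨
        ((E · H) i j + E i j) - E i j  ≈⟨ +-congʳ (+-congˡ (EE i j)) ⟨
        ((E · H) i j + (E · E) i j) - E i j  ≈⟨ +-congʳ (·-distribˡ E H E i j) ⟨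
        (E · (H ⊞ E)) i j - E i j  ≈⟨ +-congʳ (·-cong {M = E} (λ _ _ → refl) (Stage.he (stage (suc k))) i j) ⟩
        (E · 𝟙) i j - E i j  ≈⟨ +-congʳ (·-identityʳ E i j) ⟩
        E i j - E i j  ≈⟨ -‿inverseʳ _ ⟩
        0#  ∎
        where
        E = e k · h₀ k
        H = h₀ (suc k) · e (suc k)
        EE : E · E ≋ E
        EE i j = trans (sym (·-assoc E (e k) (h₀ k) i j)) (·-cong {N = h₀ k} (ehe k) (λ _ _ → refl) i j)

    contract : ContractedComplex R
    contract = record
      { rank = rank
      ; e    = e
      ; h    = h
      ; ee   = ee
      ; hh   = λ k i j → begin
          ((h₀ k · E k) · (h₀ (suc k) · (e (suc k) · h₀ (suc k)))) i j
            ≈⟨ ·-assoc (h₀ k) (E k) (h₀ (suc k) · (e (suc k) · h₀ (suc k))) i j ⟩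
          (h₀ k · (E k · (h₀ (suc k) · (e (suc k) · h₀ (suc k))))) i j
            ≈⟨ ·-cong {M = h₀ k} (λ _ _ → refl) (λ i j → begin
                 (E k · (h₀ (suc k) · (e (suc k) · h₀ (suc k)))) i j
                   ≈⟨ ·-cong {M = E k} (λ _ _ → refl) (·-assoc (h₀ (suc k)) (e (suc k)) (h₀ (suc k))) i j ⟨
                 (E k · ((h₀ (suc k) · e (suc k)) · h₀ (suc k))) i j
                   ≈⟨ ·-assoc (E k) (h₀ (suc k) · e (suc k)) (h₀ (suc k)) i j ⟨
                 ((E k · (h₀ (suc k) · e (suc k))) · h₀ (suc k)) i j
                   ≈⟨ ·-cong {N = h₀ (suc k)} (eh·he k) (λ _ _ → refl) i j ⟩
                 (𝟘 · h₀ (suc k)) i j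
                   ≈⟨ ·-zeroˡ (h₀ (suc k)) i j ⟩
                 0# ∎) i j ⟩
          (h₀ k · 𝟘) i j
            ≈⟨ ·-zeroʳ (h₀ k) i j ⟩
          0# ∎
      ; he   = λ k i j → trans (+-cong (h·e k i j) (projection≋ k i j)) (Stage.he (stage k) i j)
      }
      where
      E : ∀ k → Matrix (rank (suc k)) (rank (suc k))
      E k = e k · h₀ k


-- Nonsingularity and units over a ring like the integers.

-- Of the integers, only these properties are used; arguing in an abstract ring
-- also keeps integer arithmetic from being unfolded.
record IsIntegerLike {c ℓ} (R : CommutativeRing c ℓ) : Set (c ⊔ ℓ) where
  open CommutativeRing R
  open Matrices R
  open RawSemiring (Semiring.rawSemiring semiring) using () renaming (_×_ to _⋆_)
  field
    1≉0         : ¬ (1# ≈ 0#)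
    integral    : ∀ {x y} → x * y ≈ 0# → x ≈ 0# ⊎ y ≈ 0#
    real        : ∀ {m} (x : Fin m → Carrier) → ∑ (λ i → x i * x i) ≈ 0# → ∀ i → x i ≈ 0#
    unit        : ∀ {x y} → x * y ≈ 1# → x ≈ y
    ⋆-injective : ∀ {m n} → m ⋆ 1# ≈ n ⋆ 1# → m ≡ n

module IntegerLike {c ℓ} (R : CommutativeRing c ℓ) (isIntegerLike : IsIntegerLike R) where
  open CommutativeRing R hiding (zero)
  open IsIntegerLike isIntegerLike
  open RawSemiring (Semiring.rawSemiring semiring) using () renaming (_×_ to _⋆_)
  open Matrices R
  open DeterminantProperties R
  open IntegerMultiples R
  open Solver
  open import Data.Integer.Base using (+_)
  open import Relation.Binary.Reasoning.Setoid setoid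

  private
    variable
      m n p q : ℕ

  column : (Fin m → Carrier) → Matrix m 1
  column x i _ = x i

  form : Matrix m m → (Fin m → Carrier) → Carrier
  form M x = ∑ λ i → x i * ∑ λ j → M i j * x j

  Anisotropic : Matrix m m → Set (c ⊔ ℓ)
  Anisotropic M = ∀ x → form M x ≈ 0# → ∀ i → x i ≈ 0#

  det-1×1 : (M : Matrix 1 1) → det M ≈ M zero zero
  det-1×1 M = begin
    det M  ≡⟨ ≡.trans (det-∷ M) (∑-∷ _) ⟩
    _  ≡⟨ cong₂ (λ d s → 1# * (M zero zero * d) + s) (det-[] _) (∑-[] _) ⟩
    1# * (M zero zero * 1#) + 0#  ≈⟨ trans (+-identityʳ _) (trans (*-identityˡ _) (*-identityʳ _)) ⟩
    M zero zero ∎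

  -- Elimination without pivoting or division: T M has first column (a , 0 , …).
  module _ (M : Matrix (suc m) (suc m)) where
    private
      a : Carrier
      a = M zero zero

      b c′ : Fin m → Carrier
      b  j = M zero (suc j)
      c′ i = M (suc i) zero

      N : Matrix m m
      N i j = M (suc i) (suc j)

      T : Matrix (suc m) (suc m)
      T zero    j       = 𝟙 zero j
      T (suc i) zero    = - c′ i
      T (suc i) (suc j) = a * 𝟙 i j

    schur : Matrix m m
    schur i j = a * N i j - c′ i * b j

    private
      T·M-suc : ∀ i k → (T · M) (suc i) k ≈ - c′ i * M zero k + a * M (suc i) k
      T·M-suc i k = trans (reflexive (∑-∷ _)) (+-congˡ (begin
        ∑ (λ j → a * 𝟙 i j * M (suc j) k)  ≈⟨ ∑-cong (λ j → *-assoc a (𝟙 i j) _) ⟩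
        ∑ (λ j → a * (𝟙 i j * M (suc j) k))  ≈⟨ *-∑ a _ ⟨
        a * ∑ (λ j → 𝟙 i j * M (suc j) k)  ≈⟨ *-congˡ (∑-𝟙ˡ i λ j → M (suc j) k) ⟩
        a * M (suc i) k  ∎))

    -- `T · M` is block upper triangular with diagonal blocks `a` and `schur`. `det T` stays
    -- unevaluated, as the identity serves to pass from det M ≈ 0 to a * det schur ≈ 0.
    det-schur : a * det schur ≈ det T * det M
    det-schur = begin
      a * det schur
        ≈⟨ *-cong (trans (det-1×1 _) (∑-𝟙ˡ zero (λ j → M j zero)))
             (det-cong λ i j → trans (T·M-suc i (suc j))
               (solve 4 (λ c b a n → (:- c) :* b :+ a :* n := a :* n :- c :* b) refl (c′ i) (b j) a (N i j))) ⟨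
      det (λ i j → (T · M) (i Fin.↑ˡ m) (j Fin.↑ˡ m)) * det (λ i j → (T · M) (suc i) (suc j))
        ≈⟨ det-upperTriangular 1 (T · M) (λ { i zero → trans (T·M-suc i zero)
             (solve 2 (λ c a → (:- c) :* a :+ a :* c := con (+ 0)) refl (c′ i) a) }) ⟨
      det (T · M)  ≈⟨ det-· T M ⟩
      det T * det M  ∎

    module _ (y : Fin m → Carrier) where
      private
        β : Carrier
        β = ∑ λ j → b j * y j

      -- Completing the square without division: scaling the tail by `a` allows the head `- β`, for
      -- which the first entry of `M` times the vector is - a β + a β = 0.
      complete : Fin (suc m) → Carrier
      complete zero    = - β
      complete (suc i) = a * y i

      private
        M·complete : ∀ k → ∑ (λ j → M k j * complete j) ≈ M k zero * - β + a * ∑ (λ j → M k (suc j) * y j)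
        M·complete k = trans (reflexive (∑-∷ _)) (+-congˡ (trans
          (∑-cong λ j → solve 3 (λ n a y → n :* (a :* y) := a :* (n :* y)) refl (M k (suc j)) a (y j))
          (sym (*-∑ a _))))

        schur·y : ∀ i → ∑ (λ j → schur i j * y j) ≈ c′ i * - β + a * ∑ (λ j → N i j * y j)
        schur·y i = begin
          ∑ (λ j → schur i j * y j)
            ≈⟨ ∑-cong (λ j → solve 5 (λ a n c b y → (a :* n :- c :* b) :* y
                 := (:- c) :* (b :* y) :+ a :* (n :* y)) refl a (N i j) (c′ i) (b j) (y j)) ⟩
          ∑ (λ j → - c′ i * (b j * y j) + a * (N i j * y j))
            ≈⟨ ∑-+ _ _ ⟩
          ∑ (λ j → - c′ i * (b j * y j)) + ∑ (λ j → a * (N i j * y j))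
            ≈⟨ +-cong (*-∑ (- c′ i) _) (*-∑ a _) ⟨
          - c′ i * β + a * ∑ (λ j → N i j * y j)
            ≈⟨ solve 3 (λ c β z → (:- c) :* β :+ z := c :* (:- β) :+ z) refl (c′ i) β _ ⟩
          c′ i * - β + a * ∑ (λ j → N i j * y j) ∎

      form-complete : form M complete ≈ a * form schur y
      form-complete = begin
        form M complete
          ≡⟨ ∑-∷ _ ⟩
        - β * ∑ (λ j → M zero j * complete j) + ∑ (λ i → a * y i * ∑ (λ j → M (suc i) j * complete j))
          ≈⟨ +-cong (*-congˡ (M·complete zero)) (∑-cong λ i → trans
               (*-congˡ (trans (M·complete (suc i)) (sym (schur·y i)))) (*-assoc a (y i) _)) ⟩
        - β * (a * - β + a * β) + ∑ (λ i → a * (y i * ∑ (λ j → schur i j * y j)))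
          ≈⟨ +-cong (solve 2 (λ a β → (:- β) :* (a :* (:- β) :+ a :* β) := con (+ 0)) refl a β)
               (sym (*-∑ a _)) ⟩
        0# + a * form schur y
          ≈⟨ +-identityˡ _ ⟩
        a * form schur y ∎

    anisotropic⇒a≉0 : Anisotropic M → ¬ (a ≈ 0#)
    anisotropic⇒a≉0 aniso a≈0 = 1≉0 (aniso (𝟙 zero) (begin
      form M (𝟙 zero)  ≈⟨ ∑-𝟙ˡ zero (λ i → ∑ λ j → M i j * 𝟙 zero j) ⟩
      ∑ (λ j → M zero j * 𝟙 zero j)  ≈⟨ ∑-cong (λ j → *-congˡ (reflexive (𝟙-sym zero j))) ⟩
      ∑ (λ j → M zero j * 𝟙 j zero)  ≈⟨ ∑-𝟙ʳ zero (M zero) ⟩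
      a  ≈⟨ a≈0 ⟩
      0#  ∎) zero)

  -- Induction through `schur`: a zero of its form completes to a zero of the form of `M`, so
  -- anisotropy descends, and so does a vanishing determinant. Anisotropy replaces definiteness, for
  -- which an order would be required.
  anisotropic⇒det≉0 : (M : Matrix m m) → Anisotropic M → ¬ (det M ≈ 0#)
  anisotropic⇒det≉0 {zero}  M aniso det≈0 = 1≉0 (trans (reflexive (≡.sym (det-[] M))) det≈0)
  anisotropic⇒det≉0 {suc m} M aniso det≈0 = anisotropic⇒det≉0 (schur M)
    (λ y form≈0 i → cancel (aniso (complete M y)
      (trans (form-complete M y) (trans (*-congˡ form≈0) (zeroʳ _))) (suc i)))
    (cancel (trans (det-schur M) (trans (*-congˡ det≈0) (zeroʳ _))))
    where
    cancel : ∀ {x} → M zero zero * x ≈ 0# → x ≈ 0#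
    cancel ax≈0 with integral ax≈0
    ... | inj₁ a≈0 = contradiction a≈0 (anisotropic⇒a≉0 M aniso)
    ... | inj₂ x≈0 = x≈0

  infixr 6 _⊛_
  _⊛_ : Matrix p q → (Fin q → Carrier) → Fin p → Carrier
  (M ⊛ x) i = ∑ λ j → M i j * x j

  ⊛-· : (M : Matrix p q) (N : Matrix q n) (x : Fin n → Carrier) → ∀ i → ((M · N) ⊛ x) i ≈ (M ⊛ N ⊛ x) i
  ⊛-· M N x i = ·-assoc M N (column x) i zero

  ⊛-⊞ : (M N : Matrix p q) (x : Fin q → Carrier) → ∀ i → ((M ⊞ N) ⊛ x) i ≈ (M ⊛ x) i + (N ⊛ x) i
  ⊛-⊞ M N x i = ·-distribʳ M N (column x) i zero

  ⊛-zeroʳ : (M : Matrix p q) {x : Fin q → Carrier} → (∀ j → x j ≈ 0#) → ∀ i → (M ⊛ x) i ≈ 0#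
  ⊛-zeroʳ M x≈0 i = ∑-zero _ λ j → trans (*-congˡ (x≈0 j)) (zeroʳ _)

  ⊛-zeroˡ : {M : Matrix p q} → M ≋ 𝟘 → (x : Fin q → Carrier) → ∀ i → (M ⊛ x) i ≈ 0#
  ⊛-zeroˡ M≋𝟘 x i = ∑-zero _ λ j → trans (*-congʳ (M≋𝟘 i j)) (zeroˡ _)

  adjoint : (M : Matrix p q) (x : Fin q → Carrier) (y : Fin p → Carrier) →
            ∑ (λ i → x i * (M † ⊛ y) i) ≈ ∑ (λ j → (M ⊛ x) j * y j)
  adjoint M x y = begin
    ∑ (λ i → x i * ∑ (λ j → M j i * y j))  ≈⟨ ∑-cong (λ i → *-∑ (x i) _) ⟩
    ∑ (λ i → ∑ (λ j → x i * (M j i * y j)))  ≈⟨ ∑-comm _ ⟩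
    ∑ (λ j → ∑ (λ i → x i * (M j i * y j)))  ≈⟨ ∑-cong (λ j → ∑-cong λ i →
        solve 3 (λ x m y → x :* (m :* y) := m :* x :* y) refl (x i) (M j i) (y j)) ⟩
    ∑ (λ j → ∑ (λ i → M j i * x i * y j))  ≈⟨ ∑-cong (λ j → ∑-* (y j) _) ⟨
    ∑ (λ j → ∑ (λ i → M j i * x i) * y j)  ∎

  -- Moving M† to the other side turns ⟨x, M†M x⟩ into the sum of squares ⟨M x, M x⟩.
  †⊛⊛≈0 : (M : Matrix p q) (x : Fin q → Carrier) → (∀ i → (M † ⊛ M ⊛ x) i ≈ 0#) → ∀ i → (M ⊛ x) i ≈ 0#
  †⊛⊛≈0 M x eq = real (M ⊛ x) (trans (sym (adjoint M x (M ⊛ x)))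
    (∑-zero _ λ i → trans (*-congˡ (eq i)) (zeroʳ (x i))))

  -- The Gram matrix M†M is anisotropic, and its determinant has `det M` as a factor.
  injective⇒det≉0 : (M : Matrix m m) → (∀ x → (∀ i → (M ⊛ x) i ≈ 0#) → ∀ i → x i ≈ 0#) → ¬ (det M ≈ 0#)
  injective⇒det≉0 M inj det≈0 = anisotropic⇒det≉0 (M † · M)
    (λ x form≈0 → inj x (real (M ⊛ x) (trans (sym (adjoint M x (M ⊛ x)))
      (trans (∑-cong λ i → *-congˡ (sym (⊛-· (M †) M x i))) form≈0))))
    (trans (det-· (M †) M) (trans (*-congˡ det≈0) (zeroʳ _)))

  -- If e†e x + Q x = 0 then e e†(e x) = 0, so that e x = 0 by positivity, hence Q x = 0.
  det[e†e⊞Q]≉0 : (e : Matrix p m) (h : Matrix m p) (Q : Matrix m m) →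
    e · Q ≋ 𝟘 → (h · e) ⊞ Q ≋ 𝟙 → ¬ (det ((e † · e) ⊞ Q) ≈ 0#)
  det[e†e⊞Q]≉0 e h Q eQ he = injective⇒det≉0 _ λ x Bx≈0 →
    let
      split : ∀ i → (e † ⊛ e ⊛ x) i + (Q ⊛ x) i ≈ 0#
      split i = trans (+-congʳ (sym (⊛-· (e †) e x i))) (trans (sym (⊛-⊞ (e † · e) Q x i)) (Bx≈0 i))
      ee†ex≈0 : ∀ i → (e ⊛ e † ⊛ e ⊛ x) i ≈ 0#
      ee†ex≈0 i = begin
        (e ⊛ e † ⊛ e ⊛ x) i  ≈⟨ +-identityʳ _ ⟨
        (e ⊛ e † ⊛ e ⊛ x) i + 0#  ≈⟨ +-congˡ (trans (sym (⊛-· e Q x i)) (⊛-zeroˡ eQ x i)) ⟨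
        (e ⊛ e † ⊛ e ⊛ x) i + (e ⊛ Q ⊛ x) i  ≈⟨ ·-distribˡ e (column (e † ⊛ e ⊛ x)) (column (Q ⊛ x)) i zero ⟨
        (e ⊛ λ j → (e † ⊛ e ⊛ x) j + (Q ⊛ x) j) i ≈⟨ ⊛-zeroʳ e split i ⟩
        0#  ∎
      ex≈0 : ∀ i → (e ⊛ x) i ≈ 0#
      ex≈0 = †⊛⊛≈0 e x (†⊛⊛≈0 (e †) (e ⊛ x) ee†ex≈0)
      Qx≈0 : ∀ i → (Q ⊛ x) i ≈ 0#
      Qx≈0 i = trans (sym (+-identityˡ _)) (trans (+-congʳ (sym (⊛-zeroʳ (e †) ex≈0 i))) (split i))
    in λ i → begin
      x i  ≈⟨ ∑-𝟙ˡ i x ⟨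
      (𝟙 ⊛ x) i  ≈⟨ ∑-cong (λ j → *-congʳ (he i j)) ⟨
      (((h · e) ⊞ Q) ⊛ x) i  ≈⟨ ⊛-⊞ (h · e) Q x i ⟩
      ((h · e) ⊛ x) i + (Q ⊛ x) i  ≈⟨ +-cong (trans (⊛-· h e x i) (⊛-zeroʳ h ex≈0 i)) (Qx≈0 i) ⟩
      0# + 0#  ≈⟨ +-identityʳ _ ⟩
      0#  ∎

  ∑-𝟙-diag : ∑ {m} (λ i → 𝟙 i i) ≈ m ⋆ 1#
  ∑-𝟙-diag {zero}  = reflexive (∑-[] _)
  ∑-𝟙-diag {suc m} = trans (reflexive (∑-∷ _)) (+-congˡ (∑-𝟙-diag {m}))

  -- tr (V W) = tr (W V).
  inverse⇒square : (V : Matrix p q) (W : Matrix q p) → V · W ≋ 𝟙 → W · V ≋ 𝟙 → p ≡ q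
  inverse⇒square {p} {q} V W VW WV = ⋆-injective (begin
    p ⋆ 1#  ≈⟨ ∑-𝟙-diag {p} ⟨
    ∑ {p} (λ i → 𝟙 i i)  ≈⟨ ∑-cong (λ i → VW i i) ⟨
    ∑ (λ i → ∑ (λ j → V i j * W j i))  ≈⟨ ∑-comm _ ⟩
    ∑ (λ j → ∑ (λ i → V i j * W j i))  ≈⟨ ∑-cong (λ j → ∑-cong λ i → *-comm (V i j) (W j i)) ⟩
    ∑ (λ j → ∑ (λ i → W j i * V i j))  ≈⟨ ∑-cong (λ j → WV j j) ⟩
    ∑ {q} (λ j → 𝟙 j j)  ≈⟨ ∑-𝟙-diag {q} ⟩
    q ⋆ 1#  ∎)

  det-inverse : (V : Matrix p q) (W : Matrix q p) → V · W ≋ 𝟙 → W · V ≋ 𝟙 →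
                (D : Matrix q p) → det (D † · W) ≈ det (D · V)
  -- D, V and W have rectangular types, so their determinants can only be formed after `p` and `q`
  -- are identified.
  det-inverse V W VW WV D with ≡.refl ← inverse⇒square V W VW WV = begin
    det (D † · W)  ≈⟨ det-· (D †) W ⟩
    det (D †) * det W  ≈⟨ *-cong (det-† D) (unit (trans (sym (det-· W V)) (trans (det-cong WV) det-𝟙))) ⟩
    det D * det V  ≈⟨ det-· D V ⟨
    det (D · V)  ∎

  module _ (C : ContractedComplex R) where
    open ContractedComplex C
    open EvenOdd R C using (evens; odds; D; evens≈; odds≈; V·W≋𝟙; W·V≋𝟙; V; W)

    e·Q : ∀ k → e k · Q k ≋ 𝟘
    e·Q zero    = ·-zeroʳ (e 0)
    e·Q (suc k) i j = trans (sym (·-assoc (e (suc k)) (e k) (h k) i j))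
      (trans (·-cong {N = h k} (ee k) (λ _ _ → refl) i j) (·-zeroˡ (h k) i j))

    e†e·Q : ∀ k → (e k † · e k) · Q k ≋ 𝟘
    e†e·Q k i j = trans (·-assoc (e k †) (e k) (Q k) i j)
      (trans (·-cong {M = e k †} (λ _ _ → refl) (e·Q k) i j) (·-zeroʳ (e k †) i j))

    Q·Q : ∀ k → Q k · Q k ≋ Q k
    Q·Q k i j = begin
      (Q k · Q k) i j  ≈⟨ +-identityˡ _ ⟨
      0# + (Q k · Q k) i j  ≈⟨ +-congʳ (trans (·-assoc (h k) (e k) (Q k) i j)
                                                      (trans (·-cong {M = h k} (λ _ _ → refl) (e·Q k) i j) (·-zeroʳ (h k) i j))) ⟨
      ((h k · e k) · Q k) i j + (Q k · Q k) i j  ≈⟨ ·-distribʳ (h k · e k) (Q k) (Q k) i j ⟨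
      (((h k · e k) ⊞ Q k) · Q k) i j  ≈⟨ ·-cong {N = Q k} (he k) (λ _ _ → refl) i j ⟩
      (𝟙 · Q k) i j  ≈⟨ ·-identityˡ (Q k) i j ⟩
      Q k i j  ∎

    det-B≉0 : ∀ k → ¬ (det (B k) ≈ 0#)
    det-B≉0 k = det[e†e⊞Q]≉0 (e k) (h k) (Q k) (e·Q k) (he k)

    evens≈odds : ∀ m → rank m ≡ 0 → evens m 0 ≈ odds m 0
    evens≈odds m r≡0 = begin
      evens m 0  ≈⟨ evens≈ m r≡0 ⟩
      det (D m 0 † · W m 0)  ≈⟨ det-inverse (V m 0) (W m 0) (V·W≋𝟙 m r≡0) (W·V≋𝟙 m r≡0) (D m 0) ⟩
      det (D m 0 · V m 0)  ≈⟨ odds≈ m r≡0 ⟨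
      odds m 0  ∎

-- The integers satisfy these properties.

module IntegerRing where
  open import Data.Integer.Base using (ℤ; +_; -[1+_]; _+_; _*_; -_; ∣_∣; 0ℤ; 1ℤ)
  import Data.Integer.Properties as ℤₚ
  import Data.Nat.Properties as ℕₚ
  open Matrices ℤₚ.+-*-commutativeRing
  open RawSemiring (Semiring.rawSemiring (CommutativeRing.semiring ℤₚ.+-*-commutativeRing))
    using () renaming (_×_ to _⋆_)

  private
    square≡+ : ∀ i → ∃ λ k → i * i ≡ + k × (k ≡ 0 → i ≡ 0ℤ)
    square≡+ (+ zero)   = 0 , ≡.refl , λ _ → ≡.refl
    square≡+ (+ suc n)  = _ , ≡.refl , λ ()
    square≡+ (-[1+ n ]) = _ , ≡.refl , λ ()

    -- The sum is exhibited as a natural number, for which a vanishing sum has vanishing summands.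
    ∑-square≡+ : ∀ {m} (x : Fin m → ℤ) → ∃ λ k → ∑ (λ i → x i * x i) ≡ + k × (k ≡ 0 → ∀ i → x i ≡ 0ℤ)
    ∑-square≡+ {zero}  x = 0 , ∑-[] _ , λ _ ()
    ∑-square≡+ {suc m} x with square≡+ (x zero) | ∑-square≡+ (x ∘ suc)
    ... | k , eq , k≡0⇒ | l , eq′ , l≡0⇒ = k ℕ.+ l , ≡.trans (∑-∷ _) (cong₂ _+_ eq eq′) , λ
      { k+l≡0 zero    → k≡0⇒ (ℕₚ.m+n≡0⇒m≡0 k k+l≡0)
      ; k+l≡0 (suc i) → l≡0⇒ (ℕₚ.m+n≡0⇒n≡0 k k+l≡0) i }

    ∑-square≡0 : ∀ {m} (x : Fin m → ℤ) → ∑ (λ i → x i * x i) ≡ 0ℤ → ∀ i → x i ≡ 0ℤ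
    ∑-square≡0 x eq with ∑-square≡+ x
    ... | k , eq′ , k≡0⇒ = k≡0⇒ (ℤₚ.+-injective (≡.trans (≡.sym eq′) eq))

    ±1 : ∀ i → ∣ i ∣ ≡ 1 → i ≡ 1ℤ ⊎ i ≡ - 1ℤ
    ±1 (+ suc zero)   eq = inj₁ ≡.refl
    ±1 (-[1+ zero ]) eq = inj₂ ≡.refl

    units : ∀ i j → i * j ≡ 1ℤ → i ≡ j
    units i j ij≡1 with ±1 i (ℕₚ.m*n≡1⇒m≡1 ∣ i ∣ ∣ j ∣ (≡.trans (≡.sym (ℤₚ.abs-* i j)) (cong ∣_∣ ij≡1)))
    ... | inj₁ ≡.refl = ≡.sym (≡.trans (≡.sym (ℤₚ.*-identityˡ j)) ij≡1)
    ... | inj₂ ≡.refl = ≡.trans (≡.sym (cong -_ ij≡1)) (≡.trans (cong -_ (ℤₚ.-1*i≡-i j)) (ℤₚ.neg-involutive j))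

    ⋆1 : ∀ m → m ⋆ 1ℤ ≡ + m
    ⋆1 zero    = ≡.refl
    ⋆1 (suc m) = cong (λ z → 1ℤ + z) (⋆1 m)

  ℤ-isIntegerLike : IsIntegerLike ℤₚ.+-*-commutativeRing
  ℤ-isIntegerLike = record
    { 1≉0         = λ ()
    ; integral    = λ {x} → ℤₚ.i*j≡0⇒i≡0∨j≡0 x
    ; real        = ∑-square≡0
    ; unit        = λ {x} {y} → units x y
    ; ⋆-injective = λ {m} {n} eq → ℤₚ.+-injective (≡.trans (≡.sym (⋆1 m)) (≡.trans eq (⋆1 n)))
    }

-- Transfer of integer matrices to a commutative ring.

module IntegerMatrixImages {c ℓ} (R : CommutativeRing c ℓ) where
  open CommutativeRing R hiding (zero)
  open IntegerMultiples R
  open Matrices R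
  open import Data.Fin.Base using (toℕ; punchIn)
  open import Data.Integer.Base as ℤ using (ℤ; +_)
  import Data.Integer.Properties as ℤₚ
  open import Relation.Binary.Reasoning.Setoid setoid
  open RawSemiring (Semiring.rawSemiring semiring) using (_^_)
  private
    module Z = Matrices ℤₚ.+-*-commutativeRing
    open RawSemiring (Semiring.rawSemiring (CommutativeRing.semiring ℤₚ.+-*-commutativeRing))
      using () renaming (_^_ to _^ᶻ_)
    variable
      m p q r : ℕ

  image : Z.Matrix p q → Matrix p q
  image M i j = fromℤ (M i j)

  fromℤ-1 : fromℤ (+ 1) ≈ 1#
  fromℤ-1 = +-identityʳ 1#

  fromℤ-∑ : (f : Fin m → ℤ) → fromℤ (Z.∑ f) ≈ ∑ λ i → fromℤ (f i)
  fromℤ-∑ {zero}  f = begin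
    fromℤ (Z.∑ f)  ≡⟨ cong fromℤ (Z.∑-[] f) ⟩
    0#  ≡⟨ ∑-[] _ ⟨
    _  ∎
  fromℤ-∑ {suc m} f = begin
    fromℤ (Z.∑ f)  ≡⟨ cong fromℤ (Z.∑-∷ f) ⟩
    fromℤ (f zero ℤ.+ Z.∑ (f ∘ suc))  ≈⟨ fromℤ-+ (f zero) (Z.∑ (f ∘ suc)) ⟩
    fromℤ (f zero) + fromℤ (Z.∑ (f ∘ suc))  ≈⟨ +-congˡ (fromℤ-∑ (f ∘ suc)) ⟩
    fromℤ (f zero) + ∑ (λ i → fromℤ (f (suc i)))  ≡⟨ ∑-∷ _ ⟨
    _  ∎

  fromℤ-1^ : ∀ k → fromℤ ((ℤ.- (+ 1)) ^ᶻ k) ≈ (- 1#) ^ k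
  fromℤ-1^ zero    = fromℤ-1
  fromℤ-1^ (suc k) = trans (fromℤ-* (ℤ.- (+ 1)) ((ℤ.- (+ 1)) ^ᶻ k)) (*-cong (-‿cong fromℤ-1) (fromℤ-1^ k))

  fromℤ-det : (M : Z.Matrix m m) → fromℤ (Z.det M) ≈ det (image M)
  fromℤ-det {zero}  M = begin
    fromℤ (Z.det M)  ≡⟨ cong fromℤ (Z.det-[] M) ⟩
    fromℤ (+ 1)  ≈⟨ fromℤ-1 ⟩
    1#  ≡⟨ det-[] (image M) ⟨
    det (image M)  ∎
  fromℤ-det {suc m} M = begin
    fromℤ (Z.det M)  ≡⟨ cong fromℤ (Z.det-∷ M) ⟩
    _  ≈⟨ fromℤ-∑ _ ⟩
    _  ≈⟨ ∑-cong (λ j → trans (fromℤ-* ((ℤ.- (+ 1)) ^ᶻ toℕ j) (M zero j ℤ.* Z.det λ i k → M (suc i) (punchIn j k))) (*-cong (fromℤ-1^ (toℕ j))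
                          (trans (fromℤ-* (M zero j) (Z.det λ i k → M (suc i) (punchIn j k))) (*-congˡ (fromℤ-det λ i k → M (suc i) (punchIn j k)))))) ⟩
    _  ≡⟨ det-∷ (image M) ⟨
    det (image M)  ∎

  image-· : (M : Z.Matrix p q) (N : Z.Matrix q r) → image (M Z.· N) ≋ image M · image N
  image-· M N i k = trans (fromℤ-∑ _) (∑-cong λ j → fromℤ-* (M i j) (N j k))

-- The super determinant of an integral exact complex.

module SuperDeterminant {c ℓ₁ ℓ₂} (K : HeytingField c ℓ₁ ℓ₂) (charZero : CharZero K) where
  open HeytingField K using (_#_; #⇒invertible; heytingCommutativeRing)
  open HeytingCommutativeRing heytingCommutativeRing using (commutativeRing)
  open CommutativeRing commutativeRing hiding (zero)
  open Matrices commutativeRing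
  open IntegerMultiples commutativeRing
  open IntegerMatrixImages commutativeRing
  open PseudoDeterminant K charZero
  open import Algebra.Apartness.Properties.HeytingCommutativeRing heytingCommutativeRing
    using (#-congʳ; x-0≈x; invertibleˡ⇒#)
  open import Data.Fin.Base using (toℕ)
  open import Data.Integer.Base as ℤ using (ℤ; +_; -[1+_])
  import Data.Integer.Properties as ℤₚ
  import Data.Nat.Properties as ℕₚ
  open import Data.List.Base using (length)
  open import Relation.Binary.Reasoning.Setoid setoid
  open RawSemiring (Semiring.rawSemiring semiring) using () renaming (product to ∏; _×_ to _⋆_)
  open Solver
  private
    module LA = LinearAlgebra K
    module Z = Matrices ℤₚ.+-*-commutativeRing

  -- Characteristic zero turns the mere inequality of integers into apartness in `K`, that is, into
  -- invertibility; for negative integers the inverse is negated.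
  fromℤ#0 : ∀ {i} → i ≢ + 0 → fromℤ i # 0#
  fromℤ#0 {+ zero}   i≢0 = contradiction ≡.refl i≢0
  fromℤ#0 {+ suc n}  _   = charZero n
  fromℤ#0 { -[1+ n ]} _  with #⇒invertible (charZero n)
  ... | x⁻¹ , x⁻¹x≈1 , _ = invertibleˡ⇒# (- x⁻¹ , (begin
    - x⁻¹ * (- (suc n ⋆ 1#) - 0#)  ≈⟨ *-congˡ (x-0≈x _) ⟩
    - x⁻¹ * - (suc n ⋆ 1#)  ≈⟨ solve 2 (λ a b → :- a :* :- b := a :* b) refl x⁻¹ (suc n ⋆ 1#) ⟩
    x⁻¹ * (suc n ⋆ 1#)  ≈⟨ *-congˡ (x-0≈x _) ⟨
    x⁻¹ * ((suc n ⋆ 1#) - 0#)  ≈⟨ x⁻¹x≈1 ⟩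
    1#  ∎))

  inverse-* : ∀ x (x#0 : x # 0#) → LA.inverse x x#0 * x ≈ 1#
  inverse-* x x#0 = trans (*-congˡ (sym (x-0≈x x))) (proj₁ (proj₂ (#⇒invertible x#0)))

  module _ (C : ContractedComplex ℤₚ.+-*-commutativeRing) where
    open ContractedComplex C
    open EvenOdd ℤₚ.+-*-commutativeRing C using (evens; odds)
    open IntegerLike ℤₚ.+-*-commutativeRing IntegerRing.ℤ-isIntegerLike

    -- `Det≈det-⊞` asks for a nonsingular matrix over `K`; this comes from positivity over ℤ, where
    -- `B k` lives.
    Det≈det-B : ∀ k {M : Matrix (rank k) (rank k)} (s : LA.Spectrum M) →
      M ≋ image ((e k Z.†) Z.· e k) → LA.Det M s ≈ fromℤ (Z.det (B k))
    Det≈det-B k {M} s M≋ = trans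
      (Det≈det-⊞ M (image (Q k)) s
        (λ i j → trans (·-cong {N = image (Q k)} M≋ (λ _ _ → refl) i j)
          (trans (sym (image-· ((e k Z.†) Z.· e k) (Q k) i j)) (reflexive (cong fromℤ (e†e·Q C k i j)))))
        (λ i j → trans (sym (image-· (Q k) (Q k) i j)) (reflexive (cong fromℤ (Q·Q C k i j))))
        (#-congʳ (sym M⊞Q≈) (fromℤ#0 (det-B≉0 C k))))
      M⊞Q≈
      where
      M⊞Q≈ : det (M ⊞ image (Q k)) ≈ fromℤ (Z.det (B k))
      M⊞Q≈ = trans
        (det-cong λ i j → trans (+-congʳ (M≋ i j)) (sym (fromℤ-+ (((e k Z.†) Z.· e k) i j) (Q k i j))))
        (sym (fromℤ-det (B k)))

    evens≢0 : ∀ m o → evens m o ≢ + 0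
    odds≢0  : ∀ m o → odds m o ≢ + 0
    evens≢0 zero    o ()
    evens≢0 (suc m) o eq with ℤₚ.i*j≡0⇒i≡0∨j≡0 (Z.det (B o)) eq
    ... | inj₁ det≡0  = det-B≉0 C o det≡0
    ... | inj₂ odds≡0 = odds≢0 m (suc o) odds≡0
    odds≢0 zero    o ()
    odds≢0 (suc m) o = evens≢0 m (suc o)

    shifted : ∀ {m} {x : Fin (suc m) → Carrier} o → (∀ k → x k ≈ fromℤ (Z.det (B (toℕ k ℕ.+ o)))) →
              ∀ k → x (suc k) ≈ fromℤ (Z.det (B (toℕ k ℕ.+ suc o)))
    shifted o x≈ k = trans (x≈ (suc k))
      (reflexive (cong (λ l → fromℤ (Z.det (B l))) (≡.sym (ℕₚ.+-suc (toℕ k) o))))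

    -- The alternating product is the quotient of evens by odds, stated without division. Splitting
    -- off the first factor shifts all exponents by one and so interchanges the two products, hence
    -- the companion `∏-alternate-suc`; there `alternate (suc (suc k))` reduces to `alternate k`.
    ∏-alternate : ∀ m o (x : Fin m → Carrier) (x#0 : ∀ k → x k # 0#) →
      (∀ k → x k ≈ fromℤ (Z.det (B (toℕ k ℕ.+ o)))) →
      (∏ λ k → LA.alternate (toℕ k) (x k) (x#0 k)) * fromℤ (odds m o) ≈ fromℤ (evens m o)
    ∏-alternate-suc : ∀ m o (x : Fin m → Carrier) (x#0 : ∀ k → x k # 0#) →
      (∀ k → x k ≈ fromℤ (Z.det (B (toℕ k ℕ.+ o)))) →
      (∏ λ k → LA.alternate (suc (toℕ k)) (x k) (x#0 k)) * fromℤ (evens m o) ≈ fromℤ (odds m o)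
    ∏-alternate zero    o x x#0 x≈ = *-identityˡ _
    ∏-alternate (suc m) o x x#0 x≈ = trans (*-assoc _ _ _) (trans
      (*-cong (x≈ zero) (∏-alternate-suc m (suc o) (x ∘ suc) (x#0 ∘ suc) (shifted {x = x} o x≈)))
      (sym (fromℤ-* (Z.det (B o)) (odds m (suc o)))))
    ∏-alternate-suc zero    o x x#0 x≈ = *-identityˡ _
    ∏-alternate-suc (suc m) o x x#0 x≈ = begin
      LA.inverse (x zero) (x#0 zero) * P * fromℤ (Z.det (B o) ℤ.* odds m (suc o))
        ≈⟨ *-congˡ (fromℤ-* (Z.det (B o)) (odds m (suc o))) ⟩
      LA.inverse (x zero) (x#0 zero) * P * (fromℤ (Z.det (B o)) * fromℤ (odds m (suc o)))
        ≈⟨ *-congˡ (*-congʳ (x≈ zero)) ⟨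
      LA.inverse (x zero) (x#0 zero) * P * (x zero * fromℤ (odds m (suc o)))
        ≈⟨ solve 4 (λ i p x y → i :* p :* (x :* y) := i :* x :* (p :* y)) refl _ P _ _ ⟩
      LA.inverse (x zero) (x#0 zero) * x zero * (P * fromℤ (odds m (suc o)))
        ≈⟨ *-cong (inverse-* (x zero) (x#0 zero))
             (∏-alternate m (suc o) (x ∘ suc) (x#0 ∘ suc) (shifted {x = x} o x≈)) ⟩
      1# * fromℤ (evens m (suc o))
        ≈⟨ *-identityˡ _ ⟩
      fromℤ (evens m (suc o)) ∎
      where
      P : Carrier
      P = ∏ λ k → LA.alternate (toℕ k) (x (suc k)) (x#0 (suc k))

    ∏-alternate≈1 : ∀ m → rank m ≡ 0 → (x : Fin m → Carrier) (x#0 : ∀ k → x k # 0#) →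
      (∀ k → x k ≈ fromℤ (Z.det (B (toℕ k)))) →
      (∏ λ k → LA.alternate (toℕ k) (x k) (x#0 k)) ≈ 1#
    ∏-alternate≈1 m r≡0 x x#0 x≈ = #0-cancelˡ (fromℤ#0 (odds≢0 m 0)) (begin
      fromℤ (odds m 0) * P  ≈⟨ *-comm _ _ ⟩
      P * fromℤ (odds m 0)  ≈⟨ ∏-alternate m 0 x x#0 (λ k → trans (x≈ k)
                                 (reflexive (cong (λ l → fromℤ (Z.det (B l))) (≡.sym (ℕₚ.+-identityʳ (toℕ k)))))) ⟩
      fromℤ (evens m 0)  ≡⟨ cong fromℤ (evens≈odds C m r≡0) ⟩
      fromℤ (odds m 0)  ≈⟨ *-identityʳ _ ⟨
      fromℤ (odds m 0) * 1# ∎)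
      where
      P : Carrier
      P = ∏ λ k → LA.alternate (toℕ k) (x k) (x#0 k)

  module _ {n} (T : LA.GradedMatrix n) where
    open LA.GradedMatrix T renaming (e to eᵀ)

    private
      rank : ℕ → ℕ
      rank k = length (ofDegree k)

    -- `e` is an integral lift of the blocks `eᵀ`. Exactness concerns its action on row vectors,
    -- which is the boundary map, and `rank n ≡ 0` closes the complex from above.
    SDet≈1 :
      (e : ∀ k → Z.Matrix (rank (suc k)) (rank k)) →
      (∀ k i j → eᵀ k i j ≈ fromℤ (e k i j)) →
      (∀ k → e (suc k) Z.· e k Z.≋ Z.𝟘) →
      (∀ (x : Fin (rank 0) → ℤ) → ∃ λ (y : Fin (rank 1) → ℤ) → ∀ j → Z.∑ (λ i → y i ℤ.* e 0 i j) ≡ x j) →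
      (∀ k (x : Fin (rank (suc k)) → ℤ) → (∀ j → Z.∑ (λ i → x i ℤ.* e k i j) ≡ + 0) →
        ∃ λ (y : Fin (rank (suc (suc k))) → ℤ) → ∀ j → Z.∑ (λ i → y i ℤ.* e (suc k) i j) ≡ x j) →
      rank n ≡ 0 →
      (s : LA.Spectra T) → LA.SDet T s ≈ 1#
    SDet≈1 e eᵀ≈ ee exact₀ exact r≡0 s = ∏-alternate≈1 C n r≡0 _ (λ k → LA.Det#0 _ (s k)) λ k →
      Det≈det-B C (toℕ k) (s k) λ i j → begin
        e†e (toℕ k) i j  ≡⟨ ∑≡sum _ ⟨
        _  ≈⟨ ∑-cong (λ l → *-cong (eᵀ≈ (toℕ k) l i) (eᵀ≈ (toℕ k) l j)) ⟩
        _  ≈⟨ image-· (e (toℕ k) Z.†) (e (toℕ k)) i j ⟨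
        _  ∎
      where
      C : ContractedComplex ℤₚ.+-*-commutativeRing
      C = Contraction.contract ℤₚ.+-*-commutativeRing rank e ee exact₀ exact

-- Inserting and deleting elements of subsets.

module Subsets where
  open import Data.Fin.Subset
  open import Data.Fin.Subset.Properties
  open import Data.Vec.Base using (_∷_; here; there; _[_]≔_)

  private
    variable
      n : ℕ
      u v : Fin n
      x y : Subset n

  -- Updating one coordinate recurses in step with the operations on chains; `-≡delete` translates
  -- the removal used for facets and for induced subgraphs.
  delete insert : Fin n → Subset n → Subset n
  delete v x = x [ v ]≔ outside
  insert v x = x [ v ]≔ inside

  -≡delete : ∀ (x : Subset n) v → x - v ≡ delete v x
  -≡delete (s ∷ x) zero    = cong (outside ∷_) (p─⊥≡p x)
  -≡delete (s ∷ x) (suc v) = cong (s ∷_) (-≡delete x v)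

  v∉delete : ∀ (v : Fin n) x → v ∉ delete v x
  v∉delete zero    (s ∷ x) ()
  v∉delete (suc v) (s ∷ x) (there v∈) = v∉delete v x v∈

  ∈-delete⁻ : u ∈ delete v x → u ∈ x
  ∈-delete⁻ {u = zero}  {zero}  {s ∷ x} ()
  ∈-delete⁻ {u = suc u} {zero}  {s ∷ x} (there u∈) = there u∈
  ∈-delete⁻ {u = zero}  {suc v} {s ∷ x} here       = here
  ∈-delete⁻ {u = suc u} {suc v} {s ∷ x} (there u∈) = there (∈-delete⁻ u∈)

  ∈-delete⁺ : u ≢ v → u ∈ x → u ∈ delete v x
  ∈-delete⁺ {u = u} {v} {x} u≢v u∈x = subst (u ∈_) (-≡delete x v) (x∈p∧x≢y⇒x∈p-y u∈x u≢v)

  v∈insert : ∀ (v : Fin n) x → v ∈ insert v x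
  v∈insert zero    (s ∷ x) = here
  v∈insert (suc v) (s ∷ x) = there (v∈insert v x)

  ∈-insert⁻ : u ∈ insert v x → u ≡ v ⊎ u ∈ x
  ∈-insert⁻ {u = zero}  {zero}  {s ∷ x} here       = inj₁ ≡.refl
  ∈-insert⁻ {u = suc u} {zero}  {s ∷ x} (there u∈) = inj₂ (there u∈)
  ∈-insert⁻ {u = zero}  {suc v} {s ∷ x} here       = inj₂ here
  ∈-insert⁻ {u = suc u} {suc v} {s ∷ x} (there u∈) with ∈-insert⁻ {u = u} {v} {x} u∈
  ... | inj₁ u≡v = inj₁ (cong suc u≡v)
  ... | inj₂ u∈x = inj₂ (there u∈x)

  ∈-insert⁺ : u ∈ x → u ∈ insert v x
  ∈-insert⁺ {v = zero}  here       = here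
  ∈-insert⁺ {v = zero}  (there u∈) = there u∈
  ∈-insert⁺ {v = suc v} here       = here
  ∈-insert⁺ {v = suc v} (there u∈) = there (∈-insert⁺ u∈)

  insert-delete : v ∈ x → insert v (delete v x) ≡ x
  insert-delete here       = ≡.refl
  insert-delete (there v∈) = cong (_ ∷_) (insert-delete v∈)

  delete-insert : v ∉ x → delete v (insert v x) ≡ x
  delete-insert {v = zero}  {inside  ∷ x} v∉ = contradiction here v∉
  delete-insert {v = zero}  {outside ∷ x} v∉ = ≡.refl
  delete-insert {v = suc v} {s ∷ x}       v∉ = cong (s ∷_) (delete-insert (v∉ ∘ there))

  ∣insert∣ : v ∉ x → ∣ insert v x ∣ ≡ suc ∣ x ∣
  ∣insert∣ {v = zero}  {inside  ∷ x} v∉ = contradiction here v∉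
  ∣insert∣ {v = zero}  {outside ∷ x} v∉ = ≡.refl
  ∣insert∣ {v = suc v} {inside  ∷ x} v∉ = cong suc (∣insert∣ (v∉ ∘ there))
  ∣insert∣ {v = suc v} {outside ∷ x} v∉ = ∣insert∣ (v∉ ∘ there)

  ∣delete∣ : v ∈ x → ∣ x ∣ ≡ suc ∣ delete v x ∣
  ∣delete∣ {v = v} {x} v∈x = ≡.trans (cong ∣_∣ (≡.sym (insert-delete v∈x))) (∣insert∣ (v∉delete v x))

  -⇒delete : u ∈ x - v → u ∈ delete v x
  -⇒delete {u = u} {x} {v} = subst (u ∈_) (-≡delete x v)

  ∈-─⁻ : u ∈ x - v → u ∈ x × u ≢ v
  ∈-─⁻ {u = u} {x} {v} u∈ = ∈-delete⁻ (-⇒delete u∈) , λ { ≡.refl → v∉delete u x (-⇒delete u∈) }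

  nonempty : ∀ (x : Subset n) {k} → ∣ x ∣ ≡ suc k → Nonempty x
  nonempty {n} x eq with nonempty? x
  ... | yes ne = ne
  ... | no  ¬ne with () ← ≡.trans (≡.sym (≡.trans (cong ∣_∣ (Empty-unique ¬ne)) (∣⊥∣≡0 n))) eq

-- Chains, boundaries, cones and links in the exterior algebra.

module Chains {c ℓ} (R : CommutativeRing c ℓ) where
  open CommutativeRing R hiding (zero)
  open Matrices R using (∑; ∑-∷; ∑-[]; ∑-cong; 𝟙; ∑-𝟙ʳ)
  open Exterior R public
    using (Λ; _≐_; wedge; one; wedge-cong; wedge-congʳ; wedge-linear; wedge-neg; wedge-zero; wedge-zeroˡ)
  open import Algebra.Properties.Ring ring
  open IntegerMultiples R
  open Solver
  open Subsets
  open import Data.Integer.Base using (+_)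
  open import Data.Fin.Subset hiding (_-_)
  open import Data.Vec.Base using ([]; _∷_; here; there)
  open import Relation.Binary.Reasoning.Setoid setoid
  open RawSemiring (Semiring.rawSemiring semiring) using (_^_)

  private
    variable
      n : ℕ

  -- The interior product with the covector u.
  contract : (Fin n → Carrier) → Λ n → Λ n
  contract u ω []            = 0#
  contract u ω (outside ∷ y) = u zero * ω (inside ∷ y) + contract (u ∘ suc) (ω ∘ (outside ∷_)) y
  contract u ω (inside  ∷ y) = - contract (u ∘ suc) (ω ∘ (inside ∷_)) y

  contract-cong : ∀ (u : Fin n → Carrier) {ω η} → ω ≐ η → contract u ω ≐ contract u η
  contract-cong u ω≐η []            = refl
  contract-cong u ω≐η (outside ∷ y) =
    +-cong (*-congˡ (ω≐η (inside ∷ y))) (contract-cong (u ∘ suc) (ω≐η ∘ (outside ∷_)) y)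
  contract-cong u ω≐η (inside  ∷ y) = -‿cong (contract-cong (u ∘ suc) (ω≐η ∘ (inside ∷_)) y)

  contract-linear : ∀ (u : Fin n → Carrier) a ω η →
                    contract u (λ y → a * ω y + η y) ≐ λ y → a * contract u ω y + contract u η y
  contract-linear u a ω η []            = solve 1 (λ a → con (+ 0) := a :* con (+ 0) :+ con (+ 0)) refl a
  contract-linear u a ω η (outside ∷ y) = trans (+-congˡ (contract-linear (u ∘ suc) a _ _ y))
    (solve 6 (λ u a x z p q → u :* (a :* x :+ z) :+ (a :* p :+ q)
                           := a :* (u :* x :+ p) :+ (u :* z :+ q)) refl _ a _ _ _ _)
  contract-linear u a ω η (inside  ∷ y) = trans (-‿cong (contract-linear (u ∘ suc) a _ _ y))
    (solve 3 (λ a p q → :- (a :* p :+ q) := a :* :- p :+ :- q) refl a _ _)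

  contract-zero : ∀ (u : Fin n → Carrier) → contract u (λ _ → 0#) ≐ λ _ → 0#
  contract-zero u []            = refl
  contract-zero u (outside ∷ y) = trans (+-cong (zeroʳ _) (contract-zero (u ∘ suc) y)) (+-identityʳ _)
  contract-zero u (inside  ∷ y) = trans (-‿cong (contract-zero (u ∘ suc) y)) -0#≈0#

  contract-neg : ∀ (u : Fin n → Carrier) ω → contract u (λ y → - ω y) ≐ λ y → - contract u ω y
  contract-neg u ω []            = sym -0#≈0#
  contract-neg u ω (outside ∷ y) = trans (+-congˡ (contract-neg (u ∘ suc) _ y))
    (solve 3 (λ u x p → u :* :- x :+ :- p := :- (u :* x :+ p)) refl _ _ _)
  contract-neg u ω (inside  ∷ y) = -‿cong (contract-neg (u ∘ suc) _ y)

  contract-+ : ∀ (u : Fin n → Carrier) ω η →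
               contract u (λ y → ω y + η y) ≐ λ y → contract u ω y + contract u η y
  contract-+ u ω η y = trans (contract-cong u (λ y → +-congʳ (sym (*-identityˡ _))) y)
    (trans (contract-linear u 1# ω η y) (+-congʳ (*-identityˡ _)))

  contract-scale : ∀ (u : Fin n → Carrier) a ω → contract u (λ y → a * ω y) ≐ λ y → a * contract u ω y
  contract-scale u a ω y = trans (contract-cong u (λ y → sym (+-identityʳ _)) y)
    (trans (contract-linear u a ω (λ _ → 0#) y) (trans (+-congˡ (contract-zero u y)) (+-identityʳ _)))

  contract-minus : ∀ (u : Fin n → Carrier) ω η →
                   contract u (λ y → ω y - η y) ≐ λ y → contract u ω y - contract u η y
  contract-minus u ω η y = trans (contract-+ u ω (λ y → - η y) y) (+-congˡ (contract-neg u η y))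

  contract-∑ : ∀ {m} (u : Fin n → Carrier) (a : Fin m → Carrier) (ω : Fin m → Λ n) →
               contract u (λ y → ∑ λ i → a i * ω i y) ≐ λ y → ∑ λ i → a i * contract u (ω i) y
  contract-∑ {m = zero}  u a ω y = begin
    contract u (λ y → ∑ λ i → a i * ω i y) y  ≈⟨ contract-cong u (λ _ → reflexive (∑-[] _)) y ⟩
    contract u (λ _ → 0#) y  ≈⟨ contract-zero u y ⟩
    0#  ≡⟨ ∑-[] _ ⟨
    _  ∎
  contract-∑ {m = suc m} u a ω y = begin
    contract u (λ y → ∑ λ i → a i * ω i y) y
      ≈⟨ contract-cong u (λ _ → reflexive (∑-∷ _)) y ⟩
    contract u (λ y → a zero * ω zero y + ∑ (λ i → a (suc i) * ω (suc i) y)) y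
      ≈⟨ contract-linear u (a zero) _ _ y ⟩
    a zero * contract u (ω zero) y + contract u (λ y → ∑ λ i → a (suc i) * ω (suc i) y) y
      ≈⟨ +-congˡ (contract-∑ u (a ∘ suc) (ω ∘ suc) y) ⟩
    a zero * contract u (ω zero) y + ∑ (λ i → a (suc i) * contract u (ω (suc i)) y)
      ≡⟨ ∑-∷ _ ⟨
    _ ∎

  contract-anticomm : ∀ (u w : Fin n → Carrier) ω →
                      contract u (contract w ω) ≐ λ y → - contract w (contract u ω) y
  contract-anticomm u w ω []            = sym -0#≈0#
  contract-anticomm u w ω (outside ∷ y) = begin
    u zero * - contract w′ ω₁ y + contract u′ (λ y → w zero * ω₁ y + contract w′ ω₀ y) y
      ≈⟨ +-congˡ (trans (contract-linear u′ (w zero) ω₁ _ y) (+-congˡ (contract-anticomm u′ w′ ω₀ y))) ⟩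
    u zero * - contract w′ ω₁ y + (w zero * contract u′ ω₁ y - contract w′ (contract u′ ω₀) y)
      ≈⟨ solve 5 (λ u a w b c → u :* :- a :+ (w :* b :- c) := :- (w :* :- b :+ (u :* a :+ c))) refl _ _ _ _ _ ⟩
    - (w zero * - contract u′ ω₁ y + (u zero * contract w′ ω₁ y + contract w′ (contract u′ ω₀) y))
      ≈⟨ -‿cong (+-congˡ (contract-linear w′ (u zero) ω₁ _ y)) ⟨
    - (w zero * - contract u′ ω₁ y + contract w′ (λ y → u zero * ω₁ y + contract u′ ω₀ y) y) ∎
    where
    u′ = u ∘ suc
    w′ = w ∘ suc
    ω₀ = ω ∘ (outside ∷_)
    ω₁ = ω ∘ (inside ∷_)
  contract-anticomm u w ω (inside  ∷ y) = -‿cong (begin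
    contract u′ (λ y → - contract w′ ω₁ y) y  ≈⟨ contract-neg u′ _ y ⟩
    - contract u′ (contract w′ ω₁) y  ≈⟨ -‿cong (contract-anticomm u′ w′ ω₁ y) ⟩
    - - contract w′ (contract u′ ω₁) y  ≈⟨ -‿cong (contract-neg w′ _ y) ⟨
    - contract w′ (λ y → - contract u′ ω₁ y) y  ∎)
    where
    u′ = u ∘ suc
    w′ = w ∘ suc
    ω₁ = ω ∘ (inside ∷_)

  contract-square : ∀ (u : Fin n → Carrier) ω → contract u (contract u ω) ≐ λ _ → 0#
  contract-square u ω []            = refl
  contract-square u ω (outside ∷ y) = begin
    u zero * - contract u′ ω₁ y + contract u′ (λ y → u zero * ω₁ y + contract u′ ω₀ y) y
      ≈⟨ +-congˡ (trans (contract-linear u′ (u zero) ω₁ _ y) (+-congˡ (contract-square u′ ω₀ y))) ⟩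
    u zero * - contract u′ ω₁ y + (u zero * contract u′ ω₁ y + 0#)
      ≈⟨ solve 2 (λ u a → u :* :- a :+ (u :* a :+ con (+ 0)) := con (+ 0)) refl _ _ ⟩
    0# ∎
    where
    u′ = u ∘ suc
    ω₀ = ω ∘ (outside ∷_)
    ω₁ = ω ∘ (inside ∷_)
  contract-square u ω (inside  ∷ y) = begin
    - contract (u ∘ suc) (λ y → - contract (u ∘ suc) (ω ∘ (inside ∷_)) y) y
      ≈⟨ -‿cong (trans (contract-neg (u ∘ suc) _ y) (trans (-‿cong (contract-square (u ∘ suc) _ y)) -0#≈0#)) ⟩
    - 0#  ≈⟨ -0#≈0# ⟩
    0#  ∎

  -- The Clifford relation between interior and exterior multiplication. With `u` constantly one and
  -- `w` a vertex it is the homotopy formula for cones; with `u` and `w` the same vertex it splits a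
  -- chain into the part avoiding that vertex and the part through it.
  clifford : ∀ (u w : Fin n → Carrier) ω →
    (λ y → contract u (wedge w ω) y + wedge w (contract u ω) y) ≐ λ y → (∑ λ i → u i * w i) * ω y
  clifford u w ω [] = trans (+-identityʳ _) (sym (trans (*-congʳ (reflexive (∑-[] _))) (zeroˡ _)))
  clifford u w ω (outside ∷ y) = begin
    (u zero * (w zero * ω₀ y - wedge w′ ω₁ y) + contract u′ (wedge w′ ω₀) y)
      + wedge w′ (λ y → u zero * ω₁ y + contract u′ ω₀ y) y
      ≈⟨ +-congˡ (wedge-linear w′ (u zero) ω₁ _ y) ⟩
    (u zero * (w zero * ω₀ y - wedge w′ ω₁ y) + contract u′ (wedge w′ ω₀) y)
      + (u zero * wedge w′ ω₁ y + wedge w′ (contract u′ ω₀) y)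
      ≈⟨ solve 6 (λ u w x a b c → (u :* (w :* x :- a) :+ b) :+ (u :* a :+ c) := u :* w :* x :+ (b :+ c)) refl _ _ _ _ _ _ ⟩
    u zero * w zero * ω₀ y + (contract u′ (wedge w′ ω₀) y + wedge w′ (contract u′ ω₀) y)
      ≈⟨ +-congˡ (clifford u′ w′ ω₀ y) ⟩
    u zero * w zero * ω₀ y + (∑ λ i → u′ i * w′ i) * ω₀ y
      ≈⟨ trans (*-congʳ (reflexive (∑-∷ _))) (distribʳ _ _ _) ⟨
    (∑ λ i → u i * w i) * ω₀ y ∎
    where
    u′ = u ∘ suc
    w′ = w ∘ suc
    ω₀ = ω ∘ (outside ∷_)
    ω₁ = ω ∘ (inside ∷_)
  clifford u w ω (inside  ∷ y) = begin
    - contract u′ (λ y → w zero * ω₀ y - wedge w′ ω₁ y) y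
      + (w zero * (u zero * ω₁ y + contract u′ ω₀ y) - wedge w′ (λ y → - contract u′ ω₁ y) y)
      ≈⟨ +-cong (-‿cong (trans (contract-linear u′ (w zero) ω₀ _ y) (+-congˡ (contract-neg u′ _ y))))
                (+-congˡ (-‿cong (wedge-neg w′ _ y))) ⟩
    - (w zero * contract u′ ω₀ y - contract u′ (wedge w′ ω₁) y)
      + (w zero * (u zero * ω₁ y + contract u′ ω₀ y) - - wedge w′ (contract u′ ω₁) y)
      ≈⟨ solve 6 (λ u w x a b c → :- (w :* a :- b) :+ (w :* (u :* x :+ a) :- :- c) := u :* w :* x :+ (b :+ c)) refl _ _ _ _ _ _ ⟩
    u zero * w zero * ω₁ y + (contract u′ (wedge w′ ω₁) y + wedge w′ (contract u′ ω₁) y)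
      ≈⟨ +-congˡ (clifford u′ w′ ω₁ y) ⟩
    u zero * w zero * ω₁ y + (∑ λ i → u′ i * w′ i) * ω₁ y
      ≈⟨ trans (*-congʳ (reflexive (∑-∷ _))) (distribʳ _ _ _) ⟨
    (∑ λ i → u i * w i) * ω₁ y ∎
    where
    u′ = u ∘ suc
    w′ = w ∘ suc
    ω₀ = ω ∘ (outside ∷_)
    ω₁ = ω ∘ (inside ∷_)

  -- The value at `y` is a combination of the values of `ω` at the sets with one more element.
  contract-support : ∀ (u : Fin n → Carrier) {ω} y → (∀ v → v ∉ y → ω (insert v y) ≈ 0#) → contract u ω y ≈ 0#
  contract-support u []            ω≈0 = refl
  contract-support u (outside ∷ y) ω≈0 = trans
    (+-cong (trans (*-congˡ (ω≈0 zero λ ())) (zeroʳ _))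
            (contract-support (u ∘ suc) y λ v v∉ → ω≈0 (suc v) λ { (there v∈) → v∉ v∈ })) (+-identityʳ _)
  contract-support u (inside  ∷ y) ω≈0 = trans
    (-‿cong (contract-support (u ∘ suc) y λ v v∉ → ω≈0 (suc v) λ { (there v∈) → v∉ v∈ })) -0#≈0#

  contract-local : ∀ (u : Fin n → Carrier) {ω} y → (∀ x → ∣ x ∣ ≡ suc ∣ y ∣ → ω x ≈ 0#) → contract u ω y ≈ 0#
  contract-local u y ω≈0 = contract-support u y λ v v∉y → ω≈0 (insert v y) (∣insert∣ v∉y)

  contract-zeroˡ : ∀ (ω : Λ n) → contract (λ _ → 0#) ω ≐ λ _ → 0#
  contract-zeroˡ ω []            = refl
  contract-zeroˡ ω (outside ∷ y) = trans (+-cong (zeroˡ _) (contract-zeroˡ _ y)) (+-identityʳ _)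
  contract-zeroˡ ω (inside  ∷ y) = trans (-‿cong (contract-zeroˡ _ y)) -0#≈0#

  -- Chains on subsets of the vertices, including the empty one, are functions Λ n.
  ∂ : Λ n → Λ n
  ∂ = contract λ _ → 1#

  cone link : Fin n → Λ n → Λ n
  cone v = wedge    (𝟙 v)
  link v = contract (𝟙 v)

  ∂∂≐0 : ∀ (ω : Λ n) → ∂ (∂ ω) ≐ λ _ → 0#
  ∂∂≐0 = contract-square λ _ → 1#

  ∂-link : ∀ v (ω : Λ n) → link v (∂ ω) ≐ λ y → - ∂ (link v ω) y
  ∂-link v = contract-anticomm (𝟙 v) _

  private
    [1]≈1 : ∀ (v : Fin n) → ∑ (λ i → 1# * 𝟙 v i) ≈ 1#
    [1]≈1 v = trans (∑-cong λ i → *-congˡ (reflexive (Matrices.𝟙-sym R v i))) (∑-𝟙ʳ v (λ _ → 1#))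

    𝟙·𝟙≈1 : ∀ (v : Fin n) → ∑ (λ i → 𝟙 v i * 𝟙 v i) ≈ 1#
    𝟙·𝟙≈1 v = trans (∑-cong λ i → *-congˡ (reflexive (Matrices.𝟙-sym R v i)))
      (trans (∑-𝟙ʳ v (𝟙 v)) (reflexive (Matrices.𝟙-diag R v)))

  ∂-cone : ∀ v (ω : Λ n) y → ∂ (cone v ω) y ≈ ω y - cone v (∂ ω) y
  ∂-cone v ω y = begin
    ∂ (cone v ω) y  ≈⟨ solve 2 (λ a b → a := a :+ b :- b) refl _ _ ⟩
    ∂ (cone v ω) y + cone v (∂ ω) y - cone v (∂ ω) y  ≈⟨ +-congʳ (clifford _ (𝟙 v) ω y) ⟩
    ∑ (λ i → 1# * 𝟙 v i) * ω y - cone v (∂ ω) y  ≈⟨ +-congʳ (trans (*-congʳ ([1]≈1 v)) (*-identityˡ _)) ⟩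
    ω y - cone v (∂ ω) y  ∎

  link-cone : ∀ v (ω : Λ n) y → link v (cone v ω) y + cone v (link v ω) y ≈ ω y
  link-cone v ω y = trans (clifford (𝟙 v) (𝟙 v) ω y) (trans (*-congʳ (𝟙·𝟙≈1 v)) (*-identityˡ _))

  -- Equality up to a sign, a sign being any square root of one. The sign itself never has to be
  -- known: vanishing and squares are insensitive to it.
  record _≈±_ (a b : Carrier) : Set (c ⊔ ℓ) where
    constructor signed
    field
      sign    : Carrier
      sign²≈1 : sign * sign ≈ 1#
      eq      : a ≈ sign * b

  open _≈±_ public

  ≈±-square : ∀ {a b} → a ≈± b → a * a ≈ b * b
  ≈±-square {a} {b} (signed s s²≈1 eq) = begin
    a * a  ≈⟨ *-cong eq eq ⟩
    (s * b) * (s * b)  ≈⟨ solve 2 (λ s b → (s :* b) :* (s :* b) := s :* s :* (b :* b)) refl s b ⟩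
    s * s * (b * b)  ≈⟨ trans (*-congʳ s²≈1) (*-identityˡ _) ⟩
    b * b  ∎

  ≈±-zero : ∀ {a b} → a ≈± b → b ≈ 0# → a ≈ 0#
  ≈±-zero (signed s _ eq) b≈0 = trans eq (trans (*-congˡ b≈0) (zeroʳ s))

  ≈±-neg : ∀ {a b} → a ≈± b → (- a) ≈± b
  ≈±-neg (signed s s²≈1 eq) = signed (- s)
    (trans (solve 1 (λ s → :- s :* :- s := s :* s) refl s) s²≈1)
    (trans (-‿cong eq) (-‿distribˡ-* s _))

  ≈±-cong : ∀ {a a′ b} → a ≈ a′ → a ≈± b → a′ ≈± b
  ≈±-cong a≈a′ (signed s s²≈1 eq) = signed s s²≈1 (trans (sym a≈a′) eq)

  ≈±-refl : ∀ {a b} → a ≈ b → a ≈± b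
  ≈±-refl a≈b = signed 1# (*-identityˡ _) (trans a≈b (sym (*-identityˡ _)))

  cone-∈ : ∀ v (ω : Λ n) x → v ∈ x → cone v ω x ≈± ω (delete v x)
  cone-∈ zero ω (inside ∷ x) here = ≈±-refl (trans
    (+-cong (*-identityˡ _) (trans (-‿cong (wedge-zeroˡ _ x)) -0#≈0#)) (+-identityʳ _))
  cone-∈ (suc v) ω (outside ∷ x) (there v∈x) = cone-∈ v _ x v∈x
  cone-∈ (suc v) ω (inside  ∷ x) (there v∈x) = ≈±-cong
    (sym (trans (+-congʳ (zeroˡ _)) (+-identityˡ _))) (≈±-neg (cone-∈ v _ x v∈x))

  cone-∉ : ∀ v (ω : Λ n) x → v ∉ x → cone v ω x ≈ 0#
  cone-∉ zero    ω (inside  ∷ x) v∉x = contradiction here v∉x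
  cone-∉ zero    ω (outside ∷ x) v∉x = wedge-zeroˡ _ x
  cone-∉ (suc v) ω (outside ∷ x) v∉x = cone-∉ v _ x (v∉x ∘ there)
  cone-∉ (suc v) ω (inside  ∷ x) v∉x = trans
    (+-cong (zeroˡ _) (trans (-‿cong (cone-∉ v _ x (v∉x ∘ there))) -0#≈0#)) (+-identityʳ _)

  link-∉ : ∀ v (ω : Λ n) x → v ∉ x → link v ω x ≈± ω (insert v x)
  link-∉ zero    ω (inside  ∷ x) v∉x = contradiction here v∉x
  link-∉ zero    ω (outside ∷ x) v∉x = ≈±-refl (trans
    (+-cong (*-identityˡ _) (contract-zeroˡ _ x)) (+-identityʳ _))
  link-∉ (suc v) ω (outside ∷ x) v∉x = ≈±-cong
    (sym (trans (+-congʳ (zeroˡ _)) (+-identityˡ _))) (link-∉ v _ x (v∉x ∘ there))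
  link-∉ (suc v) ω (inside  ∷ x) v∉x = ≈±-neg (link-∉ v _ x (v∉x ∘ there))

  link-∈ : ∀ v (ω : Λ n) x → v ∈ x → link v ω x ≈ 0#
  link-∈ zero    ω (inside  ∷ x) here        = trans (-‿cong (contract-zeroˡ _ x)) -0#≈0#
  link-∈ (suc v) ω (outside ∷ x) (there v∈x) = trans (+-cong (zeroˡ _) (link-∈ v _ x v∈x)) (+-identityʳ _)
  link-∈ (suc v) ω (inside  ∷ x) (there v∈x) = trans (-‿cong (link-∈ v _ x v∈x)) -0#≈0#

  one-nonempty : ∀ (x : Subset n) → Nonempty x → one x ≈ 0#
  one-nonempty (inside  ∷ x) _                   = refl
  one-nonempty (outside ∷ x) (suc v , there v∈x) = one-nonempty x (v , v∈x)

  one-⊥ : one {n} ⊥ ≈ 1#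
  one-⊥ {zero}  = refl
  one-⊥ {suc n} = one-⊥ {n}

  ∂-one : ∂ (one {n}) ≐ λ _ → 0#
  ∂-one []            = refl
  ∂-one (outside ∷ y) = trans (+-cong (zeroʳ _) (∂-one y)) (+-identityʳ _)
  ∂-one (inside  ∷ y) = trans (-‿cong (contract-zero _ y)) -0#≈0#

  χ : Subset n → Λ n
  χ []            []            = 1#
  χ (inside  ∷ x) (inside  ∷ y) = χ x y
  χ (outside ∷ x) (outside ∷ y) = χ x y
  χ (inside  ∷ x) (outside ∷ y) = 0#
  χ (outside ∷ x) (inside  ∷ y) = 0#

  χ-same : ∀ (x : Subset n) → χ x x ≈ 1#
  χ-same []            = refl
  χ-same (inside  ∷ x) = χ-same x
  χ-same (outside ∷ x) = χ-same x

  χ-diff : ∀ (x y : Subset n) → x ≢ y → χ x y ≈ 0#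
  χ-diff []            []            x≢y = contradiction ≡.refl x≢y
  χ-diff (inside  ∷ x) (inside  ∷ y) x≢y = χ-diff x y (x≢y ∘ cong (inside ∷_))
  χ-diff (outside ∷ x) (outside ∷ y) x≢y = χ-diff x y (x≢y ∘ cong (outside ∷_))
  χ-diff (inside  ∷ x) (outside ∷ y) x≢y = refl
  χ-diff (outside ∷ x) (inside  ∷ y) x≢y = refl

  position-zero : ∀ (x : Subset (suc n)) → position zero x ≡ 0
  position-zero (s ∷ x) = ∣∩∅∣ (s ∷ x)
    where
    open import Data.Vec.Base using (tabulate)
    ∣∩∅∣ : ∀ {m} (x : Subset m) → ∣ x ∩ tabulate (λ _ → outside) ∣ ≡ 0
    ∣∩∅∣ []            = ≡.refl
    ∣∩∅∣ (inside  ∷ x) = ∣∩∅∣ x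
    ∣∩∅∣ (outside ∷ x) = ∣∩∅∣ x

  -- Every element of `x` before `v` contributes one minus sign to the interior product, and
  -- `position v x` counts these elements: `∂` carries the signs of the exterior derivative.
  ∂χ-facet : ∀ v (x : Subset n) → v ∈ x → ∂ (χ x) (delete v x) ≈ (- 1#) ^ position v x
  ∂χ-facet zero (inside ∷ x) here = begin
    1# * χ x x + ∂ (λ _ → 0#) x  ≈⟨ +-cong (trans (*-identityˡ _) (χ-same x)) (contract-zero _ x) ⟩
    1# + 0#  ≈⟨ +-identityʳ _ ⟩
    1#  ≡⟨ cong ((- 1#) ^_) (position-zero (inside ∷ x)) ⟨
    (- 1#) ^ position zero (inside ∷ x) ∎
  ∂χ-facet (suc v) (outside ∷ x) (there v∈x) = trans
    (trans (+-congʳ (zeroʳ _)) (+-identityˡ _)) (∂χ-facet v x v∈x)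
  ∂χ-facet (suc v) (inside  ∷ x) (there v∈x) = trans (-‿cong (∂χ-facet v x v∈x)) (sym (-1*x≈-x _))

  ∂χ-nonfacet : ∀ (x y : Subset n) → (∀ v → v ∈ x → y ≢ delete v x) → ∂ (χ x) y ≈ 0#
  ∂χ-nonfacet []            []            ≢ = refl
  ∂χ-nonfacet (inside  ∷ x) (outside ∷ y) ≢ = trans
    (+-cong (trans (*-identityˡ _) (χ-diff x y λ x≡y → ≢ zero here (cong (outside ∷_) (≡.sym x≡y))))
            (contract-zero _ y)) (+-identityʳ _)
  ∂χ-nonfacet (outside ∷ x) (outside ∷ y) ≢ = trans (trans (+-congʳ (zeroʳ _)) (+-identityˡ _))
    (∂χ-nonfacet x y λ v v∈x y≡ → ≢ (suc v) (there v∈x) (cong (outside ∷_) y≡))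
  ∂χ-nonfacet (inside  ∷ x) (inside  ∷ y) ≢ = trans
    (-‿cong (∂χ-nonfacet x y λ v v∈x y≡ → ≢ (suc v) (there v∈x) (cong (inside ∷_) y≡))) -0#≈0#
  ∂χ-nonfacet (outside ∷ x) (inside  ∷ y) ≢ = trans (-‿cong (contract-zero _ y)) -0#≈0#

-- Acyclicity of contractible graphs and fundamental cycles of spheres.

module Homology {c ℓ} (R : CommutativeRing c ℓ) {n} (G : Graph n) where
  open CommutativeRing R hiding (zero)
  open Graph G
  open Subsets
  open Chains R
  open Matrices R using (𝟙)
  open import Algebra.Properties.Ring ring
  open IntegerMultiples R
  open Solver
  open import Data.Fin.Properties using (_≟_)
  open import Data.Fin.Subset using (Subset; _∈_; _∉_; _∩_; ⁅_⁆; ⊥; ∣_∣; Nonempty; Empty)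
    renaming (_-_ to _∖_)
  open import Data.Fin.Subset.Properties
    using (_∈?_; nonempty?; Empty-unique; x∈⁅x⁆; x∈⁅y⁆⇒x≡y; x∈p∩q⁺; x∈p∩q⁻; x∈p∧x≢y⇒x∈p-y; ∣⊥∣≡0; ∉⊥)
  import Data.Nat.Properties as ℕₚ
  open import Data.Vec.Properties using (lookup∘tabulate; []=⇒lookup; lookup⇒[]=)
  open import Relation.Binary.Reasoning.Setoid setoid
  open import Relation.Nullary.Decidable using (dec-true; does)

  private
    variable
      k : ℕ
      u v : Fin n
      W x y : Subset n

  N : Fin n → Subset n
  N = neighbours

  ∈-neighbours⁻ : u ∈ N v → v ~ u
  ∈-neighbours⁻ {u} {v} u∈ with v ~? u | ≡.trans (≡.sym (lookup∘tabulate (λ u → does (v ~? u)) u)) ([]=⇒lookup u∈)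
  ... | yes v~u | _ = v~u

  ∈-neighbours⁺ : v ~ u → u ∈ N v
  ∈-neighbours⁺ {v} {u} v~u = lookup⇒[]= u _
    (≡.trans (lookup∘tabulate (λ u → does (v ~? u)) u) (dec-true (v ~? u) v~u))

  Face : Subset n → Subset n → Set
  Face W x = (∀ {u} → u ∈ x → u ∈ W) × (∀ {u v} → u ∈ x → v ∈ x → u ≢ v → u ~ v)

  Face-empty : Empty x → Face W x
  Face-empty empty = (λ u∈x → contradiction (_ , u∈x) empty) , λ u∈x → contradiction (_ , u∈x) empty

  v∉link : Face (W ∩ N v) y → v ∉ y
  v∉link {W} {v} (y⊆ , _) v∈y = ~-irrefl ≡.refl (∈-neighbours⁻ (proj₂ (x∈p∩q⁻ W (N v) (y⊆ v∈y))))

  link⇒Face∖ : Face (W ∩ N v) y → Face (W ∖ v) y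
  link⇒Face∖ {W} {v} F@(y⊆ , adj) =
    (λ u∈y → x∈p∧x≢y⇒x∈p-y (proj₁ (x∈p∩q⁻ W (N v) (y⊆ u∈y))) λ { ≡.refl → v∉link {W} F u∈y }) , adj

  Face∖⇒Face : Face (W ∖ v) x → Face W x
  Face∖⇒Face (x⊆ , adj) = (proj₁ ∘ ∈-─⁻ ∘ x⊆) , adj

  Face∖⇒∉ : Face (W ∖ v) x → v ∉ x
  Face∖⇒∉ {W} {v} (x⊆ , _) v∈x = proj₂ (∈-─⁻ {x = W} (x⊆ v∈x)) ≡.refl

  Face⇒Face∖ : v ∉ x → Face W x → Face (W ∖ v) x
  Face⇒Face∖ v∉x (x⊆ , adj) = (λ u∈x → x∈p∧x≢y⇒x∈p-y (x⊆ u∈x) λ { ≡.refl → v∉x u∈x }) , adj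

  Face-insert : v ∈ W → Face (W ∩ N v) y → Face W (insert v y)
  Face-insert {v} {W} {y} v∈W (y⊆ , adj) = ⊆W , adj′
    where
    ⊆W : ∀ {u} → u ∈ insert v y → u ∈ W
    ⊆W u∈ with ∈-insert⁻ u∈
    ... | inj₁ ≡.refl = v∈W
    ... | inj₂ u∈y    = proj₁ (x∈p∩q⁻ W (N v) (y⊆ u∈y))
    v~ : ∀ {u} → u ∈ y → v ~ u
    v~ u∈y = ∈-neighbours⁻ (proj₂ (x∈p∩q⁻ W (N v) (y⊆ u∈y)))
    adj′ : ∀ {u w} → u ∈ insert v y → w ∈ insert v y → u ≢ w → u ~ w
    adj′ u∈ w∈ u≢w with ∈-insert⁻ u∈ | ∈-insert⁻ w∈
    ... | inj₁ ≡.refl | inj₁ ≡.refl = contradiction ≡.refl u≢w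
    ... | inj₁ ≡.refl | inj₂ w∈y    = v~ w∈y
    ... | inj₂ u∈y    | inj₁ ≡.refl = ~-sym (v~ u∈y)
    ... | inj₂ u∈y    | inj₂ w∈y    = adj u∈y w∈y u≢w

  Face-delete : v ∈ x → Face W x → Face (W ∩ N v) (delete v x)
  Face-delete {v} {x} v∈x (x⊆ , adj) =
    (λ u∈ → x∈p∩q⁺ (x⊆ (∈-delete⁻ u∈) ,
      ∈-neighbours⁺ (adj v∈x (∈-delete⁻ u∈) λ { ≡.refl → v∉delete v x u∈ }))) ,
    λ u∈ w∈ → adj (∈-delete⁻ u∈) (∈-delete⁻ w∈)

  Face-delete-insert : v ∉ y → Face W (insert v y) → Face (W ∩ N v) y
  Face-delete-insert {v} {y} {W} v∉y F =
    subst (Face (W ∩ N v)) (delete-insert v∉y) (Face-delete (v∈insert v y) F)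

  Face-insert-delete : v ∈ W → v ∈ x → Face (W ∩ N v) (delete v x) → Face W x
  Face-insert-delete {v} {W} v∈W v∈x F = subst (Face W) (insert-delete v∈x) (Face-insert v∈W F)

  infix 4 _On_
  _On_ : Λ n → (Subset n → Set) → Set ℓ
  ω On P = ∀ x → ¬ P x → ω x ≈ 0#

  Cycle : Λ n → Set ℓ
  Cycle ω = ∂ ω ≐ λ _ → 0#

  Bounds : Subset n → Λ n → Set (c ⊔ ℓ)
  Bounds W ω = ∃ λ η → η On Face W × ∂ η ≐ ω

  Acyclic : Subset n → Set (c ⊔ ℓ)
  Acyclic W = ∀ ω → ω On Face W → Cycle ω → Bounds W ω

  On-minus : ∀ {P ω η} → ω On P → η On P → (λ x → ω x - η x) On P
  On-minus ω-on η-on x ¬P = trans (+-cong (ω-on x ¬P) (-‿cong (η-on x ¬P))) (-‿inverseʳ 0#)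

  link-on : ∀ {ω} → ω On Face W → link v ω On Face (W ∩ N v)
  link-on {W} {v} {ω} ω-on y ¬F with v ∈? y
  ... | yes v∈y = link-∈ v ω y v∈y
  ... | no  v∉y = ≈±-zero (link-∉ v ω y v∉y) (ω-on _ (¬F ∘ Face-delete-insert v∉y))

  cone-on : ∀ {ω} → v ∈ W → ω On Face (W ∩ N v) → cone v ω On Face W
  cone-on {v} {W} {ω} v∈W ω-on x ¬F with v ∈? x
  ... | yes v∈x = ≈±-zero (cone-∈ v ω x v∈x) (ω-on _ (¬F ∘ Face-insert-delete v∈W v∈x))
  ... | no  v∉x = cone-∉ v ω x v∉x

  link-Face∖ : ∀ {ω} → ω On Face (W ∖ v) → link v ω ≐ λ _ → 0#
  link-Face∖ {W} {v} {ω} ω-on y with v ∈? y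
  ... | yes v∈y = link-∈ v ω y v∈y
  ... | no  v∉y = ≈±-zero (link-∉ v ω y v∉y) (ω-on _ λ F → Face∖⇒∉ {W} F (v∈insert v y))

  link-cycle : ∀ v {ω} → Cycle ω → Cycle (link v ω)
  link-cycle v {ω} ∂ω≐0 y = begin
    ∂ (link v ω) y  ≈⟨ -‿involutive _ ⟨
    - - ∂ (link v ω) y  ≈⟨ -‿cong (∂-link v ω y) ⟨
    - link v (∂ ω) y  ≈⟨ -‿cong (trans (contract-cong (𝟙 v) ∂ω≐0 y) (contract-zero (𝟙 v) y)) ⟩
    - 0#  ≈⟨ -0#≈0# ⟩
    0#  ∎

  -- Adding the boundary of the cone over β moves ω away from v.
  bounds-from-link : ∀ {ω β} → v ∈ W → Acyclic (W ∖ v) → ω On Face W → Cycle ω →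
    β On Face (W ∩ N v) → ∂ β ≐ link v ω → Bounds W ω
  bounds-from-link {v} {W} {ω} {β} v∈W acyclic ω-on ∂ω≐0 β-on ∂β≐ =
    (λ x → η x - cone v β x) ,
    On-minus (λ x ¬F → η-on x (¬F ∘ Face∖⇒Face {W})) (cone-on v∈W β-on) ,
    λ y → begin
      ∂ (λ x → η x - cone v β x) y  ≈⟨ contract-minus _ η (cone v β) y ⟩
      ∂ η y - ∂ (cone v β) y  ≈⟨ +-congʳ (∂η≐ y) ⟩
      ω y + ∂ (cone v β) y - ∂ (cone v β) y  ≈⟨ solve 2 (λ a b → a :+ b :- b := a) refl _ _ ⟩
      ω y ∎
    where
    ω′ : Λ n
    ω′ x = ω x + ∂ (cone v β) x
    ω′≈ : ∀ x → ω′ x ≈ ω x - cone v (link v ω) x + β x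
    ω′≈ x = begin
      ω x + ∂ (cone v β) x  ≈⟨ +-congˡ (trans (∂-cone v β x) (+-congˡ (-‿cong (wedge-congʳ (𝟙 v) ∂β≐ x)))) ⟩
      ω x + (β x - cone v (link v ω) x)  ≈⟨ solve 3 (λ a b c → a :+ (b :- c) := a :- c :+ b) refl _ _ _ ⟩
      ω x - cone v (link v ω) x + β x  ∎
    away : ∀ x → ¬ Face (W ∖ v) x → ω x - cone v (link v ω) x ≈ 0#
    away x ¬F with v ∈? x
    ... | yes v∈x = begin
      ω x - cone v (link v ω) x  ≈⟨ +-congʳ (link-cone v ω x) ⟨
      link v (cone v ω) x + cone v (link v ω) x - cone v (link v ω) x
        ≈⟨ solve 2 (λ a b → a :+ b :- b := a) refl _ _ ⟩
      link v (cone v ω) x  ≈⟨ link-∈ v _ x v∈x ⟩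
      0#  ∎
    ... | no  v∉x = trans
      (+-cong (ω-on x (¬F ∘ Face⇒Face∖ v∉x)) (-‿cong (cone-∉ v _ x v∉x))) (-‿inverseʳ 0#)
    ω′-on : ω′ On Face (W ∖ v)
    ω′-on x ¬F = trans (ω′≈ x) (trans (+-cong (away x ¬F) (β-on x (¬F ∘ link⇒Face∖ {W}))) (+-identityʳ _))
    ω′-cycle : Cycle ω′
    ω′-cycle y = trans (contract-+ _ ω _ y) (trans (+-cong (∂ω≐0 y) (∂∂≐0 _ y)) (+-identityʳ _))
    η = proj₁ (acyclic ω′ ω′-on ω′-cycle)
    η-on = proj₁ (proj₂ (acyclic ω′ ω′-on ω′-cycle))
    ∂η≐ = proj₂ (proj₂ (acyclic ω′ ω′-on ω′-cycle))

  -- A Mayer-Vietoris argument on chains. For one point, the cone contracts the complex. Otherwise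
  -- the link of a cycle at `v` is a cycle in the unit sphere, where it bounds by induction; this
  -- pushes the cycle off `v`, into a graph that is acyclic by induction.
  contractible⇒acyclic : Contractible[_] G W → Acyclic W
  contractible⇒acyclic (one-point v ≡.refl) ω ω-on ∂ω≐0 = cone v ω , on , λ y → begin
    ∂ (cone v ω) y  ≈⟨ ∂-cone v ω y ⟩
    ω y - cone v (∂ ω) y  ≈⟨ +-congˡ (-‿cong (trans (wedge-congʳ (𝟙 v) ∂ω≐0 y) (wedge-zero (𝟙 v) y))) ⟩
    ω y - 0#  ≈⟨ trans (+-congˡ -0#≈0#) (+-identityʳ _) ⟩
    ω y  ∎
    where
    on : cone v ω On Face ⁅ v ⁆
    on x ¬F with v ∈? x
    ... | no  v∉x = cone-∉ v ω x v∉x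
    ... | yes v∈x = ≈±-zero (cone-∈ v ω x v∈x) (ω-on _ (¬F ∘ face))
      where
      face : Face ⁅ v ⁆ (delete v x) → Face ⁅ v ⁆ x
      face (⊆v , _) = ⊆v′ , λ u∈ w∈ u≢w →
        contradiction (≡.trans (x∈⁅y⁆⇒x≡y v (⊆v′ u∈)) (≡.sym (x∈⁅y⁆⇒x≡y v (⊆v′ w∈)))) u≢w
        where
        ⊆v′ : ∀ {u} → u ∈ x → u ∈ ⁅ v ⁆
        ⊆v′ {u} u∈x with u ≟ v
        ... | yes ≡.refl = x∈⁅x⁆ v
        ... | no  u≢v    = ⊆v (∈-delete⁺ u≢v u∈x)
  contractible⇒acyclic (extend v v∈W S W∖v) ω ω-on ∂ω≐0
    with contractible⇒acyclic S (link v ω) (link-on ω-on) (link-cycle v ∂ω≐0)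
  ... | β , β-on , ∂β≐ = bounds-from-link v∈W (contractible⇒acyclic W∖v) ω-on ∂ω≐0 β-on ∂β≐

  contractible-nonempty : Contractible[_] G W → Nonempty W
  contractible-nonempty (one-point v ≡.refl) = v , x∈⁅x⁆ v
  contractible-nonempty (extend v v∈W _ _)   = v , v∈W

  -- Connectedness as an induction principle along edges, in place of paths. The added vertex `w` is
  -- joined to the rest because its unit sphere is contractible and therefore not empty.
  contractible-connected : Contractible[_] G W → ∀ {p} (P : Fin n → Set p) →
    (∀ {u v} → u ∈ W → v ∈ W → u ~ v → P u → P v) → ∀ {u v} → u ∈ W → v ∈ W → P u → P v
  contractible-connected (one-point w ≡.refl) P transfer u∈W v∈W Pu
    with ≡.refl ← ≡.trans (x∈⁅y⁆⇒x≡y w u∈W) (≡.sym (x∈⁅y⁆⇒x≡y w v∈W)) = Pu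
  contractible-connected {W} (extend w w∈W S W∖w) P transfer {u} {v} u∈W v∈W Pu
    with contractible-nonempty S
  ... | w′ , w′∈S with x∈p∩q⁻ W (N w) w′∈S
  ... | w′∈W , w′∈N = go (u ≟ w) (v ≟ w)
    where
    w~w′ : w ~ w′
    w~w′ = ∈-neighbours⁻ w′∈N
    w′∈ : w′ ∈ W ∖ w
    w′∈ = x∈p∧x≢y⇒x∈p-y w′∈W λ { ≡.refl → ~-irrefl ≡.refl w~w′ }
    connected : ∀ {u v} → u ∈ W ∖ w → v ∈ W ∖ w → P u → P v
    connected = contractible-connected W∖w P λ u∈ v∈ → transfer (proj₁ (∈-─⁻ u∈)) (proj₁ (∈-─⁻ v∈))
    go : Dec (u ≡ w) → Dec (v ≡ w) → P v
    go (yes ≡.refl) (yes ≡.refl) = Pu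
    go (yes ≡.refl) (no v≢w)     = connected w′∈ (x∈p∧x≢y⇒x∈p-y v∈W v≢w) (transfer w∈W w′∈W w~w′ Pu)
    go (no u≢w) (yes ≡.refl)     = transfer w′∈W w∈W (~-sym w~w′) (connected (x∈p∧x≢y⇒x∈p-y u∈W u≢w) w′∈ Pu)
    go (no u≢w) (no v≢w)         = connected (x∈p∧x≢y⇒x∈p-y u∈W u≢w) (x∈p∧x≢y⇒x∈p-y v∈W v≢w) Pu

  -- For the 0-sphere, whose complement of a point has to be a single point. Without edges every
  -- property passes along edges, in particular equality with `u`.
  contractible-edgeless : Contractible[_] G W → (∀ {u v} → u ∈ W → v ∈ W → ¬ (u ~ v)) →
                          ∀ {u v} → u ∈ W → v ∈ W → u ≡ v
  contractible-edgeless γ edgeless {u} u∈W v∈W =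
    contractible-connected γ (u ≡_) (λ u∈ v∈ u~v → contradiction u~v (edgeless u∈ v∈)) u∈W v∈W ≡.refl

  face-bound : ∀ k {W x} → Sphere[_,_] G k W → Face W x → ∣ x ∣ ℕ.≤ k
  face-bound zero {x = x} empty (x⊆ , _) with nonempty? x
  ... | yes (v , v∈x) = contradiction (v , x⊆ v∈x) empty
  ... | no  ¬ne = ℕₚ.≤-reflexive (≡.trans (cong ∣_∣ (Empty-unique ¬ne)) (∣⊥∣≡0 n))
  face-bound (suc k) {x = x} (S , _) F with nonempty? x
  ... | no  ¬ne = ℕₚ.≤-trans (ℕₚ.≤-reflexive (≡.trans (cong ∣_∣ (Empty-unique ¬ne)) (∣⊥∣≡0 n))) ℕ.z≤n
  ... | yes (v , v∈x) = ℕₚ.≤-trans (ℕₚ.≤-reflexive (∣delete∣ v∈x))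
    (ℕ.s≤s (face-bound k (S v (proj₁ F v∈x)) (Face-delete v∈x F)))

  facet   : ∀ k {W} → Sphere[_,_] G k W → ∃ λ x → Face W x × ∣ x ∣ ≡ k
  facetAt : ∀ k {W} → Sphere[_,_] G (suc k) W → u ∈ W → ∃ λ x → u ∈ x × Face W x × ∣ x ∣ ≡ suc k
  facet zero    empty = ⊥ , Face-empty (λ { (_ , u∈) → ∉⊥ u∈ }) , ∣⊥∣≡0 n
  facet (suc k) S@(_ , v , v∈W , _) with facetAt k S v∈W
  ... | x , _ , F , size = x , F , size
  facetAt {u} k {W} (S , _) u∈W with facet k (S u u∈W)
  ... | y , F , size = insert u y , v∈insert u y , Face-insert u∈W F ,
    ≡.trans (∣insert∣ (v∉link {W} F)) (cong suc size)

  -- Supplies a facet common to the stars of two adjacent vertices, where coefficients can be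
  -- compared.
  facetAtEdge : ∀ k {W} → Sphere[_,_] G (suc k) W → u ∈ W → v ∈ W → u ~ v →
                ∃ λ x → u ∈ x × v ∈ x × Face W x × ∣ x ∣ ≡ suc k
  facetAtEdge {u} {v} zero    (S , _) u∈W v∈W u~v = contradiction (v , x∈p∩q⁺ (v∈W , ∈-neighbours⁺ u~v)) (S u u∈W)
  facetAtEdge {u} {v} (suc k) {W} (S , _) u∈W v∈W u~v
    with facetAt k (S u u∈W) (x∈p∩q⁺ (v∈W , ∈-neighbours⁺ u~v))
  ... | y , v∈y , F , size = insert u y , v∈insert u y , ∈-insert⁺ v∈y , Face-insert u∈W F ,
    ≡.trans (∣insert∣ (v∉link {W} F)) (cong suc size)

  -- A top-dimensional cycle which generates the homology and has coefficients ±1;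
  -- over an arbitrary ring, the latter is expressed by squares.
  record Fundamental (k : ℕ) (W : Subset n) : Set (c ⊔ ℓ) where
    field
      z     : Λ n
      on    : z On Face W
      cycle : Cycle z
      unit  : ∀ x → Face W x → ∣ x ∣ ≡ k → z x * z x ≈ 1#
      span  : ∀ ω → ω On Face W → Cycle ω →
              ∃ λ m → ∃ λ β → β On Face W × (∀ x → ω x ≈ m * z x + ∂ β x)

  -- In the augmented complex the (-1)-sphere has the empty face as its only face; its indicator
  -- `one` is the fundamental cycle.
  fundamental-empty : Empty W → Fundamental 0 W
  fundamental-empty {W} empty = record
    { z     = one
    ; on    = one-on
    ; cycle = ∂-one
    ; unit  = λ x F _ → trans (*-cong (one≈1 F) (one≈1 F)) (*-identityˡ _)
    ; span  = λ ω ω-on _ → ω ⊥ , (λ _ → 0#) , (λ _ _ → refl) , λ x →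
        trans (ω≈ ω ω-on x) (trans (sym (+-identityʳ _)) (+-congˡ (sym (contract-zero _ x))))
    }
    where
    empty-face : Face W x → x ≡ ⊥
    empty-face (x⊆ , _) = Empty-unique λ { (v , v∈x) → empty (v , x⊆ v∈x) }
    one≈1 : Face W x → one x ≈ 1#
    one≈1 F with ≡.refl ← empty-face F = one-⊥ {n = n}
    one-on : one On Face W
    one-on x ¬F with nonempty? x
    ... | yes ne  = one-nonempty x ne
    ... | no  ¬ne = contradiction (Face-empty ¬ne) ¬F
    ω≈ : ∀ ω → ω On Face W → ∀ x → ω x ≈ ω ⊥ * one x
    ω≈ ω ω-on x with nonempty? x
    ... | yes ne@(v , v∈x) = trans (ω-on x λ F → empty (v , proj₁ F v∈x))
      (sym (trans (*-congˡ (one-nonempty x ne)) (zeroʳ _)))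
    ... | no ¬ne with ≡.refl ← Empty-unique ¬ne = sym (trans (*-congˡ (one-⊥ {n = n})) (*-identityʳ _))

  module _ {k W} (sphere : Sphere[_,_] G (suc k) W)
           (fundamental : ∀ v₀ → v₀ ∈ W → Fundamental k (W ∩ N v₀)) where
    private
      S = proj₁ sphere
      v₀ = proj₁ (proj₂ sphere)
      v∈W = proj₁ (proj₂ (proj₂ sphere))
      γ = proj₂ (proj₂ (proj₂ sphere))
      module Fᵥ = Fundamental (fundamental v₀ v∈W)

      zᵥ-on : Fᵥ.z On Face (W ∖ v₀)
      zᵥ-on x ¬F = Fᵥ.on x (¬F ∘ link⇒Face∖ {W})

      filling : Bounds (W ∖ v₀) Fᵥ.z
      filling = contractible⇒acyclic γ Fᵥ.z zᵥ-on Fᵥ.cycle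

      w : Λ n
      w = proj₁ filling
      w-on : w On Face (W ∖ v₀)
      w-on = proj₁ (proj₂ filling)
      ∂w≐ : ∂ w ≐ Fᵥ.z
      ∂w≐ = proj₂ (proj₂ filling)

      -- Two fillings of the fundamental cycle of the unit sphere of `v₀` are glued along it: `w` in
      -- the contractible complement of `v₀`, and the cone with apex `v₀`.
      z : Λ n
      z x = w x - cone v₀ Fᵥ.z x

      z-on : z On Face W
      z-on = On-minus (λ x ¬F → w-on x (¬F ∘ Face∖⇒Face {W})) (cone-on v∈W Fᵥ.on)

      z-cycle : Cycle z
      z-cycle y = begin
        ∂ z y  ≈⟨ contract-minus _ w (cone v₀ Fᵥ.z) y ⟩
        ∂ w y - ∂ (cone v₀ Fᵥ.z) y  ≈⟨ +-cong (∂w≐ y) (-‿cong (∂-cone v₀ Fᵥ.z y)) ⟩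
        Fᵥ.z y - (Fᵥ.z y - cone v₀ (∂ Fᵥ.z) y)  ≈⟨ solve 2 (λ a b → a :- (a :- b) := b) refl _ _ ⟩
        cone v₀ (∂ Fᵥ.z) y  ≈⟨ trans (wedge-congʳ (𝟙 v₀) Fᵥ.cycle y) (wedge-zero (𝟙 v₀) y) ⟩
        0#  ∎

      link-z : ∀ y → link v₀ z y ≈ - Fᵥ.z y
      link-z y = begin
        link v₀ z y  ≈⟨ contract-minus (𝟙 v₀) w (cone v₀ Fᵥ.z) y ⟩
        link v₀ w y - link v₀ (cone v₀ Fᵥ.z) y  ≈⟨ +-cong (link-Face∖ {W} w-on y) (-‿cong (begin
            link v₀ (cone v₀ Fᵥ.z) y  ≈⟨ +-identityʳ _ ⟨
            link v₀ (cone v₀ Fᵥ.z) y + 0#  ≈⟨ +-congˡ (trans (wedge-congʳ (𝟙 v₀) (link-Face∖ {W} zᵥ-on) y) (wedge-zero (𝟙 v₀) y)) ⟨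
            link v₀ (cone v₀ Fᵥ.z) y + cone v₀ (link v₀ Fᵥ.z) y  ≈⟨ link-cone v₀ Fᵥ.z y ⟩
            Fᵥ.z y ∎)) ⟩
        0# - Fᵥ.z y  ≈⟨ +-identityˡ _ ⟩
        - Fᵥ.z y  ∎

      -- The link of ω is m zᵥ + ∂β and that of z is - zᵥ. Hence m z + ω has link ∂β and bounds, so
      -- that ω is homologous to - m z.
      z-span : ∀ ω → ω On Face W → Cycle ω →
               ∃ λ m → ∃ λ β → β On Face W × (∀ x → ω x ≈ m * z x + ∂ β x)
      z-span ω ω-on ω-cycle with Fᵥ.span (link v₀ ω) (link-on ω-on) (link-cycle v₀ ω-cycle)
      ... | m , β , β-on , link≈ = - m , η , η-on , λ x → begin
          ω x  ≈⟨ solve 3 (λ o m z → o := (:- m) :* z :+ (m :* z :+ o)) refl (ω x) m (z x) ⟩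
          - m * z x + (m * z x + ω x)  ≈⟨ +-congˡ (∂η≐ x) ⟨
          - m * z x + ∂ η x  ∎
        where
        bounds : Bounds W (λ x → m * z x + ω x)
        bounds = bounds-from-link v∈W (contractible⇒acyclic γ)
          (λ x ¬F → trans (+-cong (trans (*-congˡ (z-on x ¬F)) (zeroʳ m)) (ω-on x ¬F)) (+-identityʳ _))
          (λ y → trans (contract-linear _ m z ω y)
            (trans (+-cong (trans (*-congˡ (z-cycle y)) (zeroʳ m)) (ω-cycle y)) (+-identityʳ _)))
          β-on
          (λ y → sym (begin
            link v₀ (λ x → m * z x + ω x) y  ≈⟨ contract-linear (𝟙 v₀) m z ω y ⟩
            m * link v₀ z y + link v₀ ω y  ≈⟨ +-cong (*-congˡ (link-z y)) (link≈ y) ⟩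
            m * - Fᵥ.z y + (m * Fᵥ.z y + ∂ β y)  ≈⟨ solve 3 (λ m z b → m :* :- z :+ (m :* z :+ b) := b) refl m _ _ ⟩
            ∂ β y  ∎))
        η = proj₁ bounds
        η-on = proj₁ (proj₂ bounds)
        ∂η≐ = proj₂ (proj₂ bounds)

      UnitAt : Fin n → Set ℓ
      UnitAt u = ∀ x → u ∈ x → Face W x → ∣ x ∣ ≡ suc k → z x * z x ≈ 1#

      size-delete : u ∈ x → ∣ x ∣ ≡ suc k → ∣ delete u x ∣ ≡ k
      size-delete u∈x size = ℕₚ.suc-injective (≡.trans (≡.sym (∣delete∣ u∈x)) size)

      unitAt-v : UnitAt v₀
      unitAt-v x v∈x F size = begin
        z x * z x  ≈⟨ *-cong z≈ z≈ ⟩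
        - cone v₀ Fᵥ.z x * - cone v₀ Fᵥ.z x  ≈⟨ solve 1 (λ a → :- a :* :- a := a :* a) refl _ ⟩
        cone v₀ Fᵥ.z x * cone v₀ Fᵥ.z x  ≈⟨ ≈±-square (cone-∈ v₀ Fᵥ.z x v∈x) ⟩
        Fᵥ.z (delete v₀ x) * Fᵥ.z (delete v₀ x)  ≈⟨ Fᵥ.unit _ (Face-delete v∈x F) (size-delete v∈x size) ⟩
        1#  ∎
        where
        z≈ : z x ≈ - cone v₀ Fᵥ.z x
        z≈ = trans (+-congʳ (w-on x λ F′ → Face∖⇒∉ {W} F′ v∈x)) (+-identityˡ _)

      -- On the star of u, the cycle z is a multiple of the fundamental cycle of the unit sphere of u.
      multiple : ∀ u → u ∈ W → ∃ λ m → ∀ x → u ∈ x → Face W x → ∣ x ∣ ≡ suc k → z x * z x ≈ m * m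
      multiple u u∈W with Fundamental.span (fundamental u u∈W) (link u z) (link-on z-on) (link-cycle u z-cycle)
      ... | m , β , β-on , link≈ = m , λ x u∈x F size →
        let
          y = delete u x
          link≈z : link u z y ≈± z x
          link≈z = subst (λ x′ → link u z y ≈± z x′) (insert-delete u∈x) (link-∉ u z y (v∉delete u x))
          ∂β≈0 : ∂ β y ≈ 0#
          ∂β≈0 = contract-local _ y λ x′ size′ → β-on x′ λ F′ → ℕₚ.<-irrefl ≡.refl
            (ℕₚ.≤-trans (ℕₚ.≤-reflexive (≡.trans (cong suc (≡.sym (size-delete u∈x size))) (≡.sym size′)))
                        (face-bound k (S u u∈W) F′))
          zᵤ = Fundamental.z (fundamental u u∈W) y
          link≈m : link u z y ≈ m * zᵤ
          link≈m = trans (link≈ y) (trans (+-congˡ ∂β≈0) (+-identityʳ _))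
        in begin
          z x * z x  ≈⟨ ≈±-square link≈z ⟨
          link u z y * link u z y  ≈⟨ *-cong link≈m link≈m ⟩
          m * zᵤ * (m * zᵤ)  ≈⟨ solve 2 (λ m z → m :* z :* (m :* z) := m :* m :* (z :* z)) refl m zᵤ ⟩
          m * m * (zᵤ * zᵤ)  ≈⟨ *-congˡ (Fundamental.unit (fundamental u u∈W) y (Face-delete u∈x F) (size-delete u∈x size)) ⟩
          m * m * 1#  ≈⟨ *-identityʳ _ ⟩
          m * m  ∎

      -- All facets at `u′` share the squared coefficient m², which is evaluated at a facet
      -- containing both vertices.
      transfer : ∀ {u u′} → u ∈ W → u′ ∈ W → u ~ u′ → UnitAt u → UnitAt u′
      transfer {u} {u′} u∈W u′∈W u~u′ unit x u′∈x F size =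
        let
          x₀ , u∈x₀ , u′∈x₀ , F₀ , size₀ = facetAtEdge k sphere u∈W u′∈W u~u′
          m , z²≈m² = multiple u′ u′∈W
        in begin
          z x * z x  ≈⟨ z²≈m² x u′∈x F size ⟩
          m * m  ≈⟨ z²≈m² x₀ u′∈x₀ F₀ size₀ ⟨
          z x₀ * z x₀  ≈⟨ unit x₀ u∈x₀ F₀ size₀ ⟩
          1#  ∎

      -- The 0-sphere: `x` consists of `u` alone, the only vertex besides `v₀`. No larger face
      -- exists in `W ∖ v₀`, so the cone formula recovers the coefficient of `w` at `x` from ∂ w at
      -- the empty face.
      unitAt-edgeless : (∀ {u} → u ∈ W → Empty (W ∩ N u)) → ∀ {u} → u ∈ W ∖ v₀ → UnitAt u
      unitAt-edgeless edgeless {u} u∈ x u∈x F size = begin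
        z x * z x  ≈⟨ *-cong z≈w z≈w ⟩
        w x * w x  ≈⟨ *-cong w≈ w≈ ⟩
        cone u (∂ w) x * cone u (∂ w) x  ≈⟨ ≈±-square (cone-∈ u (∂ w) x u∈x) ⟩
        ∂ w (delete u x) * ∂ w (delete u x)  ≈⟨ *-cong (∂w≐ _) (∂w≐ _) ⟩
        Fᵥ.z (delete u x) * Fᵥ.z (delete u x)  ≈⟨ Fᵥ.unit _ face-x′ (size-delete u∈x size) ⟩
        1#  ∎
        where
        single : ∀ {u′} → u′ ∈ W ∖ v₀ → u′ ≡ u
        single u′∈ = contractible-edgeless γ
          (λ a∈ b∈ a~b → edgeless (proj₁ (∈-─⁻ a∈)) (_ , x∈p∩q⁺ (proj₁ (∈-─⁻ b∈) , ∈-neighbours⁺ a~b))) u′∈ u∈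
        x-single : ∀ {u′} → u′ ∈ x → u′ ≡ u
        x-single {u′} u′∈x with u′ ≟ u
        ... | yes u′≡u = u′≡u
        ... | no  u′≢u = contradiction
          (_ , x∈p∩q⁺ (proj₁ F u′∈x , ∈-neighbours⁺ (proj₂ F u∈x u′∈x (u′≢u ∘ ≡.sym)))) (edgeless (proj₁ (∈-─⁻ u∈)))
        v∉x : v₀ ∉ x
        v∉x v∈x = proj₂ (∈-─⁻ {x = W} u∈) (≡.sym (x-single v∈x))
        z≈w : z x ≈ w x
        z≈w = trans (+-congˡ (trans (-‿cong (cone-∉ v₀ Fᵥ.z x v∉x)) -0#≈0#)) (+-identityʳ _)
        cone-w≈0 : ∀ x′ → ∣ x′ ∣ ≡ suc ∣ x ∣ → cone u w x′ ≈ 0#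
        cone-w≈0 x′ size′ with u ∈? x′
        ... | no  u∉x′ = cone-∉ u w x′ u∉x′
        ... | yes u∈x′ = ≈±-zero (cone-∈ u w x′ u∈x′) (w-on _ λ F′ →
          let q , q∈ = nonempty (delete u x′) (≡.trans (ℕₚ.suc-injective (≡.trans (≡.sym (∣delete∣ u∈x′)) size′)) size)
          in v∉delete u x′ (subst (_∈ delete u x′) (single (proj₁ F′ q∈)) q∈))
        w≈ : w x ≈ cone u (∂ w) x
        w≈ = begin
          w x  ≈⟨ solve 2 (λ a b → a := (a :- b) :+ b) refl _ _ ⟩
          (w x - cone u (∂ w) x) + cone u (∂ w) x  ≈⟨ +-congʳ (∂-cone u w x) ⟨
          ∂ (cone u w) x + cone u (∂ w) x  ≈⟨ +-congʳ (contract-local _ x cone-w≈0) ⟩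
          0# + cone u (∂ w) x  ≈⟨ +-identityˡ _ ⟩
          cone u (∂ w) x  ∎
        face-x′ : Face (W ∩ N v₀) (delete u x)
        face-x′ = (λ u′∈ → empty u′∈) , λ u′∈ → empty u′∈
          where
          empty : ∀ {u′} {a} {A : Set a} → u′ ∈ delete u x → A
          empty u′∈ with ≡.refl ← x-single (∈-delete⁻ u′∈) = contradiction u′∈ (v∉delete u x)

      -- At `v₀` the coefficients are those of the cone. If `v₀` has a neighbour `v₁`, the property
      -- crosses that edge and then spreads through the connected complement of `v₀`. Only the
      -- 0-sphere has no such edge and is treated apart.
      unitAt : ∀ {u} → u ∈ W → UnitAt u
      unitAt {u} u∈W with u ≟ v₀
      ... | yes ≡.refl = unitAt-v
      ... | no  u≢v    = go k ≡.refl
        where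
        u∈ : u ∈ W ∖ v₀
        u∈ = x∈p∧x≢y⇒x∈p-y u∈W u≢v
        go : ∀ k′ → k ≡ k′ → UnitAt u
        go zero ≡.refl = unitAt-edgeless (λ {u} → S u) u∈
        go (suc k′) ≡.refl =
          let
            v₁ , v₁∈ , _ = proj₂ (S v₀ v∈W)
            v₁∈W , v₁∈N = x∈p∩q⁻ W (N v₀) v₁∈
            v₀~v₁ = ∈-neighbours⁻ v₁∈N
          in contractible-connected γ UnitAt
            (λ a∈ b∈ → transfer (proj₁ (∈-─⁻ a∈)) (proj₁ (∈-─⁻ b∈)))
            (x∈p∧x≢y⇒x∈p-y v₁∈W λ v₁≡v₀ → ~-irrefl (≡.sym v₁≡v₀) v₀~v₁) u∈
            (transfer v∈W v₁∈W v₀~v₁ unitAt-v)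

    fundamental-suc : Fundamental (suc k) W
    fundamental-suc = record
      { z     = z
      ; on    = z-on
      ; cycle = z-cycle
      ; unit  = λ x F size → let u , u∈x = nonempty x size in unitAt (proj₁ F u∈x) x u∈x F size
      ; span  = z-span
      }

  fundamental : ∀ k {W} → Sphere[_,_] G k W → Fundamental k W
  fundamental zero    empty  = fundamental-empty empty
  fundamental (suc k) sphere = fundamental-suc sphere λ v v∈W → fundamental k (proj₁ sphere v v∈W)

  -- A cycle avoiding the facet x₀ has no component along the fundamental cycle.
  punctured-sphere-acyclic : ∀ k {W x₀} → Sphere[_,_] G k W → Face W x₀ → ∣ x₀ ∣ ≡ k →
    ∀ ω → ω On (λ x → Face W x × x ≢ x₀) → Cycle ω →
    ∃ λ η → η On (λ x → Face W x × x ≢ x₀) × ∂ η ≐ ω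
  punctured-sphere-acyclic k {W} {x₀} sphere F₀ size₀ ω ω-on ω-cycle =
    η , η-on , λ y → begin
      ∂ η y  ≈⟨ contract-minus _ β (λ x → β x₀ * z x₀ * z x) y ⟩
      ∂ β y - ∂ (λ x → β x₀ * z x₀ * z x) y
        ≈⟨ +-congˡ (trans (-‿cong (trans (contract-scale _ (β x₀ * z x₀) z y) (trans (*-congˡ (cycle y)) (zeroʳ _)))) -0#≈0#) ⟩
      ∂ β y + 0#  ≈⟨ +-identityʳ _ ⟩
      ∂ β y  ≈⟨ trans (+-congʳ (trans (*-congʳ m≈0) (zeroˡ _))) (+-identityˡ _) ⟨
      m * z y + ∂ β y  ≈⟨ ω≈ y ⟨
      ω y  ∎
    where
    open Fundamental (fundamental k sphere)
    spanned = span ω (λ x ¬F → ω-on x (¬F ∘ proj₁)) ω-cycle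
    m = proj₁ spanned
    β = proj₁ (proj₂ spanned)
    β-on = proj₁ (proj₂ (proj₂ spanned))
    ω≈ = proj₂ (proj₂ (proj₂ spanned))
    z₀²≈1 : z x₀ * z x₀ ≈ 1#
    z₀²≈1 = unit x₀ F₀ size₀
    ∂β₀≈0 : ∂ β x₀ ≈ 0#
    ∂β₀≈0 = contract-local _ x₀ λ x size → β-on x λ F → ℕₚ.<-irrefl ≡.refl
      (ℕₚ.≤-trans (ℕₚ.≤-reflexive (≡.trans (cong suc (≡.sym size₀)) (≡.sym size))) (face-bound k sphere F))
    m≈0 : m ≈ 0#
    m≈0 = begin
      m  ≈⟨ trans (*-congˡ z₀²≈1) (*-identityʳ m) ⟨
      m * (z x₀ * z x₀)  ≈⟨ *-assoc _ _ _ ⟨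
      m * z x₀ * z x₀  ≈⟨ *-congʳ (trans (sym (+-identityʳ _)) (+-congˡ (sym ∂β₀≈0))) ⟩
      (m * z x₀ + ∂ β x₀) * z x₀  ≈⟨ *-congʳ (ω≈ x₀) ⟨
      ω x₀ * z x₀  ≈⟨ *-congʳ (ω-on x₀ λ F → proj₂ F ≡.refl) ⟩
      0# * z x₀  ≈⟨ zeroˡ _ ⟩
      0#  ∎
    η : Λ n
    -- Since `z x₀` is its own inverse, this multiple of the cycle `z` cancels the coefficient of
    -- `β` at `x₀` and leaves the boundary unchanged.
    η x = β x - β x₀ * z x₀ * z x
    η-on : η On (λ x → Face W x × x ≢ x₀)
    η-on x ¬F with x ≟ˢ x₀
    ... | yes ≡.refl = begin
      β x - β x * z x * z x  ≈⟨ +-congˡ (-‿cong (trans (*-assoc _ _ _) (trans (*-congˡ z₀²≈1) (*-identityʳ _)))) ⟩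
      β x - β x  ≈⟨ -‿inverseʳ _ ⟩
      0#  ∎
    ... | no x≢x₀ = trans (+-cong (β-on x ¬F′) (-‿cong (trans (*-congˡ (on x ¬F′)) (zeroʳ _)))) (-‿inverseʳ 0#)
      where
      ¬F′ : ¬ Face W x
      ¬F′ F = ¬F (F , x≢x₀)

-- Passage to the complex relative to the first vertex.

-- The chain complex of a family P of subsets, relative to ∅ and {v₀}, in terms of bases.
module RelativeComplex {c ℓ} (R : CommutativeRing c ℓ) {n : ℕ} where
  open CommutativeRing R hiding (zero)
  open Subsets
  open Chains R
  open Matrices R
  open import Algebra.Properties.Ring ring
  open import Data.Fin.Properties using (any?) renaming (_≟_ to _≟ᶠ_)
  open import Data.Fin.Subset using (Subset; _∈_; _∉_; ⁅_⁆; ⊥; ∣_∣)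
  open import Data.Fin.Subset.Properties using (Empty-unique; x∈⁅x⁆; x∈⁅y⁆⇒x≡y; ∣⁅x⁆∣≡1)
  import Data.Nat.Properties as ℕₚ
  open import Relation.Binary.Reasoning.Setoid setoid

  Supported : (Subset n → Set) → Λ n → Set ℓ
  Supported P ω = ∀ x → ¬ P x → ω x ≈ 0#

  record Basis (P : Subset n → Set) (v₀ : Fin n) : Set₁ where
    field
      rank      : ℕ → ℕ
      β         : ∀ k → Fin (rank k) → Subset n
      injective : ∀ k {i j} → β k i ≡ β k j → i ≡ j
      member    : ∀ k i → P (β k i)
      size      : ∀ k i → ∣ β k i ∣ ≡ suc k
      β≢v₀      : ∀ k i → β k i ≢ ⁅ v₀ ⁆
      complete  : ∀ k {x} → P x → ∣ x ∣ ≡ suc k → x ≢ ⁅ v₀ ⁆ → ∃ λ i → β k i ≡ x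

  ∂-local : ∀ {ω η : Λ n} y → (∀ x → ∣ x ∣ ≡ suc ∣ y ∣ → ω x ≈ η x) → ∂ ω y ≈ ∂ η y
  ∂-local {ω} {η} y ω≈η = x∙y⁻¹≈ε⇒x≈y _ _ (trans (sym (contract-minus _ ω η y))
    (contract-local _ y λ x size → trans (+-congʳ (ω≈η x size)) (-‿inverseʳ _)))

  delete-⁅⁆ : ∀ (v : Fin n) → delete v ⁅ v ⁆ ≡ ⊥
  delete-⁅⁆ v = Empty-unique λ { (u , u∈) →
    v∉delete v ⁅ v ⁆ (subst (_∈ delete v ⁅ v ⁆) (x∈⁅y⁆⇒x≡y v (∈-delete⁻ u∈)) u∈) }

  module _ {P : Subset n → Set} {v₀ : Fin n}
    (down : ∀ {v y} → v ∉ y → P (insert v y) → P y)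
    (P-v₀ : P ⁅ v₀ ⁆)
    (acyclic : ∀ ω → Supported P ω → (∀ y → ∂ ω y ≈ 0#) → ∃ λ η → Supported P η × (∀ y → ∂ η y ≈ ω y))
    (basis : Basis P v₀) where
    open Basis basis

    ∂-supported : ∀ {ω} → Supported P ω → Supported P (∂ ω)
    ∂-supported ω-on y ¬Py = contract-support _ y λ v v∉y → ω-on (insert v y) (¬Py ∘ down v∉y)

    χ-supported : ∀ {x} → P x → Supported P (χ x)
    χ-supported {x} Px y ¬Py = χ-diff x y λ { ≡.refl → ¬Py Px }

    -- Hence ∅ and {v₀} span an acyclic subcomplex, and dividing it out preserves acyclicity; `fill`
    -- carries this out on chains.
    ∂χ-v₀-⊥ : ∂ (χ ⁅ v₀ ⁆) ⊥ ≈ 1#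
    ∂χ-v₀-⊥ = begin
      ∂ (χ ⁅ v₀ ⁆) ⊥  ≡⟨ cong (∂ (χ ⁅ v₀ ⁆)) (delete-⁅⁆ v₀) ⟨
      ∂ (χ ⁅ v₀ ⁆) (delete v₀ ⁅ v₀ ⁆)  ≈⟨ ∂χ-facet v₀ ⁅ v₀ ⁆ (x∈⁅x⁆ v₀) ⟩
      _  ≡⟨ cong ((- 1#) ^_) (position-⁅⁆ v₀) ⟩
      1#  ∎
      where
      open RawSemiring (Semiring.rawSemiring semiring) using (_^_)
      position-⁅⁆ : ∀ {m} (v : Fin m) → position v ⁅ v ⁆ ≡ 0
      position-⁅⁆ {suc m} zero = position-zero {n = m} ⁅ zero ⁆
      position-⁅⁆ (suc v) = position-⁅⁆ v

    ∂χ-v₀ : ∀ y → y ≢ ⊥ → ∂ (χ ⁅ v₀ ⁆) y ≈ 0#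
    ∂χ-v₀ y y≢⊥ = ∂χ-nonfacet ⁅ v₀ ⁆ y λ v v∈ y≡ → y≢⊥ (≡.trans y≡
      (≡.trans (cong (λ u → delete u ⁅ v₀ ⁆) (x∈⁅y⁆⇒x≡y v₀ v∈)) (delete-⁅⁆ v₀)))

    -- The defect of a relative cycle is a multiple of ∅, which {v₀} compensates.
    fill : ∀ ω → Supported P ω → (∀ y → y ≢ ⊥ → y ≢ ⁅ v₀ ⁆ → ∂ ω y ≈ 0#) →
           ∃ λ η → Supported P η × (∀ y → y ≢ ⁅ v₀ ⁆ → ∂ η y ≈ ω y)
    fill ω ω-on ∂ω≈0 = η , η-on , λ y y≢v₀ → begin
      ∂ η y  ≈⟨ ∂η≈ y ⟩
      ω y - ∂ ω ⊥ * χ ⁅ v₀ ⁆ y  ≈⟨ +-congˡ (trans (-‿cong (trans (*-congˡ (χ-diff ⁅ v₀ ⁆ y (y≢v₀ ∘ ≡.sym))) (zeroʳ _))) -0#≈0#) ⟩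
      ω y + 0#  ≈⟨ +-identityʳ _ ⟩
      ω y  ∎
      where
      a = ∂ ω ⁅ v₀ ⁆
      b = ∂ ω ⊥
      ∂ω≈aχ : ∀ x → ∣ x ∣ ≡ suc ∣ ⊥ {n} ∣ → ∂ ω x ≈ a * χ ⁅ v₀ ⁆ x
      ∂ω≈aχ x size with x ≟ˢ ⁅ v₀ ⁆
      ... | yes ≡.refl = sym (trans (*-congˡ (χ-same x)) (*-identityʳ _))
      ... | no  x≢v₀   = trans (∂ω≈0 x (λ { ≡.refl → ℕₚ.1+n≢n (≡.sym size) }) x≢v₀)
        (sym (trans (*-congˡ (χ-diff ⁅ v₀ ⁆ x (x≢v₀ ∘ ≡.sym))) (zeroʳ a)))
      a≈0 : a ≈ 0#
      -- On singletons ∂ω is concentrated at {v₀}, so the value of ∂∂ω at ∅ is `a`.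
      a≈0 = begin
        a  ≈⟨ trans (*-congˡ ∂χ-v₀-⊥) (*-identityʳ a) ⟨
        a * ∂ (χ ⁅ v₀ ⁆) ⊥  ≈⟨ contract-scale _ a (χ ⁅ v₀ ⁆) ⊥ ⟨
        ∂ (λ x → a * χ ⁅ v₀ ⁆ x) ⊥  ≈⟨ ∂-local ⊥ ∂ω≈aχ ⟨
        ∂ (∂ ω) ⊥  ≈⟨ ∂∂≐0 ω ⊥ ⟩
        0#  ∎
      ω′ : Λ n
      ω′ x = ω x - b * χ ⁅ v₀ ⁆ x
      ∂ω′≈ : ∀ y → ∂ ω′ y ≈ ∂ ω y - b * ∂ (χ ⁅ v₀ ⁆) y
      ∂ω′≈ y = trans (contract-minus _ ω _ y) (+-congˡ (-‿cong (contract-scale _ b (χ ⁅ v₀ ⁆) y)))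
      ω′-cycle : ∀ y → ∂ ω′ y ≈ 0#
      ω′-cycle y with y ≟ˢ ⊥
      ... | yes ≡.refl = trans (∂ω′≈ y) (trans (+-congˡ (-‿cong (trans (*-congˡ ∂χ-v₀-⊥) (*-identityʳ b)))) (-‿inverseʳ b))
      ... | no y≢⊥ = trans (∂ω′≈ y) (trans
        (+-cong ∂ω≈ (trans (-‿cong (trans (*-congˡ (∂χ-v₀ y y≢⊥)) (zeroʳ b))) -0#≈0#)) (+-identityʳ _))
        where
        ∂ω≈ : ∂ ω y ≈ 0#
        ∂ω≈ with y ≟ˢ ⁅ v₀ ⁆
        ... | yes ≡.refl = a≈0
        ... | no  y≢v₀   = ∂ω≈0 y y≢⊥ y≢v₀
      filling = acyclic ω′
        (λ x ¬Px → trans (+-cong (ω-on x ¬Px) (trans (-‿cong (trans (*-congˡ (χ-supported P-v₀ x ¬Px)) (zeroʳ b))) -0#≈0#)) (+-identityʳ _))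
        ω′-cycle
      η = proj₁ filling
      η-on = proj₁ (proj₂ filling)
      ∂η≈ = proj₂ (proj₂ filling)

    chain : ∀ k → (Fin (rank k) → Carrier) → Λ n
    chain k f x = ∑ λ i → f i * χ (β k i) x

    chain-off : ∀ k f x → (∀ i → β k i ≢ x) → chain k f x ≈ 0#
    chain-off k f x β≢x = ∑-zero _ λ i → trans (*-congˡ (χ-diff (β k i) x (β≢x i))) (zeroʳ _)

    chain-β : ∀ k f j → chain k f (β k j) ≈ f j
    chain-β k f j = trans (∑-cong λ i → *-congˡ (χ≈𝟙 i)) (∑-𝟙ʳ j f)
      where
      χ≈𝟙 : ∀ i → χ (β k i) (β k j) ≈ 𝟙 i j
      χ≈𝟙 i with i ≟ᶠ j
      ... | yes ≡.refl = trans (χ-same (β k i)) (reflexive (≡.sym (𝟙-diag i)))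
      ... | no  i≢j    = trans (χ-diff (β k i) (β k j) (i≢j ∘ injective k)) (reflexive (≡.sym (𝟙-offdiag i≢j)))

    chain-supported : ∀ k f → Supported P (chain k f)
    chain-supported k f x ¬Px = chain-off k f x λ { i ≡.refl → ¬Px (member k i) }

    chain-restrict : ∀ k {ω} → Supported P ω → ∀ x → ∣ x ∣ ≡ suc k → x ≢ ⁅ v₀ ⁆ → chain k (ω ∘ β k) x ≈ ω x
    chain-restrict k {ω} ω-on x size-x x≢v₀ with any? (λ i → β k i ≟ˢ x)
    ... | yes (i , ≡.refl) = chain-β k (ω ∘ β k) i
    ... | no  ∄i = trans (chain-off k (ω ∘ β k) x λ i β≡x → ∄i (i , β≡x))
      (sym (ω-on x λ Px → ∄i (complete k Px size-x x≢v₀)))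

    -- One matrix read in two ways: on column vectors it is the coboundary, a block of the Dirac
    -- operator; on row vectors it is the boundary, to which acyclicity applies.
    e : ∀ k → Matrix (rank (suc k)) (rank k)
    e k i j = ∂ (χ (β (suc k) i)) (β k j)

    ∂-chain : ∀ k f j → ∂ (chain (suc k) f) (β k j) ≈ ∑ λ i → f i * e k i j
    ∂-chain k f j = contract-∑ _ f (λ i → χ (β (suc k) i)) (β k j)

    -- The boundary at `β k j` only involves members of `P` of size k + 2. None of these is {v₀}, so
    -- the basis contains them all and the restriction to it loses nothing.
    ∂-restrict : ∀ k {ω} → Supported P ω → ∀ j → ∑ (λ i → ω (β (suc k) i) * e k i j) ≈ ∂ ω (β k j)
    ∂-restrict k {ω} ω-on j = trans (sym (∂-chain k (ω ∘ β (suc k)) j))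
      (∂-local (β k j) λ x size-x →
        let size-x′ = ≡.trans size-x (cong suc (size k j)) in
        chain-restrict (suc k) ω-on x size-x′ λ x≡v₀ →
          ℕₚ.1+n≢0 (ℕₚ.suc-injective (≡.trans (≡.sym size-x′) (≡.trans (cong ∣_∣ x≡v₀) (∣⁅x⁆∣≡1 v₀)))))

    ee : ∀ k → e (suc k) · e k ≋ 𝟘
    ee k i l = trans (∂-restrict k (∂-supported (χ-supported (member (suc (suc k)) i))) l)
      (∂∂≐0 (χ (β (suc (suc k)) i)) (β k l))

    exact-from : ∀ k f → (∀ y → y ≢ ⊥ → y ≢ ⁅ v₀ ⁆ → ∂ (chain k f) y ≈ 0#) →
                 ∃ λ (g : Fin (rank (suc k)) → Carrier) → ∀ j → ∑ (λ i → g i * e k i j) ≈ f j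
    exact-from k f ∂≈0 =
      let η , η-on , ∂η≈ = fill (chain k f) (chain-supported k f) ∂≈0 in
      η ∘ β (suc k) , λ j → trans (∂-restrict k η-on j) (trans (∂η≈ (β k j) (β≢v₀ k j)) (chain-β k f j))

    ∂-chain-size : ∀ k f y → ∣ y ∣ ≢ k → ∂ (chain k f) y ≈ 0#
    ∂-chain-size k f y ∣y∣≢k = contract-local _ y λ x size-x → chain-off k f x λ { i ≡.refl →
      ∣y∣≢k (ℕₚ.suc-injective (≡.trans (≡.sym size-x) (size k i))) }

    -- The boundary of a chain of vertices sits at ∅, which is divided out, so every vector of
    -- degree zero is a relative cycle.
    exact₀ : ∀ f → ∃ λ (g : Fin (rank 1) → Carrier) → ∀ j → ∑ (λ i → g i * e 0 i j) ≈ f j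
    exact₀ f = exact-from 0 f λ y y≢⊥ _ → ∂-chain-size 0 f y (y≢⊥ ∘ size0)
      where
      size0 : ∀ {y : Subset n} → ∣ y ∣ ≡ 0 → y ≡ ⊥
      size0 {y} ∣y∣≡0 = Empty-unique λ { (v , v∈y) → ℕₚ.1+n≢0 (≡.trans (≡.sym (∣delete∣ v∈y)) ∣y∣≡0) }

    exact : ∀ k f → (∀ j → ∑ (λ i → f i * e k i j) ≈ 0#) →
            ∃ λ (g : Fin (rank (suc (suc k))) → Carrier) → ∀ j → ∑ (λ i → g i * e (suc k) i j) ≈ f j
    exact k f fe≈0 = exact-from (suc k) f ∂≈0
      where
      ∂≈0 : ∀ y → y ≢ ⊥ → y ≢ ⁅ v₀ ⁆ → ∂ (chain (suc k) f) y ≈ 0#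
      ∂≈0 y y≢⊥ y≢v₀ with ∣ y ∣ ℕₚ.≟ suc k
      ... | no  ∣y∣≢ = ∂-chain-size (suc k) f y ∣y∣≢
      ... | yes ∣y∣≡ with any? (λ j → β k j ≟ˢ y)
      ...   | yes (j , ≡.refl) = trans (∂-chain k f j) (fe≈0 j)
      ...   | no  ∄j = ∂-supported (chain-supported (suc k) f) y λ Py → ∄j (complete k Py ∣y∣≡ y≢v₀)

-- The minors A and C of the Dirac operator.

module DiracMinors {c ℓ₁ ℓ₂} (K : HeytingField c ℓ₁ ℓ₂) (charZero : CharZero K)
                   {n N} (G : Graph n) (σ : SimplexOrder G N) where
  open SimplexOrder σ
  open HeytingField K using (heytingCommutativeRing)
  open HeytingCommutativeRing heytingCommutativeRing using (commutativeRing)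
  open CommutativeRing commutativeRing hiding (zero)
  open IntegerMultiples commutativeRing
  open IntegerMatrixImages commutativeRing
  open Subsets
  open import Data.Fin.Base as Fin using (fromℕ; lower₁)
  open import Data.Fin.Properties using (inject₁-injective; inject₁-lower₁; toℕ-injective; toℕ-fromℕ; suc-injective; fromℕ≢inject₁; ≤fromℕ)
  open import Data.Fin.Subset using (Subset; _∈_; _∉_; ⁅_⁆; ⊥; ⊤; ∣_∣; Nonempty)
  open import Data.Vec.Base using () renaming (_∷_ to _∷ᵛ_)
  open import Data.Fin.Subset.Properties using (Empty-unique; x∈⁅x⁆; x∈⁅y⁆⇒x≡y; ∣⁅x⁆∣≡1; ∈⊤)
  import Data.Integer.Properties as ℤₚ
  open import Data.List.Base using (List; _∷_; length; lookup; allFin)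
  open import Data.List.Membership.Propositional.Properties using (∈-filter⁺; ∈-filter⁻; ∈-allFin; ∈-lookup)
  open import Data.List.Properties using (filter-none)
  open import Data.List.Relation.Unary.All as All using ()
  open import Data.List.Relation.Unary.AllPairs using (_∷_)
  open import Data.List.Relation.Unary.Any using (index)
  open import Data.List.Relation.Unary.Any.Properties using (lookup-index)
  open import Data.List.Relation.Unary.Unique.Propositional using (Unique)
  open import Data.List.Relation.Unary.Unique.Propositional.Properties using (filter⁺; allFin⁺)
  import Data.Nat.Properties as ℕₚ
  open import Relation.Binary.Reasoning.Setoid setoid

  private
    ℤ-ring = ℤₚ.+-*-commutativeRing
    module LA = LinearAlgebra K
    module H = Homology ℤ-ring G
    module RC = RelativeComplex ℤ-ring {n}
    open Chains ℤ-ring using (χ; ∂; ∂χ-facet; ∂χ-nonfacet)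

  incidence≈ : ∀ (y x : Subset n) → LA.incidence y x ≈ fromℤ (∂ (χ x) y)
  incidence≈ y x with facet? y x
  ... | yes (v , v∈x , y≡) = begin
    _  ≈⟨ fromℤ-1^ (position v x) ⟨
    _  ≡⟨ cong fromℤ (∂χ-facet v x v∈x) ⟨
    fromℤ (∂ (χ x) (delete v x)) ≡⟨ cong (λ y → fromℤ (∂ (χ x) y)) (≡.trans y≡ (-≡delete x v)) ⟨
    fromℤ (∂ (χ x) y)  ∎
  ... | no ¬facet = reflexive (cong fromℤ (≡.sym (∂χ-nonfacet x y λ v v∈x y≡ →
    ¬facet (v , v∈x , ≡.trans y≡ (≡.sym (-≡delete x v))))))

  -- An entry of the Dirac operator is a sum of two incidences in opposite directions; comparing
  -- sizes removes the one that belongs to d†.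
  incidence-size : ∀ (y x : Subset n) → ∣ x ∣ ≢ suc ∣ y ∣ → LA.incidence y x ≈ 0#
  incidence-size y x size≢ with facet? y x
  ... | yes (v , v∈x , ≡.refl) = contradiction
    (≡.trans (∣delete∣ v∈x) (cong (λ y → suc ∣ y ∣) (≡.sym (-≡delete x v)))) size≢
  ... | no _ = refl

  size≡suc-dim : ∀ (x : Subset n) → Nonempty x → ∣ x ∣ ≡ suc (dim x)
  size≡suc-dim x (v , v∈x) rewrite ∣delete∣ v∈x = ≡.refl

  private
    lookup-injective : ∀ {a} {A : Set a} {xs : List A} → Unique xs → ∀ {i j} → lookup xs i ≡ lookup xs j → i ≡ j
    lookup-injective (x∉ ∷ xs!) {zero}  {zero}  eq = ≡.refl
    lookup-injective {xs = x ∷ xs} (x∉ ∷ xs!) {zero}  {suc j} eq = contradiction eq (All.lookup x∉ (∈-lookup {xs = xs} j))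
    lookup-injective {xs = x ∷ xs} (x∉ ∷ xs!) {suc i} {zero}  eq = contradiction (≡.sym eq) (All.lookup x∉ (∈-lookup {xs = xs} i))
    lookup-injective (x∉ ∷ xs!) {suc i} {suc j} eq = cong suc (lookup-injective xs! eq)

  module _
    {m} (ι : Fin m → Fin N) (ι-injective : ∀ {i j} → ι i ≡ ι j → i ≡ j)
    {P : Subset n → Set} {v₀ : Fin n}
    (P⇒Face : ∀ {x} → P x → H.Face ⊤ x)
    (down : ∀ {v y} → v ∉ y → P (insert v y) → P y)
    (P-v₀ : P ⁅ v₀ ⁆)
    (acyclic : ∀ ω → RC.Supported P ω → H.Cycle ω → ∃ λ η → RC.Supported P η × (∀ y → ∂ η y ≡ ω y))
    (kept : ∀ i → P (simplex (ι i)) × simplex (ι i) ≢ ⁅ v₀ ⁆)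
    (covers : ∀ j → P (simplex j) → simplex j ≢ ⁅ v₀ ⁆ → ∃ λ i → ι i ≡ j)
    where

    private
      T : LA.GradedMatrix n
      T = LA.submatrix (LA.Dirac σ) ι
      open LA.GradedMatrix T using (ofDegree; degree; degree<n)

      rank : ℕ → ℕ
      rank k = length (ofDegree k)

      β : ∀ k → Fin (rank k) → Subset n
      β k i = simplex (ι (lookup (ofDegree k) i))

      β-size : ∀ k i → ∣ β k i ∣ ≡ suc k
      β-size k i = ≡.trans (size≡suc-dim (β k i) (proj₁ (isSimplex _)))
        (cong suc (proj₂ (∈-filter⁻ (λ i → degree i ℕₚ.≟ k) {xs = allFin m} (∈-lookup {xs = ofDegree k} i))))

      basis : RC.Basis P v₀
      basis = record
        { rank      = rank
        ; β         = β
        ; injective = λ k eq → lookup-injective (filter⁺ (λ i → degree i ℕₚ.≟ k) (allFin⁺ m))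
                        (ι-injective (injective eq))
        ; member    = λ k i → proj₁ (kept _)
        ; size      = β-size
        ; β≢v₀      = λ k i → proj₂ (kept _)
        ; complete  = λ k {x} Px size x≢v₀ →
            let
              j , simplex≡x = complete {x} (nonempty x size , λ u∈x v∈x → proj₂ (P⇒Face Px) u∈x v∈x)
              i , ιi≡j = covers j (subst P (≡.sym simplex≡x) Px) (x≢v₀ ∘ ≡.trans (≡.sym simplex≡x))
              simplex-ιi≡x = ≡.trans (cong simplex ιi≡j) simplex≡x
              i∈ = ∈-filter⁺ (λ i → degree i ℕₚ.≟ k) (∈-allFin i)
                     (≡.trans (cong dim simplex-ιi≡x) (cong ℕ.pred size))
            in index i∈ , ≡.trans (cong (simplex ∘ ι) (≡.sym (lookup-index i∈))) simplex-ιi≡x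
        }

      entry≈ : ∀ k i j → LA.GradedMatrix.e T k i j ≈ fromℤ (∂ (χ (β (suc k) i)) (β k j))
      entry≈ k i j = begin
        LA.incidence y x + LA.incidence x y  ≈⟨ +-cong (incidence≈ y x) (incidence-size x y λ eq →
            ℕₚ.<⇒≢ (ℕₚ.m≤n⇒m≤1+n ℕₚ.≤-refl) (ℕₚ.suc-injective
              (≡.trans (≡.sym (β-size k j)) (≡.trans eq (cong suc (β-size (suc k) i)))))) ⟩
        fromℤ (∂ (χ x) y) + 0#  ≈⟨ +-identityʳ _ ⟩
        fromℤ (∂ (χ x) y)  ∎
        where
        x = β (suc k) i
        y = β k j

    -- Both minors are instances: `P` is the family of all faces, or of all but the last facet, and
    -- `ι` enumerates its nonempty members other than {v₀}.
    SDet-minor≈1 : (s : LA.Spectra T) → LA.SDet T s ≈ 1#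
    SDet-minor≈1 = SuperDeterminant.SDet≈1 K charZero T
      (RC.e down P-v₀ acyclic basis)
      entry≈
      (RC.ee down P-v₀ acyclic basis)
      (RC.exact₀ down P-v₀ acyclic basis)
      (RC.exact down P-v₀ acyclic basis)
      -- No simplex has dimension `n`, so the complex is zero in that degree.
      (cong length (filter-none (λ i → degree i ℕₚ.≟ n) {xs = allFin m} (All.tabulate λ {i} _ → ℕₚ.<⇒≢ (degree<n i))))

  Face-down : ∀ {v W y} → H.Face W (insert v y) → H.Face W y
  Face-down (⊆W , adj) = (⊆W ∘ ∈-insert⁺) , λ u∈ w∈ → adj (∈-insert⁺ u∈) (∈-insert⁺ w∈)

  Face-⁅⁆ : ∀ {v} → H.Face ⊤ ⁅ v ⁆
  Face-⁅⁆ {v} = (λ _ → ∈⊤) , λ u∈ w∈ u≢w →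
    contradiction (≡.trans (x∈⁅y⁆⇒x≡y v u∈) (≡.sym (x∈⁅y⁆⇒x≡y v w∈))) u≢w

  simplex-face : ∀ i → H.Face ⊤ (simplex i)
  simplex-face i = (λ _ → ∈⊤) , proj₂ (isSimplex i)

  indexOf : ∀ v → ∃ λ i → simplex i ≡ ⁅ v ⁆
  indexOf v = complete ((v , x∈⁅x⁆ v) , proj₂ Face-⁅⁆)

  size-one : ∀ (x : Subset n) → ∣ x ∣ ≡ 1 → ∃ λ v → x ≡ ⁅ v ⁆
  size-one x size = v , ≡.trans (≡.sym (insert-delete v∈x)) (≡.trans (cong (insert v) delete≡⊥) (insert-⊥ v))
    where
    v   = proj₁ (nonempty x size)
    v∈x = proj₂ (nonempty x size)
    delete≡⊥ : delete v x ≡ ⊥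
    delete≡⊥ = Empty-unique λ { (u , u∈) → ℕₚ.1+n≢0 (≡.trans (≡.sym (∣delete∣ u∈))
      (ℕₚ.suc-injective (≡.trans (≡.sym (∣delete∣ v∈x)) size))) }
    insert-⊥ : ∀ {m} (v : Fin m) → insert v ⊥ ≡ ⁅ v ⁆
    insert-⊥ zero    = ≡.refl
    insert-⊥ (suc v) = cong (_ ∷ᵛ_) (insert-⊥ v)

  -- The first simplex has dimension at most that of any vertex.
  first-vertex : ∀ i → (∀ (j : Fin N) → i Fin.≤ j) → ∃ λ v → simplex i ≡ ⁅ v ⁆
  first-vertex i i-min =
    let
      u , _ = proj₁ (isSimplex i)
      j , simplex-j≡ = indexOf u
      dim≤0 = ℕₚ.≤-trans (monotone (i-min j)) (ℕₚ.≤-reflexive (cong ℕ.pred (≡.trans (cong ∣_∣ simplex-j≡) (∣⁅x⁆∣≡1 u))))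
    in size-one (simplex i) (≡.trans (size≡suc-dim _ (proj₁ (isSimplex i))) (cong suc (ℕₚ.n≤0⇒n≡0 dim≤0)))

  notFirst-injective : ∀ {N} {i j : Fin (ℕ.pred N)} → notFirst {N} i ≡ notFirst j → i ≡ j
  notFirst-injective {suc N} = suc-injective

  notLast-injective : ∀ {N} {i j : Fin (ℕ.pred N)} → notLast {N} i ≡ notLast j → i ≡ j
  notLast-injective {suc N} = inject₁-injective

  -- `notFirst` reduces only for a successor, while the number of simplices is a parameter. The
  -- facts are therefore packaged for every `N`, and an index in `Fin N` excludes zero in
  -- `hasFirst`.
  record First (N : ℕ) : Set where
    field
      first   : Fin N
      minimum : ∀ (j : Fin N) → first Fin.≤ j
      covers  : ∀ j → j ≢ first → ∃ λ i → notFirst {N} i ≡ j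
      avoids  : ∀ i → notFirst {N} i ≢ first

  hasFirst : ∀ {N} → Fin N → First N
  hasFirst {suc N} _ = record
    { first   = zero
    ; minimum = λ _ → ℕ.z≤n
    ; covers  = λ { zero 0≢0 → contradiction ≡.refl 0≢0 ; (suc i) _ → i , ≡.refl }
    ; avoids  = λ _ ()
    }

  record FirstLast (N : ℕ) : Set where
    field
      first   : Fin N
      last    : Fin N
      first≢last : first ≢ last
      minimum : ∀ (j : Fin N) → first Fin.≤ j
      maximum : ∀ (j : Fin N) → j Fin.≤ last
      covers  : ∀ j → j ≢ first → j ≢ last → ∃ λ i → notFirst {N} (notLast i) ≡ j
      avoids  : ∀ i → notFirst {N} (notLast i) ≢ first × notFirst {N} (notLast i) ≢ last

  hasFirstLast : ∀ {N} {i j : Fin N} → i ≢ j → FirstLast N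
  hasFirstLast {suc zero} {zero} {zero} i≢j = contradiction ≡.refl i≢j
  hasFirstLast {suc (suc N)} _ = record
    { first      = zero
    ; last       = suc (fromℕ N)
    ; first≢last = λ ()
    ; minimum    = λ _ → ℕ.z≤n
    ; maximum    = ≤fromℕ
    ; covers     = λ
        { zero    0≢0 _ → contradiction ≡.refl 0≢0
        ; (suc j) _ j≢N → let N≢j = λ N≡j → j≢N (cong suc (toℕ-injective (≡.trans (≡.sym N≡j) (≡.sym (toℕ-fromℕ N))))) in
            lower₁ j N≢j , cong suc (inject₁-lower₁ j N≢j) }
    ; avoids     = λ i → (λ ()) , λ eq → fromℕ≢inject₁ (≡.sym (suc-injective eq))
    }

  SDet-DiracA≈1 : Contractible G → (s : LA.Spectra (LA.DiracA σ)) → LA.SDet (LA.DiracA σ) s ≈ 1#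
  SDet-DiracA≈1 γ = SDet-minor≈1 (notFirst {N}) (notFirst-injective {N}) {P = H.Face ⊤} {v₀ = v₀} (λ F → F) (λ _ → Face-down) Face-⁅⁆
    (H.contractible⇒acyclic γ)
    (λ i → simplex-face _ , λ eq → avoids i (injective (≡.trans eq (≡.sym first≡))))
    (λ j _ j≢v₀ → covers j λ { ≡.refl → j≢v₀ first≡ })
    where
    open First (hasFirst (proj₁ (indexOf (proj₁ (H.contractible-nonempty γ))))) renaming (first to i₀)
    v₀ = proj₁ (first-vertex i₀ minimum)
    first≡ = proj₂ (first-vertex i₀ minimum)

  SDet-DiracC≈1 : ∀ d → Sphere G (suc d) → (s : LA.Spectra (LA.DiracC σ)) → LA.SDet (LA.DiracC σ) s ≈ 1#
  SDet-DiracC≈1 d sphere@(_ , v , _ , γ) =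
    SDet-minor≈1 (notFirst {N} ∘ notLast) (λ eq → notLast-injective {ℕ.pred N} (notFirst-injective {N} eq))
      {P = λ x → H.Face ⊤ x × x ≢ x₀} {v₀ = v₀}
      proj₁
      -- Removing `x₀` keeps the family closed downwards: a face properly containing `x₀` would
      -- exceed the largest possible size.
      (λ { v∉y (F , _) → Face-down F , λ { ≡.refl → ℕₚ.<-irrefl ≡.refl (ℕₚ.≤-trans
         (ℕₚ.≤-reflexive (≡.trans (cong suc (≡.sym x₀-size)) (≡.sym (∣insert∣ v∉y)))) (H.face-bound (suc d) sphere F)) } })
      (Face-⁅⁆ , λ eq → first≢last (injective (≡.trans first≡ eq)))
      (H.punctured-sphere-acyclic (suc d) sphere (simplex-face last) x₀-size)
      (λ i → (simplex-face _ , λ eq → proj₂ (avoids i) (injective eq)) ,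
             λ eq → proj₁ (avoids i) (injective (≡.trans eq (≡.sym first≡))))
      (λ j Pj j≢v₀ → covers j (λ { ≡.refl → j≢v₀ first≡ }) λ { ≡.refl → proj₂ Pj ≡.refl })
    where
    -- The vertex `v` and a vertex of its contractible complement give two simplices, so the first
    -- and the last one are distinct.
    two : proj₁ (indexOf v) ≢ proj₁ (indexOf (proj₁ (H.contractible-nonempty γ)))
    two eq = proj₂ (∈-─⁻ {x = ⊤} (proj₂ (H.contractible-nonempty γ))) (≡.sym (x∈⁅y⁆⇒x≡y _
      (subst (v ∈_) (≡.trans (≡.sym (proj₂ (indexOf v))) (≡.trans (cong simplex eq) (proj₂ (indexOf _)))) (x∈⁅x⁆ v))))
    open FirstLast (hasFirstLast two) renaming (first to i₀)
    v₀ = proj₁ (first-vertex i₀ minimum)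
    first≡ = proj₂ (first-vertex i₀ minimum)
    x₀ = simplex last
    x₀-size : ∣ x₀ ∣ ≡ suc d
    -- Some face has d + 1 vertices, and the last simplex has at least its dimension by monotonicity
    -- of the order; `face-bound` gives the other inequality.
    x₀-size =
      let
        x , F , size = H.facet (suc d) sphere
        i , simplex≡x = complete {x} (nonempty x size , proj₂ F)
        d≤dim = ℕₚ.≤-trans (ℕₚ.≤-reflexive (cong ℕ.pred (≡.trans (≡.sym size) (cong ∣_∣ (≡.sym simplex≡x)))))
                           (monotone (maximum i))
      in ℕₚ.≤-antisym (H.face-bound (suc d) sphere (simplex-face last))
           (ℕₚ.≤-trans (ℕ.s≤s d≤dim) (ℕₚ.≤-reflexive (≡.sym (size≡suc-dim x₀ (proj₁ (isSimplex last))))))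

lemma6 : ∀ {c ℓ₁ ℓ₂} (K : HeytingField c ℓ₁ ℓ₂) → CharZero K →
    ∀ {n N : ℕ} (G : Graph n) (σ : SimplexOrder G N) →
    let open HeytingField K using (_≈_)
        open HeytingField K using (1#)
        open LinearAlgebra K
    in
    ((γ : Contractible G) (s : Spectra (DiracA σ)) →
       φ σ (inj₁ γ) s ≈ SDet (DiracA σ) s × SDet (DiracA σ) s ≈ 1#)
    ×
    ((d : ℕ) (γ : Sphere G (suc d)) (s : Spectra (DiracC σ)) →
       φ σ (inj₂ (suc d , γ)) s ≈ SDet (DiracC σ) s × SDet (DiracC σ) s ≈ 1#)
lemma6 K charZero G σ =
  (λ γ s → HeytingField.refl K , DiracMinors.SDet-DiracA≈1 K charZero G σ γ s) ,
  (λ d γ s → HeytingField.refl K , DiracMinors.SDet-DiracC≈1 K charZero G σ d γ s)
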